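{- The system $\mathsf{RCA}_0^\omega$ proves $\mathsf{Arz}\to\mathsf{NIN}$, where $\mathsf{Arz}$ is Arzelà's convergence theorem for the Riemann integral: let $f$ and $(f_n)_{n\in\mathbb{N}}$ be Riemann integrable functions on $[0,1]$ such that $\lim_{n\to\infty}f_n(x)=f(x)$ for all $x\in[0,1]$; if there is $M\in\mathbb{N}$ such that $|f_n(x)|\le M+1$ for all $n\in\mathbb{N}$ and $x\in[0,1]$, then $\lim_{n\to\infty}\int_0^1 f_n(x)\,dx=\int_0^1 f(x)\,dx$; and $\mathsf{NIN}$ is the statement: for any $Y:[0,1]\to\mathbb{N}$ there are $x,y\in[0,1]$ with $x\neq_{\mathbb{R}}y$ and $Y(x)=Y(y)$.
   Context: Finite types: $0$ is a type (natural numbers), and if $\sigma,\tau$ are types then so is $\sigma\to\tau$; $1:=0\to 0$ and $n+1:=n\to 0$; superscripts indicate types. $\mathsf{L}_\omega$ is the many-sorted language with variables of every finite type, constants $0,1,<_0,+_0,\times_0,=_0$ (with usual meaning), typed combinators $\Pi,\Sigma$, and recursor constants $\mathbf{R}_\sigma$. For $\tau=(\tau_1\to\dots\to\tau_k\to 0)$, $x=_\tau y$ abbreviates $\forall z_1^{\tau_1}\dots z_k^{\tau_k}(xz_1\dots z_k=_0 yz_1\dots z_k)$. $\mathsf{QF\text{ - }AC}^{\sigma,\tau}$ is the schema $(\forall x^\sigma)(\exists y^\tau)A(x,y)\to(\exists Y^{\sigma\to\tau})(\forall x^\sigma)A(x,Y(x))$ for quantifier-free $A$ of $\mathsf{L}_\omega$.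 $\mathsf{RCA}_0^\omega$ (Kohlenbach's base theory, classical logic) has the following axioms: ordered semi-ring axioms for $0,1,<_0,+_0,\times_0$; defining axioms of $\Pi,\Sigma$ (giving $\lambda$-abstraction); $\mathbf{R}_0(f,m,0)=m$ and $\mathbf{R}_0(f,m,n+1)=f(n,\mathbf{R}_0(f,m,n))$; extensionality $x=_\rho y\to\varphi(x)=_\tau\varphi(y)$ for all types $\rho,\tau$; induction for quantifier-free formulas of $\mathsf{L}_\omega$; and $\mathsf{QF\text{ - }AC}^{1,0}$. Finite sequences are coded as usual. Inside this theory a real is a sequence of rationals $(q_n)$ with $|q_n-q_{n+i}|<2^{ -n}$ for all $n,i$; reals $x,y$ represented by $(q_n),(r_n)$ satisfy $x=_{\mathbb{R}}y$ iff $|q_n-r_n|\le 2^{ -n+1}$ for all $n$. Functions on $[0,1]$ or $\mathbb{R}$ with values in $\mathbb{N}$ or $\mathbb{R}$ are objects of the corresponding finite type that map $=_{\mathbb{R}}$-equal reals to equal values. Riemann integrability and the Riemann integral have their usual $\varepsilon$-$\delta$ definition (via Riemann sums over tagged partitions), for arbitrary third-order functions. -}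

module Defs where

open import Data.List using (List; []; _∷_; map)
open import Data.List.Membership.Propositional using (_∈_)
open import Data.List.Relation.Binary.Subset.Propositional using (_⊆_)
open import Data.List.Relation.Binary.Subset.Propositional.Properties using (∷⁺ʳ)
open import Data.List.Relation.Unary.Any using (here; there)
open import Data.Maybe using (Maybe; just; nothing; zipWith)
open import Relation.Binary.PropositionalEquality using (refl)

infixr 30 _⟶_
infixr 25 ↑_ ↑ᶠ_
infixl 20 _·_
infixl 18 _▸_
infixl 16 _*̇_
infixl 15 _+̇_ _∸̇_
infix  12 _∈I _≐_ _≺_ _≼_ _<ℚ_ _≤ℚ_ _=ᴿ_ _≤ᴿ_ _<ᴿ_
infixr 10 ¬̇_
infixr 9  _∧̇_
infixr 8  _∨̇_
infixr 7  _⇒_ ∀[_]_ ∃[_]_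
infixr 5  ƛ_
infix  2  _⊢_ RCA₀ω⊢_

data Ty : Set where
  𝟎   : Ty
  _⟶_ : Ty → Ty → Ty

𝟏 : Ty
𝟏 = 𝟎 ⟶ 𝟎

Cxt : Set
Cxt = List Ty

data Con : Ty → Set where
  zeroᶜ oneᶜ   : Con 𝟎
  plusᶜ timesᶜ : Con (𝟎 ⟶ 𝟎 ⟶ 𝟎)
  Πᶜ : (σ τ : Ty) → Con (σ ⟶ τ ⟶ σ)
  Σᶜ : (ρ σ τ : Ty) → Con ((ρ ⟶ σ ⟶ τ) ⟶ (ρ ⟶ σ) ⟶ ρ ⟶ τ)
  Rᶜ : (σ : Ty) → Con ((𝟎 ⟶ σ ⟶ σ) ⟶ σ ⟶ 𝟎 ⟶ σ)

-- Typed de Bruijn terms; the context lists the types of the free variables.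
data Tm (Γ : Cxt) : Ty → Set where
  var : ∀ {τ} → τ ∈ Γ → Tm Γ τ
  con : ∀ {τ} → Con τ → Tm Γ τ
  _·_ : ∀ {σ τ} → Tm Γ (σ ⟶ τ) → Tm Γ σ → Tm Γ τ

-- Only =₀ and <₀ are primitive predicates.
data Fm (Γ : Cxt) : Set where
  _≐_ _≺_       : Tm Γ 𝟎 → Tm Γ 𝟎 → Fm Γ
  ⊥̇             : Fm Γ
  _∧̇_ _∨̇_ _⇒_   : Fm Γ → Fm Γ → Fm Γ
  ∀[_]_ ∃[_]_   : (σ : Ty) → Fm (σ ∷ Γ) → Fm Γ

¬̇_ : ∀ {Γ} → Fm Γ → Fm Γ
¬̇ φ = φ ⇒ ⊥̇

data QF {Γ : Cxt} : Fm Γ → Set where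
  eq  : ∀ {s t} → QF (s ≐ t)
  lt  : ∀ {s t} → QF (s ≺ t)
  bot : QF ⊥̇
  and : ∀ {φ ψ} → QF φ → QF ψ → QF (φ ∧̇ ψ)
  or  : ∀ {φ ψ} → QF φ → QF ψ → QF (φ ∨̇ ψ)
  imp : ∀ {φ ψ} → QF φ → QF ψ → QF (φ ⇒ ψ)

renT : ∀ {Γ Δ τ} → Γ ⊆ Δ → Tm Γ τ → Tm Δ τ
renT ρ (var x) = var (ρ x)
renT ρ (con c) = con c
renT ρ (t · u) = renT ρ t · renT ρ u

renF : ∀ {Γ Δ} → Γ ⊆ Δ → Fm Γ → Fm Δ
renF ρ (s ≐ t)    = renT ρ s ≐ renT ρ t
renF ρ (s ≺ t)    = renT ρ s ≺ renT ρ t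
renF ρ ⊥̇          = ⊥̇
renF ρ (φ ∧̇ ψ)    = renF ρ φ ∧̇ renF ρ ψ
renF ρ (φ ∨̇ ψ)    = renF ρ φ ∨̇ renF ρ ψ
renF ρ (φ ⇒ ψ)    = renF ρ φ ⇒ renF ρ ψ
renF ρ (∀[ σ ] φ) = ∀[ σ ] renF (∷⁺ʳ σ ρ) φ
renF ρ (∃[ σ ] φ) = ∃[ σ ] renF (∷⁺ʳ σ ρ) φ

↑_ : ∀ {Γ σ τ} → Tm Γ τ → Tm (σ ∷ Γ) τ
↑ t = renT there t

↑ᶠ_ : ∀ {Γ σ} → Fm Γ → Fm (σ ∷ Γ)
↑ᶠ φ = renF there φ

Sub : Cxt → Cxt → Set
Sub Γ Δ = ∀ {τ} → τ ∈ Γ → Tm Δ τ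

_▸_ : ∀ {Γ Δ σ} → Sub Γ Δ → Tm Δ σ → Sub (σ ∷ Γ) Δ
(s ▸ t) (here refl) = t
(s ▸ t) (there x)   = s x

lift : ∀ {Γ Δ σ} → Sub Γ Δ → Sub (σ ∷ Γ) (σ ∷ Δ)
lift s = (λ x → ↑ s x) ▸ var (here refl)

subT : ∀ {Γ Δ τ} → Sub Γ Δ → Tm Γ τ → Tm Δ τ
subT s (var x) = s x
subT s (con c) = con c
subT s (t · u) = subT s t · subT s u

subF : ∀ {Γ Δ} → Sub Γ Δ → Fm Γ → Fm Δ
subF s (t ≐ u)    = subT s t ≐ subT s u
subF s (t ≺ u)    = subT s t ≺ subT s u
subF s ⊥̇          = ⊥̇
subF s (φ ∧̇ ψ)    = subF s φ ∧̇ subF s ψ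
subF s (φ ∨̇ ψ)    = subF s φ ∨̇ subF s ψ
subF s (φ ⇒ ψ)    = subF s φ ⇒ subF s ψ
subF s (∀[ σ ] φ) = ∀[ σ ] subF (lift s) φ
subF s (∃[ σ ] φ) = ∃[ σ ] subF (lift s) φ

_[_] : ∀ {Γ σ} → Fm (σ ∷ Γ) → Tm Γ σ → Fm Γ
φ [ t ] = subF (var ▸ t) φ

v₀ : ∀ {Γ σ} → Tm (σ ∷ Γ) σ
v₀ = var (here refl)

v₁ : ∀ {Γ σ τ} → Tm (τ ∷ σ ∷ Γ) σ
v₁ = ↑ v₀

v₂ : ∀ {Γ σ τ ρ} → Tm (ρ ∷ τ ∷ σ ∷ Γ) σ
v₂ = ↑ v₁

v₃ : ∀ {Γ σ τ ρ π} → Tm (π ∷ ρ ∷ τ ∷ σ ∷ Γ) σ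
v₃ = ↑ v₂

0̇ 1̇ : ∀ {Γ} → Tm Γ 𝟎
0̇ = con zeroᶜ
1̇ = con oneᶜ

_+̇_ _*̇_ : ∀ {Γ} → Tm Γ 𝟎 → Tm Γ 𝟎 → Tm Γ 𝟎
s +̇ t = con plusᶜ · s · t
s *̇ t = con timesᶜ · s · t

_≼_ : ∀ {Γ} → Tm Γ 𝟎 → Tm Γ 𝟎 → Fm Γ
s ≼ t = s ≺ t ∨̇ s ≐ t

Eq : ∀ {Γ} (τ : Ty) → Tm Γ τ → Tm Γ τ → Fm Γ
Eq 𝟎       s t = s ≐ t
Eq (σ ⟶ τ) s t = ∀[ σ ] Eq τ (↑ s · v₀) (↑ t · v₀)

-- Axioms are given in an arbitrary context, with terms in place of their
-- outermost universally quantified variables.  The recursors R_σ belong to the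
-- language at every type, but only R_0 has defining axioms.
data Ax {Γ : Cxt} : Fm Γ → Set where
  +-assoc  : ∀ r s t → Ax ((r +̇ s) +̇ t ≐ r +̇ (s +̇ t))
  +-comm   : ∀ s t   → Ax (s +̇ t ≐ t +̇ s)
  +-zero   : ∀ t     → Ax (t +̇ 0̇ ≐ t)
  *-assoc  : ∀ r s t → Ax ((r *̇ s) *̇ t ≐ r *̇ (s *̇ t))
  *-comm   : ∀ s t   → Ax (s *̇ t ≐ t *̇ s)
  *-one    : ∀ t     → Ax (t *̇ 1̇ ≐ t)
  *-zero   : ∀ t     → Ax (t *̇ 0̇ ≐ 0̇)
  distrib  : ∀ r s t → Ax (r *̇ (s +̇ t) ≐ r *̇ s +̇ r *̇ t)
  <-irrefl : ∀ t     → Ax (¬̇ (t ≺ t))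
  <-trans  : ∀ r s t → Ax (r ≺ s ⇒ s ≺ t ⇒ r ≺ t)
  <-total  : ∀ s t   → Ax (s ≺ t ∨̇ s ≐ t ∨̇ t ≺ s)
  +-mono   : ∀ r s t → Ax (r ≺ s ⇒ r +̇ t ≺ s +̇ t)
  *-mono   : ∀ r s t → Ax (r ≺ s ⇒ 0̇ ≺ t ⇒ r *̇ t ≺ s *̇ t)
  0<1      : Ax (0̇ ≺ 1̇)

  Π-ax : ∀ {σ τ} (x : Tm Γ σ) (y : Tm Γ τ) →
         Ax (Eq σ (con (Πᶜ σ τ) · x · y) x)
  Σ-ax : ∀ {ρ σ τ} (x : Tm Γ (ρ ⟶ σ ⟶ τ)) (y : Tm Γ (ρ ⟶ σ)) (z : Tm Γ ρ) →
         Ax (Eq τ (con (Σᶜ ρ σ τ) · x · y · z) (x · z · (y · z)))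

  R₀-zero : ∀ f m   → Ax (con (Rᶜ 𝟎) · f · m · 0̇ ≐ m)
  R₀-suc  : ∀ f m n → Ax (con (Rᶜ 𝟎) · f · m · (n +̇ 1̇) ≐
                          f · n · (con (Rᶜ 𝟎) · f · m · n))

  ext : ∀ {ρ τ} (φ : Tm Γ (ρ ⟶ τ)) (x y : Tm Γ ρ) →
        Ax (Eq ρ x y ⇒ Eq τ (φ · x) (φ · y))

  -- (λ x → var (there x)) ▸ (v₀ +̇ 1̇) replaces the variable n by n + 1.
  QF-ind : (φ : Fm (𝟎 ∷ Γ)) → QF φ →
           Ax (φ [ 0̇ ] ∧̇
               (∀[ 𝟎 ] (φ ⇒ subF ((λ x → var (there x)) ▸ (v₀ +̇ 1̇)) φ)) ⇒
               ∀[ 𝟎 ] φ)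

  -- In A the variables are v₁ = x and v₀ = y; in the conclusion they are
  -- v₁ = Y and v₀ = x.
  QF-AC¹⁰ : (A : Fm (𝟎 ∷ 𝟏 ∷ Γ)) → QF A →
            Ax ((∀[ 𝟏 ] ∃[ 𝟎 ] A) ⇒
                ∃[ 𝟏 ⟶ 𝟎 ] ∀[ 𝟏 ]
                  subF ((λ x → var (there (there x))) ▸ v₀ ▸ (v₁ · v₀)) A)

data _⊢_ {Γ : Cxt} (H : List (Fm Γ)) : Fm Γ → Set where
  ax  : ∀ {φ} → Ax φ → H ⊢ φ
  hyp : ∀ {φ} → φ ∈ H → H ⊢ φ

  ⇒-intro  : ∀ {φ ψ} → φ ∷ H ⊢ ψ → H ⊢ φ ⇒ ψ
  ⇒-elim   : ∀ {φ ψ} → H ⊢ φ ⇒ ψ → H ⊢ φ → H ⊢ ψ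
  ∧-intro  : ∀ {φ ψ} → H ⊢ φ → H ⊢ ψ → H ⊢ φ ∧̇ ψ
  ∧-elim₁  : ∀ {φ ψ} → H ⊢ φ ∧̇ ψ → H ⊢ φ
  ∧-elim₂  : ∀ {φ ψ} → H ⊢ φ ∧̇ ψ → H ⊢ ψ
  ∨-intro₁ : ∀ {φ ψ} → H ⊢ φ → H ⊢ φ ∨̇ ψ
  ∨-intro₂ : ∀ {φ ψ} → H ⊢ ψ → H ⊢ φ ∨̇ ψ
  ∨-elim   : ∀ {φ ψ χ} → H ⊢ φ ∨̇ ψ → φ ∷ H ⊢ χ → ψ ∷ H ⊢ χ → H ⊢ χ
  raa      : ∀ {φ} → (¬̇ φ) ∷ H ⊢ ⊥̇ → H ⊢ φ

  ∀-intro : ∀ {σ φ} → map ↑ᶠ_ H ⊢ φ → H ⊢ ∀[ σ ] φ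
  ∀-elim  : ∀ {σ φ} → H ⊢ ∀[ σ ] φ → (t : Tm Γ σ) → H ⊢ φ [ t ]
  ∃-intro : ∀ {σ φ} (t : Tm Γ σ) → H ⊢ φ [ t ] → H ⊢ ∃[ σ ] φ
  ∃-elim  : ∀ {σ φ ψ} → H ⊢ ∃[ σ ] φ →
            φ ∷ map ↑ᶠ_ H ⊢ ↑ᶠ ψ → H ⊢ ψ

  =-refl  : ∀ t → H ⊢ t ≐ t
  =-subst : ∀ {s t} (φ : Fm (𝟎 ∷ Γ)) → H ⊢ s ≐ t → H ⊢ φ [ s ] → H ⊢ φ [ t ]

RCA₀ω⊢_ : Fm [] → Set
RCA₀ω⊢ φ = [] ⊢ φ

-- Bracket abstraction: λx.t is Π t whenever x does not occur in t.
strengthen : ∀ {Γ σ τ} → Tm (σ ∷ Γ) τ → Maybe (Tm Γ τ)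
strengthen (var (here _))  = nothing
strengthen (var (there x)) = just (var x)
strengthen (con c)         = just (con c)
strengthen (t · u)         = zipWith _·_ (strengthen t) (strengthen u)

ƛ_ : ∀ {Γ σ τ} → Tm (σ ∷ Γ) τ → Tm Γ (σ ⟶ τ)
ƛ_ {σ = σ} (var (here refl)) = con (Σᶜ σ (σ ⟶ σ) σ) · con (Πᶜ σ (σ ⟶ σ)) · con (Πᶜ σ σ)
ƛ var (there x) = con (Πᶜ _ _) · var x
ƛ con c         = con (Πᶜ _ _) · con c
ƛ (t · u) with strengthen (t · u)
... | just w  = con (Πᶜ _ _) · w
... | nothing = con (Σᶜ _ _ _) · (ƛ t) · (ƛ u)

rec₀ : ∀ {Γ} → Tm Γ (𝟎 ⟶ 𝟎 ⟶ 𝟎) → Tm Γ 𝟎 → Tm Γ 𝟎 → Tm Γ 𝟎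
rec₀ f m n = con (Rᶜ 𝟎) · f · m · n

predᵗ : ∀ {Γ} → Tm Γ 𝟏
predᵗ = con (Rᶜ 𝟎) · (ƛ ƛ v₁) · 0̇

monusᵗ : ∀ {Γ} → Tm Γ (𝟎 ⟶ 𝟎 ⟶ 𝟎)
monusᵗ = con (Rᶜ 𝟎) · (ƛ predᵗ)

_∸̇_ : ∀ {Γ} → Tm Γ 𝟎 → Tm Γ 𝟎 → Tm Γ 𝟎
s ∸̇ t = monusᵗ · s · t

pow2ᵗ : ∀ {Γ} → Tm Γ 𝟏
pow2ᵗ = con (Rᶜ 𝟎) · (ƛ ƛ v₀ +̇ v₀) · 1̇

-- The integer square root: r(n+1) is r(n)+1 if (r(n)+1)² ≤ n+1, else r(n).
rootᵗ : ∀ {Γ} → Tm Γ 𝟏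
rootᵗ = con (Rᶜ 𝟎)
  · (ƛ ƛ v₀ +̇ (1̇ ∸̇ ((v₀ +̇ 1̇) *̇ (v₀ +̇ 1̇) ∸̇ (v₁ +̇ 1̇)))) · 0̇

-- The pairing ⟨m,n⟩ = (m+n)² + m.  Since (m+n)² ≤ ⟨m,n⟩ < (m+n+1)², the root
-- of ⟨m,n⟩ is m+n.
pairᵗ : ∀ {Γ} → Tm Γ (𝟎 ⟶ 𝟎 ⟶ 𝟎)
pairᵗ = ƛ ƛ (v₁ +̇ v₀) *̇ (v₁ +̇ v₀) +̇ v₁

leftᵗ rightᵗ : ∀ {Γ} → Tm Γ 𝟏
leftᵗ  = ƛ v₀ ∸̇ (rootᵗ · v₀) *̇ (rootᵗ · v₀)
rightᵗ = ƛ rootᵗ · v₀ ∸̇ leftᵗ · v₀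

-- The number ⟨⟨a,b⟩,d⟩ codes (a − b)/(d + 1); as the projections
-- are total, every natural number codes a rational.
ratᵗ : ∀ {Γ} → Tm Γ 𝟎 → Tm Γ 𝟎 → Tm Γ 𝟎 → Tm Γ 𝟎
ratᵗ a b d = pairᵗ · (pairᵗ · a · b) · d

pos neg den⁻ den : ∀ {Γ} → Tm Γ 𝟎 → Tm Γ 𝟎
pos q  = leftᵗ · (leftᵗ · q)
neg q  = rightᵗ · (leftᵗ · q)
den⁻ q = rightᵗ · q
den q  = den⁻ q +̇ 1̇

_<ℚ_ _≤ℚ_ : ∀ {Γ} → Tm Γ 𝟎 → Tm Γ 𝟎 → Fm Γ
q <ℚ r = pos q *̇ den r +̇ neg r *̇ den q ≺ pos r *̇ den q +̇ neg q *̇ den r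
q ≤ℚ r = pos q *̇ den r +̇ neg r *̇ den q ≼ pos r *̇ den q +̇ neg q *̇ den r

negℚ absℚ natℚ : ∀ {Γ} → Tm Γ 𝟏
negℚ = ƛ ratᵗ (neg v₀) (pos v₀) (den⁻ v₀)
absℚ = ƛ ratᵗ ((pos v₀ ∸̇ neg v₀) +̇ (neg v₀ ∸̇ pos v₀)) 0̇ (den⁻ v₀)
natℚ = ƛ ratᵗ v₀ 0̇ 0̇

addℚ subℚ mulℚ : ∀ {Γ} → Tm Γ (𝟎 ⟶ 𝟎 ⟶ 𝟎)
addℚ = ƛ ƛ ratᵗ (pos v₁ *̇ den v₀ +̇ pos v₀ *̇ den v₁)
                (neg v₁ *̇ den v₀ +̇ neg v₀ *̇ den v₁)
                (den v₁ *̇ den v₀ ∸̇ 1̇)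
subℚ = ƛ ƛ addℚ · v₁ · (negℚ · v₀)
mulℚ = ƛ ƛ ratᵗ (pos v₁ *̇ pos v₀ +̇ neg v₁ *̇ neg v₀)
                (pos v₁ *̇ neg v₀ +̇ neg v₁ *̇ pos v₀)
                (den v₁ *̇ den v₀ ∸̇ 1̇)

-- 2^{-n} and 2^{-n+1}
2⁻ 2·2⁻ : ∀ {Γ} → Tm Γ 𝟏
2⁻   = ƛ ratᵗ 1̇ 0̇ (pow2ᵗ · v₀ ∸̇ 1̇)
2·2⁻ = ƛ ratᵗ (1̇ +̇ 1̇) 0̇ (pow2ᵗ · v₀ ∸̇ 1̇)

IsReal : ∀ {Γ} → Tm Γ 𝟏 → Fm Γ
IsReal x = ∀[ 𝟎 ] ∀[ 𝟎 ]
  absℚ · (subℚ · (↑ ↑ x · v₁) · (↑ ↑ x · (v₁ +̇ v₀))) <ℚ 2⁻ · v₁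

_=ᴿ_ _≤ᴿ_ _<ᴿ_ : ∀ {Γ} → Tm Γ 𝟏 → Tm Γ 𝟏 → Fm Γ
x =ᴿ y = ∀[ 𝟎 ] absℚ · (subℚ · (↑ x · v₀) · (↑ y · v₀)) ≤ℚ 2·2⁻ · v₀
x ≤ᴿ y = ∀[ 𝟎 ] ↑ x · v₀ ≤ℚ addℚ · (↑ y · v₀) · (2·2⁻ · v₀)
x <ᴿ y = ¬̇ (y ≤ᴿ x)

natᴿ : ∀ {Γ} → Tm Γ (𝟎 ⟶ 𝟏)
natᴿ = ƛ ƛ natℚ · v₁

2⁻ᴿ : ∀ {Γ} → Tm Γ (𝟎 ⟶ 𝟏)
2⁻ᴿ = ƛ ƛ 2⁻ · v₁

absᴿ : ∀ {Γ} → Tm Γ (𝟏 ⟶ 𝟏)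
absᴿ = ƛ ƛ absℚ · (v₁ · v₀)

-- Arguments are evaluated at index n+1 so that the error stays below 2^{-n}.
subᴿ : ∀ {Γ} → Tm Γ (𝟏 ⟶ 𝟏 ⟶ 𝟏)
subᴿ = ƛ ƛ ƛ subℚ · (v₂ · (v₀ +̇ 1̇)) · (v₁ · (v₀ +̇ 1̇))

-- A natural number that is at least |q|.
boundℚ : ∀ {Γ} → Tm Γ 𝟏
boundℚ = ƛ pos v₀ +̇ neg v₀

-- (x y)_n = x_{n+B} y_{n+B}, where B ≥ |x_0| + |y_0| + 2; as B ≤ 2^B, this
-- index keeps the error below 2^{-n}.
mulᴿ : ∀ {Γ} → Tm Γ (𝟏 ⟶ 𝟏 ⟶ 𝟏)
mulᴿ = ƛ ƛ ƛ (ƛ mulℚ · (v₃ · v₀) · (v₂ · v₀))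
  · (v₀ +̇ (boundℚ · (v₂ · 0̇) +̇ boundℚ · (v₁ · 0̇) +̇ 1̇ +̇ 1̇))

-- sumᴿ z k is z_0 + … + z_{k-1}: its n-th approximation adds up the (n+k)-th
-- approximations of the summands, and k 2^{-(n+k)} < 2^{-n}.
sumᴿ : ∀ {Γ} → Tm Γ ((𝟎 ⟶ 𝟏) ⟶ 𝟎 ⟶ 𝟏)
sumᴿ = ƛ ƛ ƛ
  rec₀ (ƛ ƛ addℚ · v₀ · (↑ ↑ v₂ · v₁ · (↑ ↑ v₀ +̇ ↑ ↑ v₁))) (natℚ · 0̇) v₁

_∈I : ∀ {Γ} → Tm Γ 𝟏 → Fm Γ
x ∈I = IsReal x ∧̇ natᴿ · 0̇ ≤ᴿ x ∧̇ x ≤ᴿ natᴿ · 1̇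

I→ℕ : ∀ {Γ} → Tm Γ (𝟏 ⟶ 𝟎) → Fm Γ
I→ℕ Y = ∀[ 𝟏 ] ∀[ 𝟏 ]
  (v₁ ∈I ∧̇ v₀ ∈I ∧̇ v₁ =ᴿ v₀ ⇒ ↑ ↑ Y · v₁ ≐ ↑ ↑ Y · v₀)

I→ℝ : ∀ {Γ} → Tm Γ (𝟏 ⟶ 𝟏) → Fm Γ
I→ℝ f =
  (∀[ 𝟏 ] (v₀ ∈I ⇒ IsReal (↑ f · v₀))) ∧̇
  (∀[ 𝟏 ] ∀[ 𝟏 ]
    (v₁ ∈I ∧̇ v₀ ∈I ∧̇ v₁ =ᴿ v₀ ⇒ ↑ ↑ f · v₁ =ᴿ ↑ ↑ f · v₀))

-- 0 = x_0 ≤ t_0 ≤ x_1 ≤ … ≤ x_{k-1} ≤ t_{k-1} ≤ x_k = 1.  The finite sequences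
-- are given by k and the initial segments of x and t, whose other values are
-- irrelevant.
TaggedPartition : ∀ {Γ} → Tm Γ 𝟎 → Tm Γ (𝟎 ⟶ 𝟏) → Tm Γ (𝟎 ⟶ 𝟏) → Fm Γ
TaggedPartition k x t =
  (∀[ 𝟎 ] (v₀ ≼ ↑ k ⇒ IsReal (↑ x · v₀))) ∧̇
  x · 0̇ =ᴿ natᴿ · 0̇ ∧̇
  x · k =ᴿ natᴿ · 1̇ ∧̇
  (∀[ 𝟎 ] (v₀ ≺ ↑ k ⇒
    IsReal (↑ t · v₀) ∧̇
    ↑ x · v₀ ≤ᴿ ↑ t · v₀ ∧̇
    ↑ t · v₀ ≤ᴿ ↑ x · (v₀ +̇ 1̇)))

Mesh<2⁻ : ∀ {Γ} → Tm Γ 𝟎 → Tm Γ (𝟎 ⟶ 𝟏) → Tm Γ 𝟎 → Fm Γ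
Mesh<2⁻ k x n = ∀[ 𝟎 ] (v₀ ≺ ↑ k ⇒
  subᴿ · (↑ x · (v₀ +̇ 1̇)) · (↑ x · v₀) <ᴿ 2⁻ᴿ · ↑ n)

-- Σ_{i<k} f(t_i) (x_{i+1} − x_i)
riemannSum : ∀ {Γ} → Tm Γ (𝟏 ⟶ 𝟏) → Tm Γ 𝟎 →
             Tm Γ (𝟎 ⟶ 𝟏) → Tm Γ (𝟎 ⟶ 𝟏) → Tm Γ 𝟏
riemannSum f k x t = sumᴿ
  · (ƛ mulᴿ · (↑ f · (↑ t · v₀)) · (subᴿ · (↑ x · (v₀ +̇ 1̇)) · (↑ x · v₀)))
  · k

-- ∀ m ∃ n: every Riemann sum S of mesh < 2^{-n} satisfies |S − J| < 2^{-m}.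
HasIntegral : ∀ {Γ} → Tm Γ (𝟏 ⟶ 𝟏) → Tm Γ 𝟏 → Fm Γ
HasIntegral f J = IsReal J ∧̇
  (∀[ 𝟎 ] ∃[ 𝟎 ] ∀[ 𝟎 ] ∀[ 𝟎 ⟶ 𝟏 ] ∀[ 𝟎 ⟶ 𝟏 ]
    (let m = ↑ ↑ ↑ v₁ ; n = ↑ ↑ ↑ v₀ ; k = v₂ ; x = v₁ ; t = v₀
         f′ = ↑ ↑ ↑ ↑ ↑ f ; J′ = ↑ ↑ ↑ ↑ ↑ J
     in TaggedPartition k x t ∧̇ Mesh<2⁻ k x n ⇒
        absᴿ · (subᴿ · riemannSum f′ k x t · J′) <ᴿ 2⁻ᴿ · m))

RiemannIntegrable : ∀ {Γ} → Tm Γ (𝟏 ⟶ 𝟏) → Fm Γ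
RiemannIntegrable f = I→ℝ f ∧̇ (∃[ 𝟏 ] HasIntegral (↑ f) v₀)

LimitOnI : ∀ {Γ} → Tm Γ (𝟎 ⟶ 𝟏 ⟶ 𝟏) → Tm Γ (𝟏 ⟶ 𝟏) → Fm Γ
LimitOnI F f = ∀[ 𝟏 ] (v₀ ∈I ⇒
  ∀[ 𝟎 ] ∃[ 𝟎 ] ∀[ 𝟎 ]
    (let x = v₃ ; m = v₂ ; N = v₁ ; n = v₀
         F′ = ↑ ↑ ↑ ↑ F ; f′ = ↑ ↑ ↑ ↑ f
     in N ≼ n ⇒ absᴿ · (subᴿ · (F′ · n · x) · (f′ · x)) <ᴿ 2⁻ᴿ · m))

UniformlyBounded : ∀ {Γ} → Tm Γ (𝟎 ⟶ 𝟏 ⟶ 𝟏) → Fm Γ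
UniformlyBounded F = ∃[ 𝟎 ] ∀[ 𝟎 ] ∀[ 𝟏 ]
  (let M = v₂ ; n = v₁ ; x = v₀
   in x ∈I ⇒ absᴿ · (↑ ↑ ↑ F · n · x) ≤ᴿ natᴿ · (M +̇ 1̇))

-- lim ∫ f_n = ∫ f, with J ranging over the reals equal to ∫ f and K over those
-- equal to ∫ f_n; no choice of a sequence of representatives is involved.
IntegralsConverge : ∀ {Γ} → Tm Γ (𝟎 ⟶ 𝟏 ⟶ 𝟏) → Tm Γ (𝟏 ⟶ 𝟏) → Fm Γ
IntegralsConverge F f = ∀[ 𝟏 ] (HasIntegral (↑ f) v₀ ⇒
  ∀[ 𝟎 ] ∃[ 𝟎 ] ∀[ 𝟎 ]
    (let J = v₃ ; m = v₂ ; N = v₁ ; n = v₀ ; F′ = ↑ ↑ ↑ ↑ F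
     in N ≼ n ⇒
        ∀[ 𝟏 ] (HasIntegral (↑ (F′ · n)) v₀ ⇒
          absᴿ · (subᴿ · v₀ · ↑ J) <ᴿ 2⁻ᴿ · ↑ m)))

Arz : Fm []
Arz = ∀[ 𝟏 ⟶ 𝟏 ] ∀[ 𝟎 ⟶ 𝟏 ⟶ 𝟏 ]
  (let f = v₁ ; F = v₀
   in RiemannIntegrable f ∧̇
      (∀[ 𝟎 ] RiemannIntegrable (↑ F · v₀)) ∧̇
      LimitOnI F f ∧̇
      UniformlyBounded F ⇒
      IntegralsConverge F f)

NIN : Fm []
NIN = ∀[ 𝟏 ⟶ 𝟎 ] (I→ℕ v₀ ⇒
  ∃[ 𝟏 ] ∃[ 𝟏 ]
    (let Y = v₂ ; x = v₁ ; y = v₀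
     in x ∈I ∧̇ y ∈I ∧̇ ¬̇ (x =ᴿ y) ∧̇ Y · x ≐ Y · y))

module Submission where

-- Suppose that Y is injective on [0,1] and let f_n(x) be 1 if Y(x) < n and 0
-- otherwise.  Then f_n → 1 pointwise, while f_n is nonzero at no more than n
-- points, so that its integral is 0; by Arz, 0 converges to 1.
--
-- A Riemann sum of f_n is estimated from the approximations of the partition
-- points and tags at one common precision l, and a strict inequality of reals is
-- witnessed at one index.  All inductions are thus on quantifier-free statements
-- about rationals.  The sum of f_{n+1} exceeds that of f_n by the lengths of the
-- intervals whose tag has Y-value n; these tags are equal reals, so the intervals
-- lie within the mesh of a single point.

-- Statements about reals are universal or negations of universal ones, so they cannot be induction
-- formulas; they stay among the hypotheses, from which rational inequalities at precision l are
-- drawn. The errors so incurred grow with the number k of intervals, while the mesh has to be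
-- chosen before k is known. This is harmless because a sum of k reals is evaluated at l = n + k: an
-- error proportional to k·2^-(n+k) is small uniformly in k. Intervals tagged by one point cannot be
-- counted: degenerate intervals are allowed, so there may be any number of them. Their total length
-- is bounded instead, by comparing the growth of the sum with the position of the partition points
-- relative to a rational τ approximating the tag. Whether a tag with the given Y-value exists is
-- not a quantifier-free question; classical logic answers it between the two inductions, on the
-- values of Y and on the intervals, and τ is a parameter of the inner one. The syntactic obstacle
-- is the size of the combinator terms. They are made opaque, formulas are written as templates on
-- which substitution computes, and the concrete terms return at the end.

import Algebra.Solver.CommutativeMonoid as CMSolver
import Algebra.Solver.Ring.NaturalCoefficients.Default as NatSolver
open import Algebra.Bundles using (CommutativeMonoid; CommutativeSemiring)
open import Algebra.Solver.Monoid.Expression using () renaming (_⊕_ to _:⊕_; id to :0)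
open import Data.List using (List; []; _∷_; map)
open import Data.List.Membership.Propositional using (_∈_)
open import Data.List.Membership.Propositional.Properties using (∈-map⁺)
open import Data.List.Properties using (map-∘; map-cong)
open import Data.List.Relation.Binary.Subset.Propositional using (_⊆_)
open import Data.List.Relation.Binary.Subset.Propositional.Properties using (∷⁺ʳ; map⁺)
open import Data.List.Relation.Unary.All using (All; []; _∷_)
open import Data.List.Relation.Unary.Any using (here; there)
open import Data.Maybe using (just; nothing; zipWith)
import Data.Maybe as Maybe
open import Data.Product using (_,_)
open import Level using (0ℓ)
open import Relation.Binary.PropositionalEquality
  using (_≡_; refl; sym; trans; cong; cong₂; subst; subst₂)

open import Defs using (Ty; Cxt; Con; 𝟎; 𝟏; _⟶_)

-- The formulas of Defs over arbitrary operations and syntax.  They are used with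
-- opaque operations, as templates, and with the operations of Defs; in the last
-- case Arz and NIN are literally the sentences of Defs.
module Formulas
  (Term : Cxt → Ty → Set) (Form : Cxt → Set)
  (app  : ∀ {Γ σ τ} → Term Γ (σ ⟶ τ) → Term Γ σ → Term Γ τ)
  (con  : ∀ {Γ τ} → Con τ → Term Γ τ)
  (v₀   : ∀ {Γ σ} → Term (σ ∷ Γ) σ)
  (v₁   : ∀ {Γ σ τ} → Term (τ ∷ σ ∷ Γ) σ)
  (v₂   : ∀ {Γ σ τ ρ} → Term (ρ ∷ τ ∷ σ ∷ Γ) σ)
  (v₃   : ∀ {Γ σ τ ρ π} → Term (π ∷ ρ ∷ τ ∷ σ ∷ Γ) σ)
  (up   : ∀ {Γ σ τ} → Term Γ τ → Term (σ ∷ Γ) τ)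
  (eq less : ∀ {Γ} → Term Γ 𝟎 → Term Γ 𝟎 → Form Γ)
  (⊥̇ : ∀ {Γ} → Form Γ)
  (and or imp : ∀ {Γ} → Form Γ → Form Γ → Form Γ)
  (all ex : ∀ {Γ} (σ : Ty) → Form (σ ∷ Γ) → Form Γ)
  (left right abs 2⁻ 2·2⁻ : ∀ {Γ} → Term Γ 𝟏)
  (add sub : ∀ {Γ} → Term Γ (𝟎 ⟶ 𝟎 ⟶ 𝟎))
  (natᴿ 2⁻ᴿ : ∀ {Γ} → Term Γ (𝟎 ⟶ 𝟏))
  (absᴿ : ∀ {Γ} → Term Γ (𝟏 ⟶ 𝟏))
  (subᴿ : ∀ {Γ} → Term Γ (𝟏 ⟶ 𝟏 ⟶ 𝟏))
  (riemannSum : ∀ {Γ} → Term Γ (𝟏 ⟶ 𝟏) → Term Γ 𝟎 → Term Γ (𝟎 ⟶ 𝟏) → Term Γ (𝟎 ⟶ 𝟏) → Term Γ 𝟏) where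

  infixl 20 _·_
  infix  12 _≐_ _≺_
  infixr 9  _∧̇_
  infixr 8  _∨̇_
  infixr 7  _⇒_ ∀[_]_ ∃[_]_

  private
    _·_ : ∀ {Γ σ τ} → Term Γ (σ ⟶ τ) → Term Γ σ → Term Γ τ
    _·_ = app
    _≐_ _≺_ : ∀ {Γ} → Term Γ 𝟎 → Term Γ 𝟎 → Form Γ
    _≐_ = eq
    _≺_ = less
    _∧̇_ _∨̇_ _⇒_ : ∀ {Γ} → Form Γ → Form Γ → Form Γ
    _∧̇_ = and
    _∨̇_ = or
    _⇒_ = imp
    ∀[_]_ ∃[_]_ : ∀ {Γ} (σ : Ty) → Form (σ ∷ Γ) → Form Γ
    ∀[_]_ = all
    ∃[_]_ = ex

  infixl 16 _*̇_
  infixl 15 _+̇_ _⊕_ _⊖_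
  infix  12 _∈I _≼_ _<ℚ_ _≤ℚ_ _=ᴿ_ _≤ᴿ_ _<ᴿ_
  infixr 10 ¬̇_

  ¬̇_ : ∀ {Γ} → Form Γ → Form Γ
  ¬̇ φ = φ ⇒ ⊥̇

  0̇ 1̇ : ∀ {Γ} → Term Γ 𝟎
  0̇ = con Defs.zeroᶜ
  1̇ = con Defs.oneᶜ

  _+̇_ _*̇_ _⊕_ _⊖_ : ∀ {Γ} → Term Γ 𝟎 → Term Γ 𝟎 → Term Γ 𝟎
  s +̇ t = con Defs.plusᶜ · s · t
  s *̇ t = con Defs.timesᶜ · s · t
  q ⊕ r = add · q · r
  q ⊖ r = sub · q · r

  ∣_∣ : ∀ {Γ} → Term Γ 𝟎 → Term Γ 𝟎
  ∣ q ∣ = abs · q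

  pos neg den : ∀ {Γ} → Term Γ 𝟎 → Term Γ 𝟎
  pos q = left · (left · q)
  neg q = right · (left · q)
  den q = right · q +̇ 1̇

  _≼_ _<ℚ_ _≤ℚ_ : ∀ {Γ} → Term Γ 𝟎 → Term Γ 𝟎 → Form Γ
  s ≼ t = (s ≺ t) ∨̇ (s ≐ t)
  q <ℚ r = pos q *̇ den r +̇ neg r *̇ den q ≺ pos r *̇ den q +̇ neg q *̇ den r
  q ≤ℚ r = pos q *̇ den r +̇ neg r *̇ den q ≼ pos r *̇ den q +̇ neg q *̇ den r

  -- The type τ is given in the form that it has in Defs, which keeps the
  -- comparison with Defs syntactic.
  upᶠ : ∀ {Γ ρ σ τ} → Term Γ (σ ⟶ τ) → Term (ρ ∷ Γ) (σ ⟶ τ)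
  upᶠ {σ = σ} {τ} = up {τ = σ ⟶ τ}

  IsReal : ∀ {Γ} → Term Γ 𝟏 → Form Γ
  IsReal x = ∀[ 𝟎 ] ∀[ 𝟎 ] (∣ upᶠ (upᶠ x) · v₁ ⊖ upᶠ (upᶠ x) · (v₁ +̇ v₀) ∣ <ℚ 2⁻ · v₁)

  _=ᴿ_ _≤ᴿ_ _<ᴿ_ : ∀ {Γ} → Term Γ 𝟏 → Term Γ 𝟏 → Form Γ
  x =ᴿ y = ∀[ 𝟎 ] (∣ upᶠ x · v₀ ⊖ upᶠ y · v₀ ∣ ≤ℚ 2·2⁻ · v₀)
  x ≤ᴿ y = ∀[ 𝟎 ] (upᶠ x · v₀ ≤ℚ upᶠ y · v₀ ⊕ 2·2⁻ · v₀)
  x <ᴿ y = ¬̇ (y ≤ᴿ x)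

  _∈I : ∀ {Γ} → Term Γ 𝟏 → Form Γ
  x ∈I = IsReal x ∧̇ natᴿ · 0̇ ≤ᴿ x ∧̇ x ≤ᴿ natᴿ · 1̇

  I→ℕ : ∀ {Γ} → Term Γ (𝟏 ⟶ 𝟎) → Form Γ
  I→ℕ Y = ∀[ 𝟏 ] ∀[ 𝟏 ] (v₁ ∈I ∧̇ v₀ ∈I ∧̇ v₁ =ᴿ v₀ ⇒ (up (up Y)) · v₁ ≐ (up (up Y)) · v₀)

  I→ℝ : ∀ {Γ} → Term Γ (𝟏 ⟶ 𝟏) → Form Γ
  I→ℝ f =
    (∀[ 𝟏 ] (v₀ ∈I ⇒ IsReal ((up f) · v₀))) ∧̇
    (∀[ 𝟏 ] ∀[ 𝟏 ] (v₁ ∈I ∧̇ v₀ ∈I ∧̇ v₁ =ᴿ v₀ ⇒ (up (up f)) · v₁ =ᴿ (up (up f)) · v₀))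

  TaggedPartition : ∀ {Γ} → Term Γ 𝟎 → Term Γ (𝟎 ⟶ 𝟏) → Term Γ (𝟎 ⟶ 𝟏) → Form Γ
  TaggedPartition k x t =
    (∀[ 𝟎 ] (v₀ ≼ (up k) ⇒ IsReal ((up x) · v₀))) ∧̇
    x · 0̇ =ᴿ natᴿ · 0̇ ∧̇
    x · k =ᴿ natᴿ · 1̇ ∧̇
    (∀[ 𝟎 ] (v₀ ≺ (up k) ⇒
      IsReal ((up t) · v₀) ∧̇
      (up x) · v₀ ≤ᴿ (up t) · v₀ ∧̇
      (up t) · v₀ ≤ᴿ (up x) · (v₀ +̇ 1̇)))

  Mesh<2⁻ : ∀ {Γ} → Term Γ 𝟎 → Term Γ (𝟎 ⟶ 𝟏) → Term Γ 𝟎 → Form Γ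
  Mesh<2⁻ k x n = ∀[ 𝟎 ] (v₀ ≺ (up k) ⇒ subᴿ · ((up x) · (v₀ +̇ 1̇)) · ((up x) · v₀) <ᴿ 2⁻ᴿ · (up n))

  SumsWithin : ∀ {Γ} → Term Γ (𝟏 ⟶ 𝟏) → Term Γ 𝟏 → Term Γ 𝟎 → Term Γ 𝟎 → Form Γ
  SumsWithin f J m n = ∀[ 𝟎 ] ∀[ 𝟎 ⟶ 𝟏 ] ∀[ 𝟎 ⟶ 𝟏 ]
    (TaggedPartition v₂ v₁ v₀ ∧̇ Mesh<2⁻ v₂ v₁ ((up (up (up n)))) ⇒
     absᴿ · (subᴿ · riemannSum ((up (up (up f)))) v₂ v₁ v₀ · (up (up (up J)))) <ᴿ 2⁻ᴿ · (up (up (up m))))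

  HasIntegral : ∀ {Γ} → Term Γ (𝟏 ⟶ 𝟏) → Term Γ 𝟏 → Form Γ
  HasIntegral f J = IsReal J ∧̇ (∀[ 𝟎 ] ∃[ 𝟎 ] SumsWithin ((up (up f))) ((up (up J))) v₁ v₀)

  RiemannIntegrable : ∀ {Γ} → Term Γ (𝟏 ⟶ 𝟏) → Form Γ
  RiemannIntegrable f = I→ℝ f ∧̇ (∃[ 𝟏 ] HasIntegral ((up f)) v₀)

  CloseFrom : ∀ {Γ} → Term Γ (𝟎 ⟶ 𝟏 ⟶ 𝟏) → Term Γ (𝟏 ⟶ 𝟏) → Term Γ 𝟏 → Term Γ 𝟎 → Term Γ 𝟎 → Form Γ
  CloseFrom F f x m N = ∀[ 𝟎 ] ((up N) ≼ v₀ ⇒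
    absᴿ · (subᴿ · ((up F) · v₀ · (up x)) · ((up f) · (up x))) <ᴿ 2⁻ᴿ · (up m))

  LimitOnI : ∀ {Γ} → Term Γ (𝟎 ⟶ 𝟏 ⟶ 𝟏) → Term Γ (𝟏 ⟶ 𝟏) → Form Γ
  LimitOnI F f = ∀[ 𝟏 ] (v₀ ∈I ⇒ ∀[ 𝟎 ] ∃[ 𝟎 ] CloseFrom ((up (up (up F)))) ((up (up (up f)))) v₂ v₁ v₀)

  BoundedBy : ∀ {Γ} → Term Γ (𝟎 ⟶ 𝟏 ⟶ 𝟏) → Term Γ 𝟎 → Form Γ
  BoundedBy F M = ∀[ 𝟎 ] ∀[ 𝟏 ]
    (v₀ ∈I ⇒ absᴿ · ((up (up F)) · v₁ · v₀) ≤ᴿ natᴿ · ((up (up M)) +̇ 1̇))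

  UniformlyBounded : ∀ {Γ} → Term Γ (𝟎 ⟶ 𝟏 ⟶ 𝟏) → Form Γ
  UniformlyBounded F = ∃[ 𝟎 ] BoundedBy ((up F)) v₀

  IntegralsCloseAt : ∀ {Γ} → Term Γ (𝟎 ⟶ 𝟏 ⟶ 𝟏) → Term Γ 𝟏 → Term Γ 𝟎 → Term Γ 𝟎 → Form Γ
  IntegralsCloseAt F J m n = ∀[ 𝟏 ] (HasIntegral (up (app F n)) v₀ ⇒
    absᴿ · (subᴿ · v₀ · (up J)) <ᴿ 2⁻ᴿ · (up m))

  IntegralsConverge : ∀ {Γ} → Term Γ (𝟎 ⟶ 𝟏 ⟶ 𝟏) → Term Γ (𝟏 ⟶ 𝟏) → Form Γ
  IntegralsConverge F f = ∀[ 𝟏 ] (HasIntegral ((up f)) v₀ ⇒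
    ∀[ 𝟎 ] ∃[ 𝟎 ] ∀[ 𝟎 ] (v₁ ≼ v₀ ⇒ IntegralsCloseAt ((up (up (up (up F))))) v₃ v₂ v₀))

  Arz : Form []
  Arz = ∀[ 𝟏 ⟶ 𝟏 ] ∀[ 𝟎 ⟶ 𝟏 ⟶ 𝟏 ]
    (RiemannIntegrable v₁ ∧̇ (∀[ 𝟎 ] RiemannIntegrable (app (up {τ = 𝟎 ⟶ (𝟏 ⟶ 𝟏)} v₀) v₀)) ∧̇
     LimitOnI v₀ v₁ ∧̇ UniformlyBounded v₀ ⇒ IntegralsConverge v₀ v₁)

  NIN : Form []
  NIN = ∀[ 𝟏 ⟶ 𝟎 ] (I→ℕ v₀ ⇒
    ∃[ 𝟏 ] ∃[ 𝟏 ] (v₁ ∈I ∧̇ v₀ ∈I ∧̇ ¬̇ (v₁ =ᴿ v₀) ∧̇ v₂ · v₁ ≐ v₂ · v₀))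

open import Defs hiding
  ( pos; neg; den; _<ℚ_; _≤ℚ_; IsReal; _=ᴿ_; _≤ᴿ_; _<ᴿ_; _∈I; I→ℕ; I→ℝ; TaggedPartition; Mesh<2⁻; HasIntegral
  ; RiemannIntegrable; LimitOnI; UniformlyBounded; IntegralsConverge; Arz; NIN )

-- Substitution calculus for terms and formulas.

infix 4 _≗ₛ_
_≗ₛ_ : ∀ {Γ Δ} → Sub Γ Δ → Sub Γ Δ → Set
_≗ₛ_ {Γ} s s′ = ∀ {τ} (x : τ ∈ Γ) → s x ≡ s′ x

renₛ : ∀ {Γ Δ} → Γ ⊆ Δ → Sub Γ Δ
renₛ ρ x = var (ρ x)

infixr 20 _∘ₛ_
_∘ₛ_ : ∀ {Γ Δ Θ} → Sub Δ Θ → Sub Γ Δ → Sub Γ Θ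
(s′ ∘ₛ s) x = subT s′ (s x)

lift-cong : ∀ {Γ Δ σ} {s s′ : Sub Γ Δ} → s ≗ₛ s′ → lift {σ = σ} s ≗ₛ lift s′
lift-cong e (here refl) = refl
lift-cong e (there x)   = cong ↑_ (e x)

subT-cong : ∀ {Γ Δ τ} {s s′ : Sub Γ Δ} → s ≗ₛ s′ → (t : Tm Γ τ) → subT s t ≡ subT s′ t
subT-cong e (var x) = e x
subT-cong e (con c) = refl
subT-cong e (t · u) = cong₂ _·_ (subT-cong e t) (subT-cong e u)

subF-cong : ∀ {Γ Δ} {s s′ : Sub Γ Δ} → s ≗ₛ s′ → (φ : Fm Γ) → subF s φ ≡ subF s′ φ
subF-cong e (s ≐ t)    = cong₂ _≐_ (subT-cong e s) (subT-cong e t)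
subF-cong e (s ≺ t)    = cong₂ _≺_ (subT-cong e s) (subT-cong e t)
subF-cong e ⊥̇          = refl
subF-cong e (φ ∧̇ ψ)    = cong₂ _∧̇_ (subF-cong e φ) (subF-cong e ψ)
subF-cong e (φ ∨̇ ψ)    = cong₂ _∨̇_ (subF-cong e φ) (subF-cong e ψ)
subF-cong e (φ ⇒ ψ)    = cong₂ _⇒_ (subF-cong e φ) (subF-cong e ψ)
subF-cong e (∀[ σ ] φ) = cong (∀[ σ ]_) (subF-cong (lift-cong e) φ)
subF-cong e (∃[ σ ] φ) = cong (∃[ σ ]_) (subF-cong (lift-cong e) φ)

renT-sub : ∀ {Γ Δ τ} (ρ : Γ ⊆ Δ) (t : Tm Γ τ) → renT ρ t ≡ subT (renₛ ρ) t
renT-sub ρ (var x) = refl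
renT-sub ρ (con c) = refl
renT-sub ρ (t · u) = cong₂ _·_ (renT-sub ρ t) (renT-sub ρ u)

lift-ren : ∀ {Γ Δ σ} (ρ : Γ ⊆ Δ) → renₛ (∷⁺ʳ σ ρ) ≗ₛ lift (renₛ ρ)
lift-ren ρ (here refl) = refl
lift-ren ρ (there x)   = refl

renF-sub : ∀ {Γ Δ} (ρ : Γ ⊆ Δ) (φ : Fm Γ) → renF ρ φ ≡ subF (renₛ ρ) φ
renF-sub ρ (s ≐ t)    = cong₂ _≐_ (renT-sub ρ s) (renT-sub ρ t)
renF-sub ρ (s ≺ t)    = cong₂ _≺_ (renT-sub ρ s) (renT-sub ρ t)
renF-sub ρ ⊥̇          = refl
renF-sub ρ (φ ∧̇ ψ)    = cong₂ _∧̇_ (renF-sub ρ φ) (renF-sub ρ ψ)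
renF-sub ρ (φ ∨̇ ψ)    = cong₂ _∨̇_ (renF-sub ρ φ) (renF-sub ρ ψ)
renF-sub ρ (φ ⇒ ψ)    = cong₂ _⇒_ (renF-sub ρ φ) (renF-sub ρ ψ)
renF-sub ρ (∀[ σ ] φ) = cong (∀[ σ ]_) (trans (renF-sub _ φ) (subF-cong (lift-ren ρ) φ))
renF-sub ρ (∃[ σ ] φ) = cong (∃[ σ ]_) (trans (renF-sub _ φ) (subF-cong (lift-ren ρ) φ))

subT-renT : ∀ {Γ Δ Θ τ} (s : Sub Δ Θ) (ρ : Γ ⊆ Δ) (t : Tm Γ τ) →
            subT s (renT ρ t) ≡ subT (λ x → s (ρ x)) t
subT-renT s ρ (var x) = refl
subT-renT s ρ (con c) = refl
subT-renT s ρ (t · u) = cong₂ _·_ (subT-renT s ρ t) (subT-renT s ρ u)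

subT-subT : ∀ {Γ Δ Θ τ} (s′ : Sub Δ Θ) (s : Sub Γ Δ) (t : Tm Γ τ) →
            subT s′ (subT s t) ≡ subT (s′ ∘ₛ s) t
subT-subT s′ s (var x) = refl
subT-subT s′ s (con c) = refl
subT-subT s′ s (t · u) = cong₂ _·_ (subT-subT s′ s t) (subT-subT s′ s u)

subT-var : ∀ {Γ τ} (t : Tm Γ τ) → subT var t ≡ t
subT-var (var x) = refl
subT-var (con c) = refl
subT-var (t · u) = cong₂ _·_ (subT-var t) (subT-var u)

subT-lift-↑ : ∀ {Γ Δ σ τ} (s : Sub Γ Δ) (t : Tm Γ τ) → subT (lift {σ = σ} s) (↑ t) ≡ ↑ subT s t
subT-lift-↑ s t =
  trans (subT-renT (lift s) there t)
  (trans (subT-cong (λ x → renT-sub there (s x)) t)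
  (trans (sym (subT-subT (renₛ there) s t)) (sym (renT-sub there _))))

subT-▸-↑ : ∀ {Γ Δ σ τ} (s : Sub Γ Δ) (u : Tm Δ σ) (t : Tm Γ τ) → subT (s ▸ u) (↑ t) ≡ subT s t
subT-▸-↑ s u t = subT-renT (s ▸ u) there t

[]-↑ : ∀ {Γ σ τ} (u : Tm Γ σ) (t : Tm Γ τ) → subT (var ▸ u) (↑ t) ≡ t
[]-↑ u t = trans (subT-▸-↑ var u t) (subT-var t)

lift-∘ : ∀ {Γ Δ Θ σ} (s′ : Sub Δ Θ) (s : Sub Γ Δ) → lift {σ = σ} s′ ∘ₛ lift s ≗ₛ lift (s′ ∘ₛ s)
lift-∘ s′ s (here refl) = refl
lift-∘ s′ s (there x)   = subT-lift-↑ s′ (s x)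

subF-subF : ∀ {Γ Δ Θ} (s′ : Sub Δ Θ) (s : Sub Γ Δ) (φ : Fm Γ) →
            subF s′ (subF s φ) ≡ subF (s′ ∘ₛ s) φ
subF-subF s′ s (t ≐ u)    = cong₂ _≐_ (subT-subT s′ s t) (subT-subT s′ s u)
subF-subF s′ s (t ≺ u)    = cong₂ _≺_ (subT-subT s′ s t) (subT-subT s′ s u)
subF-subF s′ s ⊥̇          = refl
subF-subF s′ s (φ ∧̇ ψ)    = cong₂ _∧̇_ (subF-subF s′ s φ) (subF-subF s′ s ψ)
subF-subF s′ s (φ ∨̇ ψ)    = cong₂ _∨̇_ (subF-subF s′ s φ) (subF-subF s′ s ψ)
subF-subF s′ s (φ ⇒ ψ)    = cong₂ _⇒_ (subF-subF s′ s φ) (subF-subF s′ s ψ)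
subF-subF s′ s (∀[ σ ] φ) =
  cong (∀[ σ ]_) (trans (subF-subF (lift s′) (lift s) φ) (subF-cong (lift-∘ s′ s) φ))
subF-subF s′ s (∃[ σ ] φ) =
  cong (∃[ σ ]_) (trans (subF-subF (lift s′) (lift s) φ) (subF-cong (lift-∘ s′ s) φ))

-- Turns interchange laws for substitutions in formulas into checks on variables; instantiation,
-- weakening and both axiom schemes are moved past a substitution in this way.
subF-comm : ∀ {Γ Δ Δ′ Θ} {s′ : Sub Δ Θ} {s : Sub Γ Δ} {r′ : Sub Δ′ Θ} {r : Sub Γ Δ′} →
            s′ ∘ₛ s ≗ₛ r′ ∘ₛ r → (φ : Fm Γ) → subF s′ (subF s φ) ≡ subF r′ (subF r φ)
subF-comm {s′ = s′} {s} {r′} {r} e φ =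
  trans (subF-subF s′ s φ) (trans (subF-cong e φ) (sym (subF-subF r′ r φ)))

subF-[] : ∀ {Γ Δ σ} (s : Sub Γ Δ) (φ : Fm (σ ∷ Γ)) (t : Tm Γ σ) →
          subF s (φ [ t ]) ≡ subF (lift s) φ [ subT s t ]
subF-[] s φ t = subF-comm {s′ = s} {var ▸ t} {var ▸ subT s t} {lift s}
  (λ { (here refl) → refl ; (there x) → sym ([]-↑ (subT s t) (s x)) }) φ

subF-↑ : ∀ {Γ Δ σ} (s : Sub Γ Δ) (φ : Fm Γ) → subF (lift {σ = σ} s) (↑ᶠ φ) ≡ ↑ᶠ subF s φ
subF-↑ s φ =
  trans (cong (subF (lift s)) (renF-sub there φ))
  (trans (subF-comm {s′ = lift s} {renₛ there} {renₛ there} {s}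
           (λ x → renT-sub there (s x)) φ)
         (sym (renF-sub there (subF s φ))))

subF-QF : ∀ {Γ Δ} (s : Sub Γ Δ) {φ : Fm Γ} → QF φ → QF (subF s φ)
subF-QF s eq        = eq
subF-QF s lt        = lt
subF-QF s bot       = bot
subF-QF s (and p q) = and (subF-QF s p) (subF-QF s q)
subF-QF s (or p q)  = or (subF-QF s p) (subF-QF s q)
subF-QF s (imp p q) = imp (subF-QF s p) (subF-QF s q)

subF-Eq : ∀ {Γ Δ} (s : Sub Γ Δ) τ (t u : Tm Γ τ) → subF s (Eq τ t u) ≡ Eq τ (subT s t) (subT s u)
subF-Eq s 𝟎       t u = refl
subF-Eq s (σ ⟶ τ) t u = cong (∀[ σ ]_)
  (trans (subF-Eq (lift s) τ _ _)
         (cong₂ (λ a b → Eq τ (a · v₀) (b · v₀)) (subT-lift-↑ s t) (subT-lift-↑ s u)))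

-- Substitution and weakening in axioms and derivations.

private
  -- Names for the substitutions in the schemes of induction and choice, which must commute with a
  -- lifted substitution if the schemes are to be closed under substitution.
  succₛ : ∀ {Γ} → Sub (𝟎 ∷ Γ) (𝟎 ∷ Γ)
  succₛ = (λ x → var (there x)) ▸ (v₀ +̇ 1̇)

  choiceₛ : ∀ {Γ} → Sub (𝟎 ∷ 𝟏 ∷ Γ) (𝟏 ∷ (𝟏 ⟶ 𝟎) ∷ Γ)
  choiceₛ = (λ x → var (there (there x))) ▸ v₀ ▸ (v₁ · v₀)

  succₛ-lift : ∀ {Γ Δ} (s : Sub Γ Δ) → lift s ∘ₛ succₛ ≗ₛ succₛ ∘ₛ lift s
  succₛ-lift s (here refl) = refl
  succₛ-lift s (there x) = sym (trans (subT-renT succₛ there (s x)) (sym (renT-sub there (s x))))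

  choiceₛ-lift : ∀ {Γ Δ} (s : Sub Γ Δ) → lift (lift s) ∘ₛ choiceₛ ≗ₛ choiceₛ ∘ₛ lift (lift s)
  choiceₛ-lift s (here refl) = refl
  choiceₛ-lift s (there (here refl)) = refl
  choiceₛ-lift s (there (there x)) =
    trans (trans (renT-sub there _) (cong (subT _) (renT-sub there (s x))))
    (trans (subT-subT _ _ (s x))
    (sym (trans (subT-renT choiceₛ there (↑ s x)) (subT-renT (λ y → choiceₛ (there y)) there (s x)))))

-- Axioms about numbers are closed under substitution by computation. Those stated with `Eq` need
-- `subF-Eq`, because `Eq` does not unfold at an unknown type, and the two schemes need the
-- interchange laws.
Ax-sub : ∀ {Γ Δ} (s : Sub Γ Δ) {φ : Fm Γ} → Ax φ → Ax (subF s φ)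
Ax-sub s (+-assoc r t u) = +-assoc _ _ _
Ax-sub s (+-comm t u)    = +-comm _ _
Ax-sub s (+-zero t)      = +-zero _
Ax-sub s (*-assoc r t u) = *-assoc _ _ _
Ax-sub s (*-comm t u)    = *-comm _ _
Ax-sub s (*-one t)       = *-one _
Ax-sub s (*-zero t)      = *-zero _
Ax-sub s (distrib r t u) = distrib _ _ _
Ax-sub s (<-irrefl t)    = <-irrefl _
Ax-sub s (<-trans r t u) = <-trans _ _ _
Ax-sub s (<-total t u)   = <-total _ _
Ax-sub s (+-mono r t u)  = +-mono _ _ _
Ax-sub s (*-mono r t u)  = *-mono _ _ _
Ax-sub s 0<1             = 0<1
Ax-sub s (Π-ax x y)      = subst Ax (sym (subF-Eq s _ _ _)) (Π-ax _ _)
Ax-sub s (Σ-ax x y z)    = subst Ax (sym (subF-Eq s _ _ _)) (Σ-ax _ _ _)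
Ax-sub s (R₀-zero f m)   = R₀-zero _ _
Ax-sub s (R₀-suc f m n)  = R₀-suc _ _ _
Ax-sub s (ext φ x y)     =
  subst Ax (sym (cong₂ _⇒_ (subF-Eq s _ x y) (subF-Eq s _ (φ · x) (φ · y)))) (ext _ _ _)
Ax-sub s (QF-ind φ q)    = subst Ax
  (cong₂ (λ α β → α ∧̇ (∀[ 𝟎 ] (subF (lift s) φ ⇒ β)) ⇒ ∀[ 𝟎 ] subF (lift s) φ)
     (sym (subF-[] s φ 0̇))
     (subF-comm {s′ = succₛ} {lift s} {lift s} {succₛ} (λ x → sym (succₛ-lift s x)) φ))
  (QF-ind (subF (lift s) φ) (subF-QF (lift s) q))
Ax-sub s (QF-AC¹⁰ A q)   = subst Ax
  (cong (λ β → (∀[ 𝟏 ] ∃[ 𝟎 ] subF (lift (lift s)) A) ⇒ ∃[ 𝟏 ⟶ 𝟎 ] ∀[ 𝟏 ] β)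
     (subF-comm {s′ = choiceₛ} {lift (lift s)} {lift (lift s)} {choiceₛ}
       (λ x → sym (choiceₛ-lift s x)) A))
  (QF-AC¹⁰ (subF (lift (lift s)) A) (subF-QF (lift (lift s)) q))

map-subF-↑ : ∀ {Γ Δ σ} (s : Sub Γ Δ) (H : List (Fm Γ)) →
             map (subF (lift {σ = σ} s)) (map ↑ᶠ_ H) ≡ map ↑ᶠ_ (map (subF s) H)
map-subF-↑ s H = trans (sym (map-∘ H)) (trans (map-cong (subF-↑ s) H) (map-∘ H))

wk : ∀ {Γ} {H H′ : List (Fm Γ)} {φ} → H ⊆ H′ → H ⊢ φ → H′ ⊢ φ
wk i (ax a)         = ax a
wk i (hyp x)        = hyp (i x)
wk i (⇒-intro d)    = ⇒-intro (wk (∷⁺ʳ _ i) d)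
wk i (⇒-elim d e)   = ⇒-elim (wk i d) (wk i e)
wk i (∧-intro d e)  = ∧-intro (wk i d) (wk i e)
wk i (∧-elim₁ d)    = ∧-elim₁ (wk i d)
wk i (∧-elim₂ d)    = ∧-elim₂ (wk i d)
wk i (∨-intro₁ d)   = ∨-intro₁ (wk i d)
wk i (∨-intro₂ d)   = ∨-intro₂ (wk i d)
wk i (∨-elim d e f) = ∨-elim (wk i d) (wk (∷⁺ʳ _ i) e) (wk (∷⁺ʳ _ i) f)
wk i (raa d)        = raa (wk (∷⁺ʳ _ i) d)
wk i (∀-intro d)    = ∀-intro (wk (map⁺ ↑ᶠ_ i) d)
wk i (∀-elim d t)   = ∀-elim (wk i d) t
wk i (∃-intro t d)  = ∃-intro t (wk i d)
wk i (∃-elim d e)   = ∃-elim (wk i d) (wk (∷⁺ʳ _ (map⁺ ↑ᶠ_ i)) e)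
wk i (=-refl t)     = =-refl t
wk i (=-subst φ d e) = =-subst φ (wk i d) (wk i e)

⊢-sub : ∀ {Γ Δ} (s : Sub Γ Δ) {H : List (Fm Γ)} {φ} → H ⊢ φ → map (subF s) H ⊢ subF s φ
⊢-sub s (ax a)         = ax (Ax-sub s a)
⊢-sub s (hyp x)        = hyp (∈-map⁺ (subF s) x)
⊢-sub s (⇒-intro d)    = ⇒-intro (⊢-sub s d)
⊢-sub s (⇒-elim d e)   = ⇒-elim (⊢-sub s d) (⊢-sub s e)
⊢-sub s (∧-intro d e)  = ∧-intro (⊢-sub s d) (⊢-sub s e)
⊢-sub s (∧-elim₁ d)    = ∧-elim₁ (⊢-sub s d)
⊢-sub s (∧-elim₂ d)    = ∧-elim₂ (⊢-sub s d)
⊢-sub s (∨-intro₁ d)   = ∨-intro₁ (⊢-sub s d)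
⊢-sub s (∨-intro₂ d)   = ∨-intro₂ (⊢-sub s d)
⊢-sub s (∨-elim d e f) = ∨-elim (⊢-sub s d) (⊢-sub s e) (⊢-sub s f)
⊢-sub s (raa d)        = raa (⊢-sub s d)
⊢-sub s {H} (∀-intro d) =
  ∀-intro (subst (_⊢ _) (map-subF-↑ s H) (⊢-sub (lift s) d))
⊢-sub s (∀-elim {φ = φ} d t) =
  subst (_ ⊢_) (sym (subF-[] s φ t)) (∀-elim (⊢-sub s d) (subT s t))
⊢-sub s (∃-intro {φ = φ} t d) =
  ∃-intro (subT s t) (subst (_ ⊢_) (subF-[] s φ t) (⊢-sub s d))
⊢-sub s {H} (∃-elim {φ = φ} {ψ} d e) =
  ∃-elim (⊢-sub s d)
    (subst₂ (λ K χ → subF (lift s) φ ∷ K ⊢ χ) (map-subF-↑ s H) (subF-↑ s ψ) (⊢-sub (lift s) e))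
⊢-sub s (=-refl t)     = =-refl _
⊢-sub s (=-subst {t} {u} φ d e) =
  subst (_ ⊢_) (sym (subF-[] s φ u))
    (=-subst (subF (lift s) φ) (⊢-sub s d) (subst (_ ⊢_) (subF-[] s φ t) (⊢-sub s e)))

⊢-↑ : ∀ {Γ σ} {H : List (Fm Γ)} {φ} → H ⊢ φ → map (↑ᶠ_ {σ = σ}) H ⊢ ↑ᶠ φ
⊢-↑ {H = H} {φ} d = subst₂ _⊢_ (map-cong (λ ψ → sym (renF-sub there ψ)) H)
  (sym (renF-sub there φ)) (⊢-sub (renₛ there) d)

cut : ∀ {Γ} {H : List (Fm Γ)} {φ ψ} → H ⊢ φ → φ ∷ H ⊢ ψ → H ⊢ ψ
cut d e = ⇒-elim (⇒-intro e) d

cuts-map : ∀ {Γ Δ} (s : Sub Γ Δ) {H : List (Fm Δ)} {K : List (Fm Γ)} {ψ} →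
           All (λ φ → H ⊢ subF s φ) K → map (subF s) K ⊢ ψ → H ⊢ ψ
cuts-map s []       e = wk (λ ()) e
cuts-map s (d ∷ ds) e = ⇒-elim (cuts-map s ds (⇒-intro e)) d

inst : ∀ {Γ Δ} (s : Sub Γ Δ) {H : List (Fm Δ)} {K : List (Fm Γ)} {φ} →
       K ⊢ φ → All (λ ψ → H ⊢ subF s ψ) K → H ⊢ subF s φ
inst s d ds = cuts-map s ds (⊢-sub s d)

-- For lemmas proved by induction with variables as parameters, where the substitutions of the
-- induction scheme compute; here the parameters and the induction variable become arbitrary terms.
inst-∀ : ∀ {Γ Δ σ} (s : Sub Γ Δ) {H : List (Fm Δ)} {K : List (Fm Γ)} {φ} →
         K ⊢ ∀[ σ ] φ → All (λ ψ → H ⊢ subF s ψ) K → (t : Tm Δ σ) → H ⊢ subF (s ▸ t) φ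
inst-∀ s {H} {φ = φ} d ds t = subst (H ⊢_)
  (trans (subF-subF (var ▸ t) (lift s) φ)
    (subF-cong {s′ = s ▸ t} (λ { (here refl) → refl ; (there x) → []-↑ t (s x) }) φ))
  (∀-elim (inst s d ds) t)

-- Derived rules of logic and of equality at finite types.

∅ : ∀ {Γ} → Sub [] Γ
∅ ()

w : ∀ {Γ} {H : List (Fm Γ)} {φ ψ} → H ⊢ φ → ψ ∷ H ⊢ φ
w = wk there

h₀ : ∀ {Γ} {H : List (Fm Γ)} {φ} → φ ∷ H ⊢ φ
h₀ = hyp (here refl)

h₁ : ∀ {Γ} {H : List (Fm Γ)} {φ ψ} → ψ ∷ φ ∷ H ⊢ φ
h₁ = hyp (there (here refl))

h₂ : ∀ {Γ} {H : List (Fm Γ)} {φ ψ χ} → χ ∷ ψ ∷ φ ∷ H ⊢ φ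
h₂ = w h₁

⊥-elimᵈ : ∀ {Γ} {H : List (Fm Γ)} {φ} → H ⊢ ⊥̇ → H ⊢ φ
⊥-elimᵈ d = raa (w d)

em : ∀ {Γ} {H : List (Fm Γ)} φ → H ⊢ φ ∨̇ ¬̇ φ
em φ = raa (⇒-elim h₀ (∨-intro₂ (⇒-intro (⇒-elim h₁ (∨-intro₁ h₀)))))

by-cases : ∀ {Γ} {H : List (Fm Γ)} φ {ψ} → φ ∷ H ⊢ ψ → (¬̇ φ) ∷ H ⊢ ψ → H ⊢ ψ
by-cases φ = ∨-elim (em φ)

≡⇒Eq : ∀ {Γ} {H : List (Fm Γ)} {τ} {t u v : Tm Γ τ} → u ≡ v → H ⊢ Eq τ t u → H ⊢ Eq τ t v
≡⇒Eq refl d = d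

Eq-·ˡ : ∀ {Γ} {H : List (Fm Γ)} {σ τ} {f g : Tm Γ (σ ⟶ τ)} →
        H ⊢ Eq (σ ⟶ τ) f g → (u : Tm Γ σ) → H ⊢ Eq τ (f · u) (g · u)
Eq-·ˡ {τ = τ} {f} {g} d u = subst (_ ⊢_)
  (trans (subF-Eq (var ▸ u) τ _ _)
         (cong₂ (λ a b → Eq τ (a · u) (b · u)) ([]-↑ u f) ([]-↑ u g)))
  (∀-elim d u)

Eq-·ʳ : ∀ {Γ} {H : List (Fm Γ)} {σ τ} (f : Tm Γ (σ ⟶ τ)) {u v : Tm Γ σ} →
        H ⊢ Eq σ u v → H ⊢ Eq τ (f · u) (f · v)
Eq-·ʳ f d = ⇒-elim (ax (ext f _ _)) d

↑-Eq : ∀ {Γ σ} {H : List (Fm Γ)} τ {t u : Tm Γ τ} → H ⊢ Eq τ t u → map (↑ᶠ_ {σ = σ}) H ⊢ Eq τ (↑ t) (↑ u)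
↑-Eq τ {t} {u} d = subst (_ ⊢_)
  (trans (renF-sub there (Eq τ t u))
  (trans (subF-Eq (renₛ there) τ t u)
         (sym (cong₂ (Eq τ) (renT-sub there t) (renT-sub there u)))))
  (⊢-↑ d)

≐-sym : ∀ {Γ} {H : List (Fm Γ)} {s t : Tm Γ 𝟎} → H ⊢ s ≐ t → H ⊢ t ≐ s
≐-sym {s = s} {t} d = subst (λ u → _ ⊢ t ≐ u) ([]-↑ t s)
  (=-subst (v₀ ≐ ↑ s) d (subst (λ u → _ ⊢ s ≐ u) (sym ([]-↑ s s)) (=-refl s)))

≐-trans : ∀ {Γ} {H : List (Fm Γ)} {r s t : Tm Γ 𝟎} → H ⊢ r ≐ s → H ⊢ s ≐ t → H ⊢ r ≐ t
≐-trans {r = r} {s} {t} d e = subst (λ u → _ ⊢ u ≐ t) ([]-↑ t r)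
  (=-subst (↑ r ≐ v₀) e (subst (λ u → _ ⊢ u ≐ s) (sym ([]-↑ s r)) d))

Eq-trans : ∀ {Γ} {H : List (Fm Γ)} τ {t u v : Tm Γ τ} →
           H ⊢ Eq τ t u → H ⊢ Eq τ u v → H ⊢ Eq τ t v
Eq-trans 𝟎       d e = ≐-trans d e
Eq-trans (σ ⟶ τ) d e =
  ∀-intro (Eq-trans τ (Eq-·ˡ (↑-Eq (σ ⟶ τ) d) v₀) (Eq-·ˡ (↑-Eq (σ ⟶ τ) e) v₀))

Eq-· : ∀ {Γ} {H : List (Fm Γ)} {σ τ} {f g : Tm Γ (σ ⟶ τ)} {u v : Tm Γ σ} →
       H ⊢ Eq (σ ⟶ τ) f g → H ⊢ Eq σ u v → H ⊢ Eq τ (f · u) (g · v)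
Eq-· {τ = τ} {g = g} d e = Eq-trans τ (Eq-·ˡ d _) (Eq-·ʳ g e)

-- Bracket abstraction commutes with substitution and satisfies β.

strengthen-sound : ∀ {Γ σ τ} (t : Tm (σ ∷ Γ) τ) {u} → strengthen t ≡ just u → t ≡ ↑ u
strengthen-sound (var (there x)) refl = refl
strengthen-sound (con c)         refl = refl
strengthen-sound (t · u) e with strengthen t in et | strengthen u in eu
strengthen-sound (t · u) refl | just t′ | just u′ =
  cong₂ _·_ (strengthen-sound t et) (strengthen-sound u eu)

strengthen-↑ : ∀ {Γ σ τ} (t : Tm Γ τ) → strengthen {σ = σ} (↑ t) ≡ just t
strengthen-↑ (var x) = refl
strengthen-↑ (con c) = refl
strengthen-↑ {σ = σ} (t · u) = cong₂ (zipWith _·_) (strengthen-↑ {σ = σ} t) (strengthen-↑ u)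

-- The optimisation in `ƛ` makes this hold for compound terms as well. Otherwise a variable and a
-- compound term substituted for it would be abstracted differently, and `subT-ƛ` would fail as a
-- syntactic equation.
ƛ-↑ : ∀ {Γ σ τ} (t : Tm Γ τ) → ƛ_ {σ = σ} (↑ t) ≡ con (Πᶜ τ σ) · t
ƛ-↑ (var x) = refl
ƛ-↑ (con c) = refl
ƛ-↑ {σ = σ} (t · u) rewrite strengthen-↑ {σ = σ} t | strengthen-↑ {σ = σ} u = refl

-- A lifted substitution neither creates nor removes occurrences of the abstracted variable, so `ƛ`
-- makes the same choice between Π and Σ before and after it.
strengthen-sub : ∀ {Γ Δ σ τ} (s : Sub Γ Δ) (t : Tm (σ ∷ Γ) τ) →
                 strengthen (subT (lift s) t) ≡ Maybe.map (subT s) (strengthen t)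
strengthen-sub s (var (here refl)) = refl
strengthen-sub s (var (there x))   = strengthen-↑ (s x)
strengthen-sub s (con c)           = refl
strengthen-sub s (t · u) rewrite strengthen-sub s t | strengthen-sub s u
  with strengthen t | strengthen u
... | just _  | just _  = refl
... | just _  | nothing = refl
... | nothing | just _  = refl
... | nothing | nothing = refl

subT-ƛ : ∀ {Γ Δ σ τ} (s : Sub Γ Δ) (t : Tm (σ ∷ Γ) τ) → subT s (ƛ t) ≡ ƛ subT (lift s) t
subT-ƛ s (var (here refl)) = refl
subT-ƛ s (var (there x))   = sym (ƛ-↑ (s x))
subT-ƛ s (con c)           = refl
subT-ƛ s (t · u) with strengthen (t · u) | strengthen (subT (lift s) (t · u)) | strengthen-sub s (t · u)
... | just _  | _ | refl = refl
... | nothing | _ | refl = cong₂ (λ a b → con (Σᶜ _ _ _) · a · b) (subT-ƛ s t) (subT-ƛ s u)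

β : ∀ {Γ} {H : List (Fm Γ)} {σ τ} (t : Tm (σ ∷ Γ) τ) (u : Tm Γ σ) →
    H ⊢ Eq τ ((ƛ t) · u) (subT (var ▸ u) t)
β {τ = τ} (var (here refl)) u = Eq-trans τ (ax (Σ-ax _ _ _)) (ax (Π-ax _ _))
β (var (there x)) u = ax (Π-ax _ _)
β (con c) u = ax (Π-ax _ _)
β {τ = τ} (t · v) u with strengthen (t · v) in e
... | just t′ = ≡⇒Eq (sym (trans (cong (subT (var ▸ u)) (strengthen-sound (t · v) e)) ([]-↑ u t′)))
                  (ax (Π-ax _ _))
... | nothing = Eq-trans τ (ax (Σ-ax _ _ _)) (Eq-· (β t u) (β v u))

-- For a concrete body t, subT s (ƛ t) and subT (s ▸ a) t compute.
βₛ : ∀ {Γ Θ} {H : List (Fm Γ)} {σ τ} (s : Sub Θ Γ) (t : Tm (σ ∷ Θ) τ) (a : Tm Γ σ) →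
     H ⊢ Eq τ (subT s (ƛ t) · a) (subT (s ▸ a) t)
βₛ {H = H} {τ = τ} s t a = subst (λ f → H ⊢ Eq τ (f · a) (subT (s ▸ a) t)) (sym (subT-ƛ s t))
  (≡⇒Eq (trans (subT-subT (var ▸ a) (lift s) t)
               (subT-cong {s′ = s ▸ a} (λ { (here refl) → refl ; (there x) → []-↑ a (s x) }) t))
        (β (subT (lift s) t) a))

β₂ₛ : ∀ {Γ Θ} {H : List (Fm Γ)} {ρ σ τ} (s : Sub Θ Γ) (t : Tm (σ ∷ ρ ∷ Θ) τ) (a : Tm Γ ρ) (b : Tm Γ σ) →
      H ⊢ Eq τ (subT s (ƛ ƛ t) · a · b) (subT (s ▸ a ▸ b) t)
β₂ₛ {τ = τ} s t a b = Eq-trans τ (Eq-·ˡ (βₛ s (ƛ t) a) b) (βₛ (s ▸ a) t b)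

β₃ₛ : ∀ {Γ Θ} {H : List (Fm Γ)} {π ρ σ τ} (s : Sub Θ Γ) (t : Tm (σ ∷ ρ ∷ π ∷ Θ) τ)
      (a : Tm Γ π) (b : Tm Γ ρ) (c : Tm Γ σ) →
      H ⊢ Eq τ (subT s (ƛ ƛ ƛ t) · a · b · c) (subT (s ▸ a ▸ b ▸ c) t)
β₃ₛ {τ = τ} s t a b c = Eq-trans τ (Eq-·ˡ (β₂ₛ s (ƛ t) a b) c) (βₛ (s ▸ a ▸ b) t c)

-- The ordered semiring of natural numbers.

+-cong : ∀ {Γ} {H : List (Fm Γ)} {s s′ t t′} → H ⊢ s ≐ s′ → H ⊢ t ≐ t′ → H ⊢ s +̇ t ≐ s′ +̇ t′
+-cong d e = Eq-· (Eq-·ʳ (con plusᶜ) d) e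

*-cong : ∀ {Γ} {H : List (Fm Γ)} {s s′ t t′} → H ⊢ s ≐ s′ → H ⊢ t ≐ t′ → H ⊢ s *̇ t ≐ s′ *̇ t′
*-cong d e = Eq-· (Eq-·ʳ (con timesᶜ) d) e

-- Provable equality serves as the setoid equality of terms, so that the ring solver produces
-- derivations of polynomial identities.
semiring : ∀ {Γ} → List (Fm Γ) → CommutativeSemiring 0ℓ 0ℓ
semiring {Γ} H = record
  { Carrier = Tm Γ 𝟎
  ; _≈_ = λ s t → H ⊢ s ≐ t
  ; _+_ = _+̇_
  ; _*_ = _*̇_
  ; 0# = 0̇
  ; 1# = 1̇
  ; isCommutativeSemiring = record
    { isSemiring = record
      { isSemiringWithoutAnnihilatingZero = record
        { +-isCommutativeMonoid = record
          { isMonoid = record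
            { isSemigroup = record
              { isMagma = record
                { isEquivalence = record
                  { refl = =-refl _ ; sym = ≐-sym ; trans = ≐-trans }
                ; ∙-cong = +-cong }
              ; assoc = λ r s t → ax (+-assoc r s t) }
            ; identity = (λ t → ≐-trans (ax (+-comm _ _)) (ax (+-zero t))) , λ t → ax (+-zero t) }
          ; comm = λ s t → ax (+-comm s t) }
        ; *-cong = *-cong
        ; *-assoc = λ r s t → ax (*-assoc r s t)
        ; *-identity = (λ t → ≐-trans (ax (*-comm _ _)) (ax (*-one t))) , λ t → ax (*-one t)
        ; distrib = (λ r s t → ax (distrib r s t)) ,
                    (λ r s t → ≐-trans (ax (*-comm _ _))
                       (≐-trans (ax (distrib r s t)) (+-cong (ax (*-comm _ _)) (ax (*-comm _ _)))))
        }
      ; zero = (λ t → ≐-trans (ax (*-comm _ _)) (ax (*-zero t))) , λ t → ax (*-zero t)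
      }
    ; *-comm = λ s t → ax (*-comm s t) } }

module NS {Γ} {H : List (Fm Γ)} = NatSolver (semiring H)
open NS using (solve; _:=_; _:+_; _:*_) renaming (con to :con)

module ≐-Reasoning {Γ} {H : List (Fm Γ)} where
  open import Relation.Binary.Reasoning.Setoid (CommutativeSemiring.setoid (semiring H)) public

module _ {Γ} {H : List (Fm Γ)} where

  ≺-resp : ∀ {s s′ t t′} → H ⊢ s ≐ s′ → H ⊢ t ≐ t′ → H ⊢ s ≺ t → H ⊢ s′ ≺ t′
  ≺-resp {s} {s′} {t} {t′} d e f = subst (λ b → H ⊢ b ≺ t′) ([]-↑ t′ s′)
    (=-subst (↑ s′ ≺ v₀) e (subst (λ b → H ⊢ b ≺ t) (sym ([]-↑ t s′)) g))
    where
    g : H ⊢ s′ ≺ t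
    g = subst (λ b → H ⊢ s′ ≺ b) ([]-↑ s′ t)
          (=-subst (v₀ ≺ ↑ t) d (subst (λ b → H ⊢ s ≺ b) (sym ([]-↑ s t)) f))

  ≺-trans : ∀ {r s t} → H ⊢ r ≺ s → H ⊢ s ≺ t → H ⊢ r ≺ t
  ≺-trans d e = ⇒-elim (⇒-elim (ax (<-trans _ _ _)) d) e

  ≺-irrefl : ∀ {t φ} → H ⊢ t ≺ t → H ⊢ φ
  ≺-irrefl d = ⊥-elimᵈ (⇒-elim (ax (<-irrefl _)) d)

  ≺⇒≼ : ∀ {s t} → H ⊢ s ≺ t → H ⊢ s ≼ t
  ≺⇒≼ = ∨-intro₁

  ≐⇒≼ : ∀ {s t} → H ⊢ s ≐ t → H ⊢ s ≼ t
  ≐⇒≼ = ∨-intro₂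

  ≼-refl : ∀ {t} → H ⊢ t ≼ t
  ≼-refl = ∨-intro₂ (=-refl _)

module _ {Γ} {H : List (Fm Γ)} where

  ≼-≺-trans : ∀ {r s t} → H ⊢ r ≼ s → H ⊢ s ≺ t → H ⊢ r ≺ t
  ≼-≺-trans d e = ∨-elim d (≺-trans h₀ (w e)) (≺-resp (≐-sym h₀) (=-refl _) (w e))

  ≺-≼-trans : ∀ {r s t} → H ⊢ r ≺ s → H ⊢ s ≼ t → H ⊢ r ≺ t
  ≺-≼-trans d e = ∨-elim e (≺-trans (w d) h₀) (≺-resp (=-refl _) h₀ (w d))

  ≼-resp : ∀ {s s′ t t′} → H ⊢ s ≐ s′ → H ⊢ t ≐ t′ → H ⊢ s ≼ t → H ⊢ s′ ≼ t′
  ≼-resp d e f = ∨-elim f (≺⇒≼ (≺-resp (w d) (w e) h₀))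
                         (≐⇒≼ (≐-trans (≐-sym (w d)) (≐-trans h₀ (w e))))

  ≺-or-≽ : ∀ s t → H ⊢ s ≺ t ∨̇ t ≼ s
  ≺-or-≽ s t = ∨-elim (ax (<-total s t)) (∨-intro₁ h₀)
    (∨-intro₂ (∨-elim h₀ (≐⇒≼ (≐-sym h₀)) (≺⇒≼ h₀)))

  +-monoˡ-≺ : ∀ {r s} t → H ⊢ r ≺ s → H ⊢ r +̇ t ≺ s +̇ t
  +-monoˡ-≺ t d = ⇒-elim (ax (+-mono _ _ t)) d

module _ {Γ} {H : List (Fm Γ)} where

  ≼-trans : ∀ {r s t} → H ⊢ r ≼ s → H ⊢ s ≼ t → H ⊢ r ≼ t
  ≼-trans d e = ∨-elim d (≺⇒≼ (≺-≼-trans h₀ (w e))) (≼-resp (≐-sym h₀) (=-refl _) (w e))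

  +-monoˡ-≼ : ∀ {r s} t → H ⊢ r ≼ s → H ⊢ r +̇ t ≼ s +̇ t
  +-monoˡ-≼ t d = ∨-elim d (≺⇒≼ (+-monoˡ-≺ t h₀)) (≐⇒≼ (+-cong h₀ (=-refl _)))

  +-monoʳ-≺ : ∀ {r s} t → H ⊢ r ≺ s → H ⊢ t +̇ r ≺ t +̇ s
  +-monoʳ-≺ t d = ≺-resp (ax (+-comm _ _)) (ax (+-comm _ _)) (+-monoˡ-≺ t d)

module _ {Γ} {H : List (Fm Γ)} where

  +-mono-≼ : ∀ {r s t u} → H ⊢ r ≼ s → H ⊢ t ≼ u → H ⊢ r +̇ t ≼ s +̇ u
  +-mono-≼ d e = ≼-trans (+-monoˡ-≼ _ d)
    (≼-resp (ax (+-comm _ _)) (ax (+-comm _ _)) (+-monoˡ-≼ _ e))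

  +-mono-≺-≼ : ∀ {r s t u} → H ⊢ r ≺ s → H ⊢ t ≼ u → H ⊢ r +̇ t ≺ s +̇ u
  +-mono-≺-≼ d e = ≺-≼-trans (+-monoˡ-≺ _ d)
    (≼-resp (ax (+-comm _ _)) (ax (+-comm _ _)) (+-monoˡ-≼ _ e))

  +-mono-≼-≺ : ∀ {r s t u} → H ⊢ r ≼ s → H ⊢ t ≺ u → H ⊢ r +̇ t ≺ s +̇ u
  +-mono-≼-≺ d e = ≼-≺-trans (+-monoˡ-≼ _ d) (+-monoʳ-≺ _ e)

module _ {Γ} {H : List (Fm Γ)} where

  -- Linear arithmetic by certificates: the hypothesis is a sum of known inequalities.
  ≼-lin : ∀ {a b c d} → H ⊢ c ≼ d → H ⊢ a +̇ d ≐ b +̇ c → H ⊢ a ≼ b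
  ≼-lin {a} {b} h e = ∨-elim (≺-or-≽ b a)
    (≺-irrefl (≺-resp (≐-sym (w e)) (=-refl _) (+-mono-≺-≼ h₀ (w h)))) h₀

  ≺-lin : ∀ {a b c d} → H ⊢ c ≺ d → H ⊢ a +̇ d ≐ b +̇ c → H ⊢ a ≺ b
  ≺-lin {a} {b} h e = ∨-elim (≺-or-≽ a b) h₀
    (≺-irrefl (≺-resp (≐-sym (w e)) (=-refl _) (+-mono-≼-≺ h₀ (w h))))

  ≼-antisym : ∀ {a b} → H ⊢ a ≼ b → H ⊢ b ≼ a → H ⊢ a ≐ b
  ≼-antisym d e = ∨-elim d (≺-irrefl (≺-≼-trans h₀ (w e))) h₀

module _ {Γ} {H : List (Fm Γ)} where

  +-cancelʳ : ∀ {a b} c → H ⊢ a +̇ c ≐ b +̇ c → H ⊢ a ≐ b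
  +-cancelʳ c e = ≼-antisym
    (≼-lin (≼-refl {t = c}) e) (≼-lin (≼-refl {t = c}) (≐-sym e))

  +-cancelˡ : ∀ {a b} c → H ⊢ c +̇ a ≐ c +̇ b → H ⊢ a ≐ b
  +-cancelˡ c e = +-cancelʳ c (≐-trans (ax (+-comm _ _)) (≐-trans e (ax (+-comm _ _))))

  ≺-suc : ∀ n → H ⊢ n ≺ n +̇ 1̇
  ≺-suc n = ≺-lin (ax 0<1) (solve 1 (λ n → n :+ :con 1 := n :+ :con 1 :+ :con 0) (=-refl _) n)

-- Quantifier-free induction, predecessor and truncated subtraction.

ind : ∀ {Γ} {H : List (Fm Γ)} (φ : Fm (𝟎 ∷ Γ)) → QF φ → H ⊢ φ [ 0̇ ] →
      φ ∷ map ↑ᶠ_ H ⊢ subF ((λ x → var (there x)) ▸ (v₀ +̇ 1̇)) φ → H ⊢ ∀[ 𝟎 ] φ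
ind φ q d e = ⇒-elim (ax (QF-ind φ q)) (∧-intro d (∀-intro (⇒-intro e)))

module _ {Γ} {H : List (Fm Γ)} where

  0≼ : ∀ n → H ⊢ 0̇ ≼ n
  0≼ = ∀-elim (ind (0̇ ≼ v₀) (or lt eq) ≼-refl (≺⇒≼ (≼-≺-trans h₀ (≺-suc _))))

  pred-zero : H ⊢ predᵗ · 0̇ ≐ 0̇
  pred-zero = ax (R₀-zero _ _)

  pred-suc : ∀ n → H ⊢ predᵗ · (n +̇ 1̇) ≐ n
  pred-suc n = ≐-trans (ax (R₀-suc _ _ n)) (β₂ₛ ∅ v₁ n _)

  ∸-zero : ∀ a → H ⊢ a ∸̇ 0̇ ≐ a
  ∸-zero a = ax (R₀-zero _ _)

  ∸-suc : ∀ a n → H ⊢ a ∸̇ (n +̇ 1̇) ≐ predᵗ · (a ∸̇ n)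
  ∸-suc a n = ≐-trans (ax (R₀-suc _ _ n)) (Eq-·ˡ (βₛ ∅ predᵗ n) _)

  ∸-cong : ∀ {a a′ b b′} → H ⊢ a ≐ a′ → H ⊢ b ≐ b′ → H ⊢ a ∸̇ b ≐ a′ ∸̇ b′
  ∸-cong d e = Eq-· (Eq-·ʳ monusᵗ d) e

module _ {Γ} {H : List (Fm Γ)} where

  zero-or-suc : ∀ n → H ⊢ n ≐ 0̇ ∨̇ n ≐ predᵗ · n +̇ 1̇
  zero-or-suc = ∀-elim (ind (v₀ ≐ 0̇ ∨̇ v₀ ≐ predᵗ · v₀ +̇ 1̇) (or eq eq) (∨-intro₁ (=-refl _))
    (∨-intro₂ (+-cong (≐-sym (pred-suc v₀)) (=-refl _))))

-- By induction on the smaller number a: if a + 1 ≤ b, then b ∸ a is not 0, so it is a successor,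
-- and its predecessor is b ∸ (a + 1).
≼⇒+-var : [] ⊢ ∀[ 𝟎 ] (v₀ ≼ v₁ {[]} {𝟎} ⇒ v₁ ≐ v₀ +̇ (v₁ ∸̇ v₀))
≼⇒+-var = ind (v₀ ≼ v₁ ⇒ v₁ ≐ v₀ +̇ (v₁ ∸̇ v₀)) (imp (or lt eq) eq)
  (⇒-intro (≐-trans (≐-sym (∸-zero v₀))
     (solve 1 (λ a → a := :con 0 :+ a) (=-refl _) (v₀ ∸̇ 0̇))))
  (⇒-intro (cut (⇒-elim h₁ (≺⇒≼ (≺-≼-trans (≺-suc v₀) h₀)))
    (∨-elim (zero-or-suc (v₁ ∸̇ v₀))
      (≺-irrefl (≺-≼-trans (≺-suc v₀) (≼-resp (=-refl _)
        (≐-trans h₁ (≐-trans (+-cong (=-refl _) h₀) (ax (+-zero _)))) h₂)))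
      (≐-trans h₁ (≐-trans (+-cong (=-refl _) h₀)
        (≐-trans (solve 3 (λ n p i → n :+ (p :+ i) := n :+ i :+ p) (=-refl _) v₀ _ 1̇)
          (+-cong (=-refl _) (≐-sym (∸-suc v₁ v₀)))))))))

module _ {Γ} {H : List (Fm Γ)} where

  ≼⇒+ : ∀ {a b} → H ⊢ a ≼ b → H ⊢ b ≐ a +̇ (b ∸̇ a)
  ≼⇒+ {a} {b} d = ⇒-elim (inst-∀ (∅ ▸ b) ≼⇒+-var [] a) d

≼-+ʳ : ∀ {Γ} {H : List (Fm Γ)} a b → H ⊢ a ≼ a +̇ b
≼-+ʳ a b = ≼-lin (0≼ b) (solve 2 (λ a b → a :+ b := a :+ b :+ :con 0) (=-refl _) a b)

module _ {Γ} {H : List (Fm Γ)} where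

  ≺⇒suc≼ : ∀ {a b} → H ⊢ a ≺ b → H ⊢ a +̇ 1̇ ≼ b
  ≺⇒suc≼ {a} {b} d = cut (≼⇒+ (≺⇒≼ d)) (∨-elim (zero-or-suc (b ∸̇ a))
    (≺-irrefl (≺-resp (=-refl _) (≐-trans h₁ (≐-trans (+-cong (=-refl _) h₀) (ax (+-zero _)))) (w (w d))))
    (≼-resp (=-refl _) (≐-sym (≐-trans h₁ (≐-trans (+-cong (=-refl _) h₀)
      (solve 3 (λ a p i → a :+ (p :+ i) := a :+ i :+ p) (=-refl _) a _ 1̇))))
      (≼-+ʳ (a +̇ 1̇) _)))

  n+m∸n : ∀ n m → H ⊢ (n +̇ m) ∸̇ n ≐ m
  n+m∸n n m = ≐-sym (+-cancelˡ n (≼⇒+ (≼-+ʳ n m)))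

  0≺⇒suc : ∀ {n} → H ⊢ 0̇ ≺ n → H ⊢ n ≐ (n ∸̇ 1̇) +̇ 1̇
  0≺⇒suc d = ≐-trans (≼⇒+ (≼-resp (solve 1 (λ i → :con 0 :+ i := i) (=-refl _) 1̇) (=-refl _) (≺⇒suc≼ d)))
    (ax (+-comm _ _))

  0≺suc : ∀ n → H ⊢ 0̇ ≺ n +̇ 1̇
  0≺suc n = ≼-≺-trans (0≼ n) (≺-suc n)

∸-self-+-var : [] ⊢ ∀[ 𝟎 ] (v₁ {[]} {𝟎} ∸̇ (v₁ +̇ v₀) ≐ 0̇)
∸-self-+-var = ind (v₁ ∸̇ (v₁ +̇ v₀) ≐ 0̇) eq
  (≐-trans (∸-cong (=-refl v₀) (ax (+-zero v₀)))
    (+-cancelˡ v₀ (≐-trans (≐-sym (≼⇒+ ≼-refl)) (≐-sym (ax (+-zero _))))))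
  (≐-trans (∸-cong (=-refl v₁) (≐-sym (ax (+-assoc v₁ v₀ 1̇))))
    (≐-trans (∸-suc v₁ _) (≐-trans (Eq-·ʳ predᵗ h₀) pred-zero)))

module _ {Γ} {H : List (Fm Γ)} where

  ∸-≼ : ∀ {a b} → H ⊢ a ≼ b → H ⊢ a ∸̇ b ≐ 0̇
  ∸-≼ {a} {b} d = ≐-trans (∸-cong (=-refl a) (≼⇒+ d)) (inst-∀ (∅ ▸ a) ∸-self-+-var [] (b ∸̇ a))

module _ {Γ} {H : List (Fm Γ)} where

  *-monoˡ-≼ : ∀ {a b} c → H ⊢ a ≼ b → H ⊢ a *̇ c ≼ b *̇ c
  *-monoˡ-≼ {a} {b} c d = ≼-resp (=-refl _)
    (≐-trans (solve 3 (λ a d c → a :* c :+ d :* c := (a :+ d) :* c) (=-refl _) a (b ∸̇ a) c)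
             (*-cong (≐-sym (≼⇒+ d)) (=-refl c)))
    (≼-+ʳ (a *̇ c) ((b ∸̇ a) *̇ c))

  *-monoˡ-≺ : ∀ {a b} c → H ⊢ 0̇ ≺ c → H ⊢ a ≺ b → H ⊢ a *̇ c ≺ b *̇ c
  *-monoˡ-≺ c p d = ⇒-elim (⇒-elim (ax (*-mono _ _ c)) d) p

  *-mono-≼ : ∀ {a b c d} → H ⊢ a ≼ b → H ⊢ c ≼ d → H ⊢ a *̇ c ≼ b *̇ d
  *-mono-≼ {a} {b} {c} {d} p q = ≼-trans (*-monoˡ-≼ c p)
    (≼-resp (ax (*-comm c b)) (ax (*-comm d b)) (*-monoˡ-≼ b q))

  *-positive : ∀ {a b} → H ⊢ 0̇ ≺ a → H ⊢ 0̇ ≺ b → H ⊢ 0̇ ≺ a *̇ b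
  *-positive {a} {b} p q = ≺-resp (≐-trans (ax (*-comm _ _)) (ax (*-zero b))) (=-refl _) (*-monoˡ-≺ b q p)

module _ {Γ} {H : List (Fm Γ)} where

  *-cancelʳ-≼ : ∀ {a b} c → H ⊢ 0̇ ≺ c → H ⊢ a *̇ c ≼ b *̇ c → H ⊢ a ≼ b
  *-cancelʳ-≼ {a} {b} c p d = ∨-elim (≺-or-≽ b a)
    (≺-irrefl (≺-≼-trans (*-monoˡ-≺ c (w p) h₀) (w d))) h₀

-- Powers of two.

pow2 : ∀ {Γ} → Tm Γ 𝟎 → Tm Γ 𝟎
pow2 n = pow2ᵗ · n

module _ {Γ} {H : List (Fm Γ)} where

  pow2-zero : H ⊢ pow2 0̇ ≐ 1̇
  pow2-zero = ax (R₀-zero _ _)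

  pow2-suc : ∀ n → H ⊢ pow2 (n +̇ 1̇) ≐ pow2 n +̇ pow2 n
  pow2-suc n = ≐-trans (ax (R₀-suc _ _ n)) (β₂ₛ ∅ (v₀ +̇ v₀) n _)

module _ {Γ} {H : List (Fm Γ)} where

  suc≼pow2 : ∀ n → H ⊢ n +̇ 1̇ ≼ pow2 n
  suc≼pow2 = ∀-elim (ind (v₀ +̇ 1̇ ≼ pow2 v₀) (or lt eq)
    (≐⇒≼ (≐-trans (solve 1 (λ i → :con 0 :+ i := i) (=-refl _) 1̇) (≐-sym pow2-zero)))
    (≼-resp (=-refl _) (≐-sym (pow2-suc v₀))
      (+-mono-≼ h₀ (≼-trans (≼-lin (0≼ v₀) (solve 2 (λ n i → i :+ n := n :+ i :+ :con 0) (=-refl _) v₀ 1̇)) h₀))))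

  0≺pow2 : ∀ n → H ⊢ 0̇ ≺ pow2 n
  0≺pow2 n = ≺-≼-trans (0≺suc n) (suc≼pow2 n)

pow2-+-var : [] ⊢ ∀[ 𝟎 ] (pow2 (v₁ {[]} {𝟎} +̇ v₀) ≐ pow2 v₁ *̇ pow2 v₀)
pow2-+-var = ind (pow2 (v₁ +̇ v₀) ≐ pow2 v₁ *̇ pow2 v₀) eq
    (≐-trans (Eq-·ʳ pow2ᵗ (ax (+-zero v₀)))
      (≐-trans (≐-sym (ax (*-one _))) (*-cong (=-refl _) (≐-sym pow2-zero))))
    (≐-trans (Eq-·ʳ pow2ᵗ (≐-sym (ax (+-assoc v₁ v₀ 1̇))))
      (≐-trans (pow2-suc _) (≐-trans (+-cong h₀ h₀)
        (≐-trans (solve 2 (λ a b → a :* b :+ a :* b := a :* (b :+ b)) (=-refl _) (pow2 v₁) (pow2 v₀))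
          (*-cong (=-refl _) (≐-sym (pow2-suc v₀)))))))

module _ {Γ} {H : List (Fm Γ)} where

  pow2-+ : ∀ a b → H ⊢ pow2 (a +̇ b) ≐ pow2 a *̇ pow2 b
  pow2-+ a b = inst-∀ (∅ ▸ a) pow2-+-var [] b

-- Integer square root and pairing.

root : ∀ {Γ} → Tm Γ 𝟎 → Tm Γ 𝟎
root n = rootᵗ · n

IsRoot : ∀ {Γ} → Tm Γ 𝟎 → Tm Γ 𝟎 → Fm Γ
IsRoot n r = r *̇ r ≼ n ∧̇ n ≺ (r +̇ 1̇) *̇ (r +̇ 1̇)

module _ {Γ} {H : List (Fm Γ)} where

  IsRoot-resp : ∀ {n r s} → H ⊢ r ≐ s → H ⊢ IsRoot n r → H ⊢ IsRoot n s
  IsRoot-resp e d = ∧-intro (≼-resp (*-cong e e) (=-refl _) (∧-elim₁ d))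
    (≺-resp (=-refl _) (*-cong e′ e′) (∧-elim₂ d))
    where e′ = +-cong e (=-refl 1̇)

  root-suc : ∀ n → H ⊢ root (n +̇ 1̇) ≐ root n +̇ (1̇ ∸̇ ((root n +̇ 1̇) *̇ (root n +̇ 1̇) ∸̇ (n +̇ 1̇)))
  root-suc n = ≐-trans (ax (R₀-suc _ _ n))
    (β₂ₛ ∅ (v₀ +̇ (1̇ ∸̇ ((v₀ +̇ 1̇) *̇ (v₀ +̇ 1̇) ∸̇ (v₁ +̇ 1̇)))) n _)

  -- If s < r, then n < (s+1)² ≤ r² ≤ n. Used in both directions, this gives uniqueness of the root.
  isRoot-≼ : ∀ {n r s} → H ⊢ IsRoot n r → H ⊢ IsRoot n s → H ⊢ r ≼ s
  isRoot-≼ {n} {r} {s} d e = ∨-elim (≺-or-≽ s r)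
    (≺-irrefl (≺-≼-trans (w (∧-elim₂ e)) (≼-trans (*-mono-≼ (≺⇒suc≼ h₀) (≺⇒suc≼ h₀)) (w (∧-elim₁ d))))) h₀

module _ {Γ} {H : List (Fm Γ)} where

  -- Truncated subtraction makes the added term 0 if n + 1 < (r+1)² and 1 otherwise. One unit is
  -- enough, because n < (r+1)² implies n + 1 ≤ (r+1)² < (r+2)².
  IsRoot-step : ∀ {n r} → H ⊢ IsRoot n r →
                H ⊢ IsRoot (n +̇ 1̇) (r +̇ (1̇ ∸̇ ((r +̇ 1̇) *̇ (r +̇ 1̇) ∸̇ (n +̇ 1̇))))
  IsRoot-step {n} {r} d = ∨-elim (≺-or-≽ (n +̇ 1̇) ((r +̇ 1̇) *̇ (r +̇ 1̇)))
    (IsRoot-resp (≐-sym (≐-trans (+-cong (=-refl r) (∸-≼ small)) (ax (+-zero r))))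
      (∧-intro (≼-trans (w (∧-elim₁ d)) (≺⇒≼ (≺-suc n))) h₀))
    (IsRoot-resp (≐-sym (+-cong (=-refl r) (≐-trans (∸-cong (=-refl 1̇) (∸-≼ h₀)) (∸-zero 1̇))))
      (∧-intro h₀ (≼-≺-trans (≺⇒suc≼ (w (∧-elim₂ d)))
        (≺-lin (0≺suc ((r +̇ 1̇) +̇ (r +̇ 1̇))) (solve 1 (λ s → s :* s :+ (s :+ s :+ :con 1)
          := (s :+ :con 1) :* (s :+ :con 1) :+ :con 0) (=-refl _) (r +̇ 1̇))))))
    where
    X : Tm Γ 𝟎
    X = (r +̇ 1̇) *̇ (r +̇ 1̇) ∸̇ (n +̇ 1̇)
    small : (n +̇ 1̇ ≺ (r +̇ 1̇) *̇ (r +̇ 1̇)) ∷ H ⊢ 1̇ ≼ X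
    small = ≼-resp (solve 1 (λ i → :con 0 :+ i := i) (=-refl _) 1̇) (=-refl _) (≺⇒suc≼
      (≺-lin h₀ (≐-trans (ax (+-comm _ _)) (≐-trans (ax (+-zero _))
        (≐-trans (≼⇒+ (≺⇒≼ h₀)) (ax (+-comm _ _)))))))

module _ {Γ} {H : List (Fm Γ)} where

  root-spec : ∀ n → H ⊢ IsRoot n (root n)
  root-spec = ∀-elim (ind (IsRoot v₀ (root v₀)) (and (or lt eq) lt)
    (IsRoot-resp (≐-sym (ax (R₀-zero _ _)))
      (∧-intro (≐⇒≼ (ax (*-zero _))) (*-positive (0≺suc 0̇) (0≺suc 0̇))))
    (IsRoot-resp (≐-sym (root-suc v₀)) (IsRoot-step h₀)))

  pair-def : ∀ m n → H ⊢ pairᵗ · m · n ≐ (m +̇ n) *̇ (m +̇ n) +̇ m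
  pair-def m n = β₂ₛ ∅ ((v₁ +̇ v₀) *̇ (v₁ +̇ v₀) +̇ v₁) m n

  root-pair : ∀ m n → H ⊢ root (pairᵗ · m · n) ≐ m +̇ n
  root-pair m n = ≼-antisym (isRoot-≼ (root-spec p) is) (isRoot-≼ is (root-spec p))
    where
    p = pairᵗ · m · n
    is : H ⊢ IsRoot p (m +̇ n)
    is = ∧-intro (≼-resp (=-refl _) (≐-sym (pair-def m n)) (≼-+ʳ _ m))
      (≺-resp (≐-sym (pair-def m n)) (=-refl _)
        (≺-lin (0≺suc (m +̇ n +̇ n)) (solve 2 (λ m n → (m :+ n) :* (m :+ n) :+ m :+ (m :+ n :+ n :+ :con 1)
          := (m :+ n :+ :con 1) :* (m :+ n :+ :con 1) :+ :con 0) (=-refl _) m n)))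

module _ {Γ} {H : List (Fm Γ)} where

  left-pair : ∀ m n → H ⊢ leftᵗ · (pairᵗ · m · n) ≐ m
  left-pair m n = ≐-trans (βₛ ∅ (v₀ ∸̇ (rootᵗ · v₀) *̇ (rootᵗ · v₀)) _)
    (≐-trans (∸-cong (pair-def m n) (*-cong (root-pair m n) (root-pair m n))) (n+m∸n _ m))

  right-pair : ∀ m n → H ⊢ rightᵗ · (pairᵗ · m · n) ≐ n
  right-pair m n = ≐-trans (βₛ ∅ (rootᵗ · v₀ ∸̇ leftᵗ · v₀) _)
    (≐-trans (∸-cong (root-pair m n) (left-pair m n)) (n+m∸n m n))

-- The operations of Defs without their definitions; only the equations below
-- are used.
opaque

  leftᵒ rightᵒ absᵒ natᵒ 2⁻ᵒ 2·2⁻ᵒ : ∀ {Γ} → Tm Γ 𝟏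
  leftᵒ  = leftᵗ
  rightᵒ = rightᵗ
  absᵒ   = absℚ
  natᵒ   = natℚ
  2⁻ᵒ    = 2⁻
  2·2⁻ᵒ  = 2·2⁻

  addᵒ subᵒ mulᵒ : ∀ {Γ} → Tm Γ (𝟎 ⟶ 𝟎 ⟶ 𝟎)
  addᵒ = addℚ
  subᵒ = subℚ
  mulᵒ = mulℚ

  natᴿᵒ 2⁻ᴿᵒ : ∀ {Γ} → Tm Γ (𝟎 ⟶ 𝟏)
  natᴿᵒ = natᴿ
  2⁻ᴿᵒ  = 2⁻ᴿ

  absᴿᵒ : ∀ {Γ} → Tm Γ (𝟏 ⟶ 𝟏)
  absᴿᵒ = absᴿ

  subᴿᵒ : ∀ {Γ} → Tm Γ (𝟏 ⟶ 𝟏 ⟶ 𝟏)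
  subᴿᵒ = subᴿ

  riemannSumᵒ : ∀ {Γ} → Tm Γ (𝟏 ⟶ 𝟏) → Tm Γ 𝟎 → Tm Γ (𝟎 ⟶ 𝟏) → Tm Γ (𝟎 ⟶ 𝟏) → Tm Γ 𝟏
  riemannSumᵒ = riemannSum

  -- The dyadic number a/2^l; the code stores the denominator minus one.
  frac : ∀ {Γ} → Tm Γ 𝟎 → Tm Γ 𝟎 → Tm Γ 𝟎
  frac a l = ratᵗ a 0̇ (pow2 l ∸̇ 1̇)

module O = Formulas Tm Fm _·_ con v₀ v₁ v₂ v₃ ↑_ _≐_ _≺_ ⊥̇ _∧̇_ _∨̇_ _⇒_ ∀[_]_ ∃[_]_
  leftᵒ rightᵒ absᵒ 2⁻ᵒ 2·2⁻ᵒ addᵒ subᵒ natᴿᵒ 2⁻ᴿᵒ absᴿᵒ subᴿᵒ riemannSumᵒ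

opaque
  unfolding leftᵒ riemannSumᵒ frac

  leftᵒ-sub : ∀ {Γ Δ} (s : Sub Γ Δ) → subT s leftᵒ ≡ leftᵒ
  leftᵒ-sub s = refl
  rightᵒ-sub : ∀ {Γ Δ} (s : Sub Γ Δ) → subT s rightᵒ ≡ rightᵒ
  rightᵒ-sub s = refl
  absᵒ-sub : ∀ {Γ Δ} (s : Sub Γ Δ) → subT s absᵒ ≡ absᵒ
  absᵒ-sub s = refl
  natᵒ-sub : ∀ {Γ Δ} (s : Sub Γ Δ) → subT s natᵒ ≡ natᵒ
  natᵒ-sub s = refl
  2⁻ᵒ-sub : ∀ {Γ Δ} (s : Sub Γ Δ) → subT s 2⁻ᵒ ≡ 2⁻ᵒ
  2⁻ᵒ-sub s = refl
  2·2⁻ᵒ-sub : ∀ {Γ Δ} (s : Sub Γ Δ) → subT s 2·2⁻ᵒ ≡ 2·2⁻ᵒ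
  2·2⁻ᵒ-sub s = refl
  addᵒ-sub : ∀ {Γ Δ} (s : Sub Γ Δ) → subT s addᵒ ≡ addᵒ
  addᵒ-sub s = refl
  subᵒ-sub : ∀ {Γ Δ} (s : Sub Γ Δ) → subT s subᵒ ≡ subᵒ
  subᵒ-sub s = refl
  natᴿᵒ-sub : ∀ {Γ Δ} (s : Sub Γ Δ) → subT s natᴿᵒ ≡ natᴿᵒ
  natᴿᵒ-sub s = refl
  2⁻ᴿᵒ-sub : ∀ {Γ Δ} (s : Sub Γ Δ) → subT s 2⁻ᴿᵒ ≡ 2⁻ᴿᵒ
  2⁻ᴿᵒ-sub s = refl
  absᴿᵒ-sub : ∀ {Γ Δ} (s : Sub Γ Δ) → subT s absᴿᵒ ≡ absᴿᵒ
  absᴿᵒ-sub s = refl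
  subᴿᵒ-sub : ∀ {Γ Δ} (s : Sub Γ Δ) → subT s subᴿᵒ ≡ subᴿᵒ
  subᴿᵒ-sub s = refl
  frac-sub : ∀ {Γ Δ} (s : Sub Γ Δ) a l → subT s (frac a l) ≡ frac (subT s a) (subT s l)
  frac-sub s a l = refl

module _ {Γ} {H : List (Fm Γ)} where
  open O using (pos; neg; den)

  opaque
    unfolding leftᵒ riemannSumᵒ frac

    leftᵒ-pair : ∀ m n → H ⊢ leftᵒ · (pairᵗ · m · n) ≐ m
    leftᵒ-pair = left-pair

    rightᵒ-pair : ∀ m n → H ⊢ rightᵒ · (pairᵗ · m · n) ≐ n
    rightᵒ-pair = right-pair

    add-def : ∀ q r → H ⊢ addᵒ · q · r ≐ ratᵗ (pos q *̇ den r +̇ pos r *̇ den q)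
                (neg q *̇ den r +̇ neg r *̇ den q) (den q *̇ den r ∸̇ 1̇)
    add-def q r = β₂ₛ ∅ (ratᵗ (Defs.pos v₁ *̇ Defs.den v₀ +̇ Defs.pos v₀ *̇ Defs.den v₁)
                   (Defs.neg v₁ *̇ Defs.den v₀ +̇ Defs.neg v₀ *̇ Defs.den v₁)
                   (Defs.den v₁ *̇ Defs.den v₀ ∸̇ 1̇)) q r

    mul-def : ∀ q r → H ⊢ mulᵒ · q · r ≐ ratᵗ (pos q *̇ pos r +̇ neg q *̇ neg r)
                (pos q *̇ neg r +̇ neg q *̇ pos r) (den q *̇ den r ∸̇ 1̇)
    mul-def q r = β₂ₛ ∅ (ratᵗ (Defs.pos v₁ *̇ Defs.pos v₀ +̇ Defs.neg v₁ *̇ Defs.neg v₀)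
                   (Defs.pos v₁ *̇ Defs.neg v₀ +̇ Defs.neg v₁ *̇ Defs.pos v₀)
                   (Defs.den v₁ *̇ Defs.den v₀ ∸̇ 1̇)) q r

    sub-def : ∀ q r → H ⊢ subᵒ · q · r ≐ addᵒ · q · ratᵗ (neg r) (pos r) (rightᵒ · r)
    sub-def q r = ≐-trans (β₂ₛ ∅ (addℚ · v₁ · (negℚ · v₀)) q r)
      (Eq-·ʳ (addℚ · q) (βₛ ∅ (ratᵗ (Defs.neg v₀) (Defs.pos v₀) (Defs.den⁻ v₀)) r))

    abs-def : ∀ q → H ⊢ absᵒ · q ≐ ratᵗ ((pos q ∸̇ neg q) +̇ (neg q ∸̇ pos q)) 0̇ (rightᵒ · q)
    abs-def q = βₛ ∅ (ratᵗ ((Defs.pos v₀ ∸̇ Defs.neg v₀) +̇ (Defs.neg v₀ ∸̇ Defs.pos v₀)) 0̇ (Defs.den⁻ v₀)) q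

    nat-def : ∀ a → H ⊢ natᵒ · a ≐ ratᵗ a 0̇ 0̇
    nat-def a = βₛ ∅ (ratᵗ v₀ 0̇ 0̇) a

    frac-def : ∀ a l → H ⊢ frac a l ≐ ratᵗ a 0̇ (pow2 l ∸̇ 1̇)
    frac-def a l = =-refl _

    2⁻-def : ∀ n → H ⊢ 2⁻ᵒ · n ≐ frac 1̇ n
    2⁻-def n = βₛ ∅ (ratᵗ 1̇ 0̇ (pow2ᵗ · v₀ ∸̇ 1̇)) n

    2·2⁻-def : ∀ n → H ⊢ 2·2⁻ᵒ · n ≐ frac (1̇ +̇ 1̇) n
    2·2⁻-def n = βₛ ∅ (ratᵗ (1̇ +̇ 1̇) 0̇ (pow2ᵗ · v₀ ∸̇ 1̇)) n

    natᴿ-def : ∀ a n → H ⊢ natᴿᵒ · a · n ≐ natᵒ · a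
    natᴿ-def a n = β₂ₛ ∅ (natℚ · v₁) a n

    2⁻ᴿ-def : ∀ m n → H ⊢ 2⁻ᴿᵒ · m · n ≐ 2⁻ᵒ · m
    2⁻ᴿ-def m n = β₂ₛ ∅ (2⁻ · v₁) m n

    absᴿ-def : ∀ x n → H ⊢ absᴿᵒ · x · n ≐ absᵒ · (x · n)
    absᴿ-def x n = β₂ₛ ∅ (absℚ · (v₁ · v₀)) x n

    subᴿ-def : ∀ x y n → H ⊢ subᴿᵒ · x · y · n ≐ subᵒ · (x · (n +̇ 1̇)) · (y · (n +̇ 1̇))
    subᴿ-def x y n = β₃ₛ ∅ (subℚ · (v₂ · (v₀ +̇ 1̇)) · (v₁ · (v₀ +̇ 1̇))) x y n

-- Equations for products, finite sums and Riemann sums of reals.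

sumStep : Tm (𝟎 ∷ 𝟎 ∷ 𝟎 ∷ 𝟎 ∷ (𝟎 ⟶ 𝟏) ∷ []) 𝟎
sumStep = addℚ · v₀ · (↑ ↑ v₂ · v₁ · (↑ ↑ v₀ +̇ ↑ ↑ v₁))

sumRec : Tm (𝟎 ∷ 𝟎 ∷ (𝟎 ⟶ 𝟏) ∷ []) 𝟏
sumRec = con (Rᶜ 𝟎) · (ƛ ƛ sumStep) · (natℚ · 0̇)

opaque
  unfolding leftᵒ

  mulᴿᵒ : ∀ {Γ} → Tm Γ (𝟏 ⟶ 𝟏 ⟶ 𝟏)
  mulᴿᵒ = mulᴿ

  sumᴿᵒ : ∀ {Γ} → Tm Γ ((𝟎 ⟶ 𝟏) ⟶ 𝟎 ⟶ 𝟏)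
  sumᴿᵒ = sumᴿ

  shift : ∀ {Γ} → Tm Γ 𝟏 → Tm Γ 𝟏 → Tm Γ 𝟎
  shift u v = boundℚ · (u · 0̇) +̇ boundℚ · (v · 0̇) +̇ 1̇ +̇ 1̇

  -- The partial sums inside the n-th approximation of `sumᴿ · z · k`, as a function of the number
  -- of terms. All summands are read at index n + k, however few of them are added, so partial sums
  -- share one precision.
  sumTo : ∀ {Γ} → Tm Γ (𝟎 ⟶ 𝟏) → Tm Γ 𝟎 → Tm Γ 𝟎 → Tm Γ 𝟏
  sumTo z k n = subT (∅ ▸ z ▸ k ▸ n) sumRec

opaque
  unfolding leftᵒ mulᴿᵒ sumᴿᵒ sumTo

  mulᴿᵒ-sub : ∀ {Γ Δ} (s : Sub Γ Δ) → subT s mulᴿᵒ ≡ mulᴿᵒ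
  mulᴿᵒ-sub s = refl

  sumᴿᵒ-sub : ∀ {Γ Δ} (s : Sub Γ Δ) → subT s sumᴿᵒ ≡ sumᴿᵒ
  sumᴿᵒ-sub s = refl

  sumTo-def : ∀ {Γ} z (k n : Tm Γ 𝟎) → sumTo z k n ≡ subT (∅ ▸ z ▸ k ▸ n) sumRec
  sumTo-def z k n = refl

sumTo-sub : ∀ {Γ Δ} (s : Sub Γ Δ) z k n → subT s (sumTo z k n) ≡ sumTo (subT s z) (subT s k) (subT s n)
sumTo-sub s z k n = trans (cong (subT s) (sumTo-def z k n)) (trans
  (trans (subT-subT s (∅ ▸ z ▸ k ▸ n) sumRec)
    (subT-cong {s = s ∘ₛ (∅ ▸ z ▸ k ▸ n)} {∅ ▸ subT s z ▸ subT s k ▸ subT s n}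
       (λ { (here refl) → refl
          ; (there (here refl)) → refl
          ; (there (there (here refl))) → refl }) sumRec))
  (sym (sumTo-def (subT s z) (subT s k) (subT s n))))

module _ {Γ} {H : List (Fm Γ)} where

  opaque
    unfolding leftᵒ mulᴿᵒ sumᴿᵒ sumTo shift

    mulᴿ-at : ∀ u v p → H ⊢ mulᴿᵒ · u · v · p ≐ mulᵒ · (u · (p +̇ shift u v)) · (v · (p +̇ shift u v))
    mulᴿ-at u v p = ≐-trans
      (β₃ₛ ∅ ((ƛ mulℚ · (v₃ · v₀) · (v₂ · v₀))
        · (v₀ +̇ (boundℚ · (v₂ · 0̇) +̇ boundℚ · (v₁ · 0̇) +̇ 1̇ +̇ 1̇))) u v p)
      (βₛ (∅ ▸ u ▸ v ▸ p) (mulℚ · (v₃ · v₀) · (v₂ · v₀)) (p +̇ shift u v))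

module _ {Γ} {H : List (Fm Γ)} where
  opaque
    unfolding leftᵒ mulᴿᵒ sumᴿᵒ sumTo shift
    sumᴿ-at : ∀ z k n → H ⊢ sumᴿᵒ · z · k · n ≐ sumTo z k n · k
    sumᴿ-at z k n = β₃ₛ ∅ (sumRec · v₁) z k n

    sumTo-zero : ∀ z k n → H ⊢ sumTo z k n · 0̇ ≐ natᵒ · 0̇
    sumTo-zero z k n = ax (R₀-zero _ _)

    sumTo-suc : ∀ z k n j → H ⊢ sumTo z k n · (j +̇ 1̇) ≐ addᵒ · (sumTo z k n · j) · (z · j · (n +̇ k))
    sumTo-suc z k n j = ≐-trans (ax (R₀-suc _ _ j)) (β₂ₛ (∅ ▸ z ▸ k ▸ n) sumStep j (sumTo z k n · j))

summandBody : ∀ {Γ} → Tm Γ (𝟏 ⟶ 𝟏) → Tm Γ (𝟎 ⟶ 𝟏) → Tm Γ (𝟎 ⟶ 𝟏) → Tm (𝟎 ∷ Γ) 𝟏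
summandBody f x t = mulᴿᵒ · (↑ f · (↑ t · v₀)) · (subᴿᵒ · (↑ x · (v₀ +̇ 1̇)) · (↑ x · v₀))

summandBody-sub : ∀ {Γ Δ} (s : Sub Γ Δ) f x t →
  subT (lift s) (summandBody f x t) ≡ summandBody (subT s f) (subT s x) (subT s t)
summandBody-sub s f x t = cong₂ _·_
  (cong₂ _·_ (mulᴿᵒ-sub (lift s)) (cong₂ _·_ (subT-lift-↑ s f) (cong (_· v₀) (subT-lift-↑ s t))))
  (cong₂ _·_ (cong₂ _·_ (subᴿᵒ-sub (lift s)) (cong (_· (v₀ +̇ 1̇)) (subT-lift-↑ s x)))
             (cong (_· v₀) (subT-lift-↑ s x)))

opaque
  summand : ∀ {Γ} → Tm Γ (𝟏 ⟶ 𝟏) → Tm Γ (𝟎 ⟶ 𝟏) → Tm Γ (𝟎 ⟶ 𝟏) → Tm Γ (𝟎 ⟶ 𝟏)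
  summand f x t = ƛ summandBody f x t

  summand-sub : ∀ {Γ Δ} (s : Sub Γ Δ) f x t →
                subT s (summand f x t) ≡ summand (subT s f) (subT s x) (subT s t)
  summand-sub s f x t = trans (subT-ƛ s (summandBody f x t)) (cong ƛ_ (summandBody-sub s f x t))

  summand-at : ∀ {Γ} {H : List (Fm Γ)} f x t j → H ⊢ Eq 𝟏 (summand f x t · j)
                 (mulᴿᵒ · (f · (t · j)) · (subᴿᵒ · (x · (j +̇ 1̇)) · (x · j)))
  summand-at f x t j = ≡⇒Eq
    (cong₂ _·_
      (cong₂ _·_ (mulᴿᵒ-sub (var ▸ j)) (cong₂ _·_ ([]-↑ j f) (cong (_· j) ([]-↑ j t))))
      (cong₂ _·_ (cong₂ _·_ (subᴿᵒ-sub (var ▸ j)) (cong (_· (j +̇ 1̇)) ([]-↑ j x)))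
                 (cong (_· j) ([]-↑ j x))))
    (β (summandBody f x t) j)

opaque
  unfolding mulᴿᵒ leftᵒ sumᴿᵒ
  mulᴿᵒ≡ : ∀ {Γ} → mulᴿ {Γ} ≡ mulᴿᵒ
  mulᴿᵒ≡ = refl
  sumᴿᵒ≡ : ∀ {Γ} → sumᴿ {Γ} ≡ sumᴿᵒ
  sumᴿᵒ≡ = refl
  subᴿ≡ : (λ Γ → subᴿᵒ {Γ}) ≡ (λ Γ → subᴿ {Γ})
  subᴿ≡ = refl

family-at : ∀ {A : Cxt → Set} {F G : ∀ Γ → A Γ} → F ≡ G → ∀ Γ → F Γ ≡ G Γ
family-at refl Γ = refl

-- The Riemann sum with its operations as parameters: the concrete operations are exchanged for the
-- opaque ones by congruence, without unfolding them under `ƛ`.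
abstractSum : ∀ {Γ} → Tm (𝟎 ∷ Γ) (𝟏 ⟶ 𝟏 ⟶ 𝟏) → Tm (𝟎 ∷ Γ) (𝟏 ⟶ 𝟏 ⟶ 𝟏) → Tm Γ ((𝟎 ⟶ 𝟏) ⟶ 𝟎 ⟶ 𝟏) →
  Tm Γ (𝟏 ⟶ 𝟏) → Tm Γ 𝟎 → Tm Γ (𝟎 ⟶ 𝟏) → Tm Γ (𝟎 ⟶ 𝟏) → Tm Γ 𝟏
abstractSum m d σ f k x t = σ
  · (ƛ m · (↑ f · (↑ t · v₀)) · (d · (↑ x · (v₀ +̇ 1̇)) · (↑ x · v₀)))
  · k

opaque
  unfolding riemannSumᵒ

  riemannSumᵒ-unfold : ∀ {Γ} (f : Tm Γ (𝟏 ⟶ 𝟏)) k x t → riemannSumᵒ f k x t ≡ abstractSum mulᴿ subᴿ sumᴿ f k x t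
  riemannSumᵒ-unfold f k x t = refl

opaque
  unfolding summand

  summand-unfold : ∀ {Γ} (f : Tm Γ (𝟏 ⟶ 𝟏)) k x t → abstractSum mulᴿᵒ subᴿᵒ sumᴿᵒ f k x t ≡ sumᴿᵒ · summand f x t · k
  summand-unfold f k x t = refl

riemannSum-def : ∀ {Γ} (f : Tm Γ (𝟏 ⟶ 𝟏)) k x t → riemannSumᵒ f k x t ≡ sumᴿᵒ · summand f x t · k
riemannSum-def f k x t = trans (riemannSumᵒ-unfold f k x t) (trans
  (cong₂ (λ m d → abstractSum m d sumᴿ f k x t) mulᴿᵒ≡ (sym (family-at subᴿ≡ _)))
  (trans (cong (λ σ → abstractSum mulᴿᵒ subᴿᵒ σ f k x t) sumᴿᵒ≡) (summand-unfold f k x t)))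

riemannSumᵒ-sub : ∀ {Γ Δ} (s : Sub Γ Δ) f k x t →
                  subT s (riemannSumᵒ f k x t) ≡ riemannSumᵒ (subT s f) (subT s k) (subT s x) (subT s t)
riemannSumᵒ-sub s f k x t = trans (cong (subT s) (riemannSum-def f k x t))
  (trans (cong₂ (λ a b → a · b · subT s k) (sumᴿᵒ-sub s) (summand-sub s f x t))
         (sym (riemannSum-def (subT s f) (subT s k) (subT s x) (subT s t))))

-- Templates: terms and formulas over opaque constants, evaluated in an
-- environment of terms.  Evaluation commutes with substitution, and on concrete
-- templates it computes, so that no substitution is ever pushed into a constant.

infixl 20 _·_
infix  12 _≐_ _≺_
infixr 9  _∧̇_
infixr 8  _∨̇_
infixr 7  _⇒_ ∀[_]_ ∃[_]_

data Tp (Γ : Cxt) : Ty → Set where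
  var : ∀ {τ} → τ ∈ Γ → Tp Γ τ
  cst : ∀ {τ} (c : ∀ Δ → Tm Δ τ) → (∀ {Δ Θ} (s : Sub Δ Θ) → subT s (c Δ) ≡ c Θ) → Tp Γ τ
  _·_ : ∀ {σ τ} → Tp Γ (σ ⟶ τ) → Tp Γ σ → Tp Γ τ
  -- For `frac`, `riemannSumᵒ` and other operations that are Agda functions on terms and not
  -- constants of the language. The two proofs are what `eval-cong` and `eval-sub` require of them.
  fun : ∀ {Θ τ} (g : ∀ {Δ} → Sub Θ Δ → Tm Δ τ) →
        (∀ {Δ} {s s′ : Sub Θ Δ} → s ≗ₛ s′ → g s ≡ g s′) →
        (∀ {Δ Δ′} (r : Sub Δ Δ′) (s : Sub Θ Δ) → subT r (g s) ≡ g (r ∘ₛ s)) →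
        (∀ {τ} → τ ∈ Θ → Tp Γ τ) → Tp Γ τ

eval : ∀ {Γ Δ τ} → Tp Γ τ → Sub Γ Δ → Tm Δ τ
eval (var x)   s = s x
eval (cst c _) s = c _
eval (t · u)   s = eval t s · eval u s
eval (fun g _ _ ts) s = g (λ x → eval (ts x) s)

eval-cong : ∀ {Γ Δ τ} {s s′ : Sub Γ Δ} → s ≗ₛ s′ → (t : Tp Γ τ) → eval t s ≡ eval t s′
eval-cong e (var x)   = e x
eval-cong e (cst c _) = refl
eval-cong e (t · u)   = cong₂ _·_ (eval-cong e t) (eval-cong e u)
eval-cong e (fun g c _ ts) = c (λ x → eval-cong e (ts x))

eval-sub : ∀ {Γ Δ Θ τ} (r : Sub Δ Θ) (s : Sub Γ Δ) (t : Tp Γ τ) →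
           subT r (eval t s) ≡ eval t (r ∘ₛ s)
eval-sub r s (var x)   = refl
eval-sub r s (cst c e) = e r
eval-sub r s (t · u)   = cong₂ _·_ (eval-sub r s t) (eval-sub r s u)
eval-sub r s (fun g c e ts) = trans (e r _) (c (λ x → eval-sub r s (ts x)))

upᵖ : ∀ {Γ σ τ} → Tp Γ τ → Tp (σ ∷ Γ) τ
upᵖ (var x)        = var (there x)
upᵖ (cst c e)      = cst c e
upᵖ (t · u)        = upᵖ t · upᵖ u
upᵖ (fun g c e ts) = fun g c e (λ x → upᵖ (ts x))

eval-upᵖ : ∀ {Γ Δ σ τ} (s : Sub (σ ∷ Γ) Δ) (t : Tp Γ τ) → eval (upᵖ t) s ≡ eval t (λ x → s (there x))
eval-upᵖ s (var x)        = refl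
eval-upᵖ s (cst c e)      = refl
eval-upᵖ s (t · u)        = cong₂ _·_ (eval-upᵖ s t) (eval-upᵖ s u)
eval-upᵖ s (fun g c e ts) = c (λ x → eval-upᵖ s (ts x))

eval-↑ : ∀ {Γ Δ σ τ} (s : Sub Γ Δ) (t : Tp Γ τ) → ↑_ {σ = σ} (eval t s) ≡ eval t (λ x → ↑ s x)
eval-↑ s t = trans (renT-sub there (eval t s)) (trans (eval-sub (renₛ there) s t)
  (eval-cong (λ x → sym (renT-sub there (s x))) t))

tsub : ∀ {Γ Δ τ} → (∀ {τ} → τ ∈ Γ → Tp Δ τ) → Tp Γ τ → Tp Δ τ
tsub ts (var x)         = ts x
tsub ts (cst c e)       = cst c e
tsub ts (t · u)         = tsub ts t · tsub ts u
tsub ts (fun g c e us)  = fun g c e (λ x → tsub ts (us x))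

eval-tsub : ∀ {Γ Δ Θ τ} (s : Sub Δ Θ) (ts : ∀ {τ} → τ ∈ Γ → Tp Δ τ) (t : Tp Γ τ) →
            eval (tsub ts t) s ≡ eval t (λ x → eval (ts x) s)
eval-tsub s ts (var x)        = refl
eval-tsub s ts (cst c e)      = refl
eval-tsub s ts (t · u)        = cong₂ _·_ (eval-tsub s ts t) (eval-tsub s ts u)
eval-tsub s ts (fun g c e us) = c (λ x → eval-tsub s ts (us x))

liftᵖ : ∀ {Γ Δ σ} → (∀ {τ} → τ ∈ Γ → Tp Δ τ) → (∀ {τ} → τ ∈ (σ ∷ Γ) → Tp (σ ∷ Δ) τ)
liftᵖ ts (here refl) = var (here refl)
liftᵖ ts (there x)   = upᵖ (ts x)

eval-liftᵖ : ∀ {Γ Δ Θ σ} (s : Sub Δ Θ) (ts : ∀ {τ} → τ ∈ Γ → Tp Δ τ) →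
             (λ {τ} x → eval (liftᵖ {σ = σ} ts {τ} x) (lift s)) ≗ₛ lift (λ x → eval (ts x) s)
eval-liftᵖ s ts (here refl) = refl
eval-liftᵖ s ts (there x)   = trans (eval-upᵖ (lift s) (ts x)) (sym (eval-↑ s (ts x)))

data Fp (Γ : Cxt) : Set where
  _≐_ _≺_     : Tp Γ 𝟎 → Tp Γ 𝟎 → Fp Γ
  ⊥̇           : Fp Γ
  _∧̇_ _∨̇_ _⇒_ : Fp Γ → Fp Γ → Fp Γ
  ∀[_]_ ∃[_]_ : (σ : Ty) → Fp (σ ∷ Γ) → Fp Γ

⟪_⟫ : ∀ {Γ Δ} → Fp Γ → Sub Γ Δ → Fm Δ
⟪ t ≐ u ⟫    s = eval t s ≐ eval u s
⟪ t ≺ u ⟫    s = eval t s ≺ eval u s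
⟪ ⊥̇ ⟫        s = ⊥̇
⟪ φ ∧̇ ψ ⟫    s = ⟪ φ ⟫ s ∧̇ ⟪ ψ ⟫ s
⟪ φ ∨̇ ψ ⟫    s = ⟪ φ ⟫ s ∨̇ ⟪ ψ ⟫ s
⟪ φ ⇒ ψ ⟫    s = ⟪ φ ⟫ s ⇒ ⟪ ψ ⟫ s
⟪ ∀[ σ ] φ ⟫ s = ∀[ σ ] ⟪ φ ⟫ (lift s)
⟪ ∃[ σ ] φ ⟫ s = ∃[ σ ] ⟪ φ ⟫ (lift s)

⟪⟫-cong : ∀ {Γ Δ} {s s′ : Sub Γ Δ} → s ≗ₛ s′ → (φ : Fp Γ) → ⟪ φ ⟫ s ≡ ⟪ φ ⟫ s′
⟪⟫-cong e (t ≐ u)    = cong₂ _≐_ (eval-cong e t) (eval-cong e u)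
⟪⟫-cong e (t ≺ u)    = cong₂ _≺_ (eval-cong e t) (eval-cong e u)
⟪⟫-cong e ⊥̇          = refl
⟪⟫-cong e (φ ∧̇ ψ)    = cong₂ _∧̇_ (⟪⟫-cong e φ) (⟪⟫-cong e ψ)
⟪⟫-cong e (φ ∨̇ ψ)    = cong₂ _∨̇_ (⟪⟫-cong e φ) (⟪⟫-cong e ψ)
⟪⟫-cong e (φ ⇒ ψ)    = cong₂ _⇒_ (⟪⟫-cong e φ) (⟪⟫-cong e ψ)
⟪⟫-cong e (∀[ σ ] φ) = cong (∀[ σ ]_) (⟪⟫-cong (lift-cong e) φ)
⟪⟫-cong e (∃[ σ ] φ) = cong (∃[ σ ]_) (⟪⟫-cong (lift-cong e) φ)

⟪⟫-sub : ∀ {Γ Δ Θ} (r : Sub Δ Θ) (s : Sub Γ Δ) (φ : Fp Γ) → subF r (⟪ φ ⟫ s) ≡ ⟪ φ ⟫ (r ∘ₛ s)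
⟪⟫-sub r s (t ≐ u)    = cong₂ _≐_ (eval-sub r s t) (eval-sub r s u)
⟪⟫-sub r s (t ≺ u)    = cong₂ _≺_ (eval-sub r s t) (eval-sub r s u)
⟪⟫-sub r s ⊥̇          = refl
⟪⟫-sub r s (φ ∧̇ ψ)    = cong₂ _∧̇_ (⟪⟫-sub r s φ) (⟪⟫-sub r s ψ)
⟪⟫-sub r s (φ ∨̇ ψ)    = cong₂ _∨̇_ (⟪⟫-sub r s φ) (⟪⟫-sub r s ψ)
⟪⟫-sub r s (φ ⇒ ψ)    = cong₂ _⇒_ (⟪⟫-sub r s φ) (⟪⟫-sub r s ψ)
⟪⟫-sub r s (∀[ σ ] φ) =
  cong (∀[ σ ]_) (trans (⟪⟫-sub (lift r) (lift s) φ) (⟪⟫-cong (lift-∘ r s) φ))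
⟪⟫-sub r s (∃[ σ ] φ) =
  cong (∃[ σ ]_) (trans (⟪⟫-sub (lift r) (lift s) φ) (⟪⟫-cong (lift-∘ r s) φ))

fsub : ∀ {Γ Δ} → (∀ {τ} → τ ∈ Γ → Tp Δ τ) → Fp Γ → Fp Δ
fsub ts (t ≐ u)    = tsub ts t ≐ tsub ts u
fsub ts (t ≺ u)    = tsub ts t ≺ tsub ts u
fsub ts ⊥̇          = ⊥̇
fsub ts (φ ∧̇ ψ)    = fsub ts φ ∧̇ fsub ts ψ
fsub ts (φ ∨̇ ψ)    = fsub ts φ ∨̇ fsub ts ψ
fsub ts (φ ⇒ ψ)    = fsub ts φ ⇒ fsub ts ψ
fsub ts (∀[ σ ] φ) = ∀[ σ ] fsub (liftᵖ ts) φ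
fsub ts (∃[ σ ] φ) = ∃[ σ ] fsub (liftᵖ ts) φ

⟪⟫-fsub : ∀ {Γ Δ Θ} (s : Sub Δ Θ) (ts : ∀ {τ} → τ ∈ Γ → Tp Δ τ) (φ : Fp Γ) →
          ⟪ fsub ts φ ⟫ s ≡ ⟪ φ ⟫ (λ x → eval (ts x) s)
⟪⟫-fsub s ts (t ≐ u)    = cong₂ _≐_ (eval-tsub s ts t) (eval-tsub s ts u)
⟪⟫-fsub s ts (t ≺ u)    = cong₂ _≺_ (eval-tsub s ts t) (eval-tsub s ts u)
⟪⟫-fsub s ts ⊥̇          = refl
⟪⟫-fsub s ts (φ ∧̇ ψ)    = cong₂ _∧̇_ (⟪⟫-fsub s ts φ) (⟪⟫-fsub s ts ψ)
⟪⟫-fsub s ts (φ ∨̇ ψ)    = cong₂ _∨̇_ (⟪⟫-fsub s ts φ) (⟪⟫-fsub s ts ψ)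
⟪⟫-fsub s ts (φ ⇒ ψ)    = cong₂ _⇒_ (⟪⟫-fsub s ts φ) (⟪⟫-fsub s ts ψ)
⟪⟫-fsub s ts (∀[ σ ] φ) =
  cong (∀[ σ ]_) (trans (⟪⟫-fsub (lift s) (liftᵖ ts) φ) (⟪⟫-cong (eval-liftᵖ s ts) φ))
⟪⟫-fsub s ts (∃[ σ ] φ) =
  cong (∃[ σ ]_) (trans (⟪⟫-fsub (lift s) (liftᵖ ts) φ) (⟪⟫-cong (eval-liftᵖ s ts) φ))

infix 26 ⇑_
⇑_ : ∀ {Γ Δ σ} → Sub Γ Δ → Sub Γ (σ ∷ Δ)
(⇑ s) x = ↑ s x

⟪⟫-[] : ∀ {Γ Δ σ} (s : Sub Γ Δ) (φ : Fp (σ ∷ Γ)) (t : Tm Δ σ) →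
        ⟪ φ ⟫ (lift s) [ t ] ≡ ⟪ φ ⟫ (s ▸ t)
⟪⟫-[] s φ t = trans (⟪⟫-sub (var ▸ t) (lift s) φ)
  (⟪⟫-cong {s = (var ▸ t) ∘ₛ lift s} {s ▸ t}
    (λ { (here refl) → refl ; (there x) → []-↑ t (s x) }) φ)

⟪⟫-↑ : ∀ {Γ Δ σ} (s : Sub Γ Δ) (φ : Fp Γ) → ↑ᶠ_ {σ = σ} (⟪ φ ⟫ s) ≡ ⟪ φ ⟫ (⇑ s)
⟪⟫-↑ s φ = trans (renF-sub there (⟪ φ ⟫ s)) (trans (⟪⟫-sub (renₛ there) s φ)
  (⟪⟫-cong (λ x → sym (renT-sub there (s x))) φ))

instantiate : ∀ {Θ σ} → Tp Θ σ → (∀ {τ} → τ ∈ (σ ∷ Θ) → Tp Θ τ)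
instantiate t (here refl) = t
instantiate t (there x)   = var x

module _ {Γ} {H : List (Fm Γ)} {Θ : Cxt} (s : Sub Θ Γ) where

  ∀E : ∀ {σ} (φ : Fp (σ ∷ Θ)) → H ⊢ ∀[ σ ] ⟪ φ ⟫ (lift s) → (t : Tm Γ σ) → H ⊢ ⟪ φ ⟫ (s ▸ t)
  ∀E φ d t = subst (H ⊢_) (⟪⟫-[] s φ t) (∀-elim d t)

  ∃I : ∀ {σ} (φ : Fp (σ ∷ Θ)) (t : Tm Γ σ) → H ⊢ ⟪ φ ⟫ (s ▸ t) → H ⊢ ∃[ σ ] ⟪ φ ⟫ (lift s)
  ∃I φ t d = ∃-intro t (subst (H ⊢_) (sym (⟪⟫-[] s φ t)) d)

  ∃E : ∀ {σ} {χ : Fm (σ ∷ Γ)} (ψ : Fp Θ) → H ⊢ ∃[ σ ] χ →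
       χ ∷ map ↑ᶠ_ H ⊢ ⟪ ψ ⟫ (⇑ s) → H ⊢ ⟪ ψ ⟫ s
  ∃E ψ d e = ∃-elim d (subst (_ ⊢_) (sym (⟪⟫-↑ s ψ)) e)

  ↑E : ∀ {σ} (φ : Fp Θ) → H ⊢ ⟪ φ ⟫ s → map (↑ᶠ_ {σ = σ}) H ⊢ ⟪ φ ⟫ (⇑ s)
  ↑E φ d = subst (_ ⊢_) (⟪⟫-↑ s φ) (⊢-↑ d)

  -- Only φ has to be quantifier-free. The hypotheses H are weakened and kept outside the induction
  -- formula, so they may be of any complexity.
  IND : (φ : Fp (𝟎 ∷ Θ)) → QF (⟪ φ ⟫ (lift s)) → H ⊢ ⟪ φ ⟫ (s ▸ 0̇) →
        ⟪ φ ⟫ (lift s) ∷ map ↑ᶠ_ H ⊢ ⟪ φ ⟫ (⇑ s ▸ (v₀ +̇ 1̇)) → (t : Tm Γ 𝟎) → H ⊢ ⟪ φ ⟫ (s ▸ t)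
  IND φ q d e = ∀E φ (⇒-elim (ax (QF-ind (⟪ φ ⟫ (lift s)) q))
    (∧-intro (subst (H ⊢_) (sym (⟪⟫-[] s φ 0̇)) d)
      (∀-intro (⇒-intro (subst (⟪ φ ⟫ (lift s) ∷ map ↑ᶠ_ H ⊢_) (sym step) e)))))
    where
    step = trans (⟪⟫-sub succₛ (lift s) φ)
      (⟪⟫-cong {s = succₛ ∘ₛ lift s} {⇑ s ▸ (v₀ +̇ 1̇)}
        (λ { (here refl) → refl
           ; (there x) → trans (subT-renT succₛ there (s x)) (sym (renT-sub there (s x))) }) φ)

  ⟪⟫-instantiate : ∀ {σ} (φ : Fp (σ ∷ Θ)) (t : Tp Θ σ) → ⟪ fsub (instantiate t) φ ⟫ s ≡ ⟪ φ ⟫ (s ▸ eval t s)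
  ⟪⟫-instantiate φ t = trans (⟪⟫-fsub s (instantiate t) φ)
    (⟪⟫-cong {s = λ x → eval (instantiate t x) s} {s ▸ eval t s} (λ { (here refl) → refl ; (there x) → refl }) φ)

  -- A composite opaque term in the environment would leave a stuck weakening under every binder.
  -- Substituted into the template, it is weakened by computation.
  ∀Eᵖ : ∀ {σ} (φ : Fp (σ ∷ Θ)) (t : Tp Θ σ) → H ⊢ ∀[ σ ] ⟪ φ ⟫ (lift s) → H ⊢ ⟪ fsub (instantiate t) φ ⟫ s
  ∀Eᵖ φ t d = subst (H ⊢_) (sym (⟪⟫-instantiate φ t)) (∀E φ d (eval t s))

  ∃Iᵖ : ∀ {σ} (φ : Fp (σ ∷ Θ)) (t : Tp Θ σ) → H ⊢ ⟪ fsub (instantiate t) φ ⟫ s → H ⊢ ∃[ σ ] ⟪ φ ⟫ (lift s)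
  ∃Iᵖ φ t d = ∃I φ (eval t s) (subst (H ⊢_) (⟪⟫-instantiate φ t) d)

x₀ : ∀ {Γ a} → Tp (a ∷ Γ) a
x₀ = var (here refl)
x₁ : ∀ {Γ a b} → Tp (b ∷ a ∷ Γ) a
x₁ = var (there (here refl))
x₂ : ∀ {Γ a b c} → Tp (c ∷ b ∷ a ∷ Γ) a
x₂ = var (there (there (here refl)))
x₃ : ∀ {Γ a b c d} → Tp (d ∷ c ∷ b ∷ a ∷ Γ) a
x₃ = upᵖ x₂
x₄ : ∀ {Γ a b c d e} → Tp (e ∷ d ∷ c ∷ b ∷ a ∷ Γ) a
x₄ = upᵖ x₃
x₅ : ∀ {Γ a b c d e f} → Tp (f ∷ e ∷ d ∷ c ∷ b ∷ a ∷ Γ) a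
x₅ = upᵖ x₄
x₆ : ∀ {Γ a b c d e f g} → Tp (g ∷ f ∷ e ∷ d ∷ c ∷ b ∷ a ∷ Γ) a
x₆ = upᵖ x₅
x₇ : ∀ {Γ a b c d e f g h} → Tp (h ∷ g ∷ f ∷ e ∷ d ∷ c ∷ b ∷ a ∷ Γ) a
x₇ = upᵖ x₆

infixl 18 _▹_
_▹_ : ∀ {Θ Γ σ} → (∀ {τ} → τ ∈ Θ → Tp Γ τ) → Tp Γ σ → (∀ {τ} → τ ∈ (σ ∷ Θ) → Tp Γ τ)
(s ▹ t) (here refl) = t
(s ▹ t) (there x)   = s x

εᵖ : ∀ {Γ τ} → τ ∈ [] → Tp Γ τ
εᵖ ()

conᵖ : ∀ {Γ τ} → Con τ → Tp Γ τ
conᵖ c = cst (λ _ → con c) (λ _ → refl)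

private
  i₀ : ∀ {a} {Γ : Cxt} → a ∈ (a ∷ Γ)
  i₀ = here refl
  i₁ : ∀ {a b} {Γ : Cxt} → a ∈ (b ∷ a ∷ Γ)
  i₁ = there i₀
  i₂ : ∀ {a b c} {Γ : Cxt} → a ∈ (c ∷ b ∷ a ∷ Γ)
  i₂ = there i₁
  i₃ : ∀ {a b c d} {Γ : Cxt} → a ∈ (d ∷ c ∷ b ∷ a ∷ Γ)
  i₃ = there i₂

  cong₃ : ∀ {A B C D : Set} (f : A → B → C → D) {a a′ b b′ c c′} →
          a ≡ a′ → b ≡ b′ → c ≡ c′ → f a b c ≡ f a′ b′ c′
  cong₃ f refl refl refl = refl

fracᵖ : ∀ {Γ} → Tp Γ 𝟎 → Tp Γ 𝟎 → Tp Γ 𝟎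
fracᵖ a l = fun {Θ = 𝟎 ∷ 𝟎 ∷ []} (λ s → frac (s i₁) (s i₀)) (λ e → cong₂ frac (e i₁) (e i₀))
  (λ r s → frac-sub r _ _) (εᵖ ▹ a ▹ l)

summandᵖ : ∀ {Γ} → Tp Γ (𝟏 ⟶ 𝟏) → Tp Γ (𝟎 ⟶ 𝟏) → Tp Γ (𝟎 ⟶ 𝟏) → Tp Γ (𝟎 ⟶ 𝟏)
summandᵖ f x t = fun {Θ = (𝟎 ⟶ 𝟏) ∷ (𝟎 ⟶ 𝟏) ∷ (𝟏 ⟶ 𝟏) ∷ []} (λ s → summand (s i₂) (s i₁) (s i₀))
  (λ e → cong₃ summand (e i₂) (e i₁) (e i₀)) (λ r s → summand-sub r _ _ _) (εᵖ ▹ f ▹ x ▹ t)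

sumToᵖ : ∀ {Γ} → Tp Γ (𝟎 ⟶ 𝟏) → Tp Γ 𝟎 → Tp Γ 𝟎 → Tp Γ 𝟏
sumToᵖ z k n = fun {Θ = 𝟎 ∷ 𝟎 ∷ (𝟎 ⟶ 𝟏) ∷ []} (λ s → sumTo (s i₂) (s i₁) (s i₀))
  (λ e → cong₃ sumTo (e i₂) (e i₁) (e i₀)) (λ r s → sumTo-sub r _ _ _) (εᵖ ▹ z ▹ k ▹ n)

riemannSumᵖ : ∀ {Γ} → Tp Γ (𝟏 ⟶ 𝟏) → Tp Γ 𝟎 → Tp Γ (𝟎 ⟶ 𝟏) → Tp Γ (𝟎 ⟶ 𝟏) → Tp Γ 𝟏
riemannSumᵖ f k x t = fun {Θ = (𝟎 ⟶ 𝟏) ∷ (𝟎 ⟶ 𝟏) ∷ 𝟎 ∷ (𝟏 ⟶ 𝟏) ∷ []}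
  (λ s → riemannSumᵒ (s i₃) (s i₂) (s i₁) (s i₀))
  (λ e → trans (cong₃ (λ a b c → riemannSumᵒ a b c _) (e i₃) (e i₂) (e i₁)) (cong (riemannSumᵒ _ _ _) (e i₀)))
  (λ r s → riemannSumᵒ-sub r _ _ _ _) (εᵖ ▹ f ▹ k ▹ x ▹ t)

natᴿᵖ 2⁻ᴿᵖ : ∀ {Γ} → Tp Γ (𝟎 ⟶ 𝟏)
natᴿᵖ = cst (λ _ → natᴿᵒ) natᴿᵒ-sub
2⁻ᴿᵖ  = cst (λ _ → 2⁻ᴿᵒ) 2⁻ᴿᵒ-sub

absᴿᵖ : ∀ {Γ} → Tp Γ (𝟏 ⟶ 𝟏)
absᴿᵖ = cst (λ _ → absᴿᵒ) absᴿᵒ-sub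

subᴿᵖ : ∀ {Γ} → Tp Γ (𝟏 ⟶ 𝟏 ⟶ 𝟏)
subᴿᵖ = cst (λ _ → subᴿᵒ) subᴿᵒ-sub

module T = Formulas Tp Fp _·_ conᵖ x₀ x₁ x₂ x₃ upᵖ _≐_ _≺_ ⊥̇ _∧̇_ _∨̇_ _⇒_ ∀[_]_ ∃[_]_
  (cst (λ _ → leftᵒ) leftᵒ-sub) (cst (λ _ → rightᵒ) rightᵒ-sub) (cst (λ _ → absᵒ) absᵒ-sub)
  (cst (λ _ → 2⁻ᵒ) 2⁻ᵒ-sub) (cst (λ _ → 2·2⁻ᵒ) 2·2⁻ᵒ-sub)
  (cst (λ _ → addᵒ) addᵒ-sub) (cst (λ _ → subᵒ) subᵒ-sub)
  natᴿᵖ 2⁻ᴿᵖ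
  absᴿᵖ subᴿᵖ riemannSumᵖ

open T public using () renaming
  ( _⊕_ to _⊕ᵖ_; _⊖_ to _⊖ᵖ_; ∣_∣ to ∣_∣ᵖ; _≤ℚ_ to _≤ℚᵖ_; _<ℚ_ to _<ℚᵖ_; _≼_ to _≼ᵖ_; _+̇_ to _+ᵖ_; _*̇_ to _*ᵖ_
  ; 0̇ to 0ᵖ; 1̇ to 1ᵖ; IsReal to IsRealᵖ; _=ᴿ_ to _=ᴿᵖ_; _≤ᴿ_ to _≤ᴿᵖ_; _<ᴿ_ to _<ᴿᵖ_; _∈I to _∈Iᵖ; I→ℕ to I→ℕᵖ; I→ℝ to I→ℝᵖ
  ; TaggedPartition to TaggedPartitionᵖ; Mesh<2⁻ to Meshᵖ; HasIntegral to HasIntegralᵖ; ¬̇_ to ¬ᵖ_)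

open O using (pos; neg; den; _<ℚ_; _≤ℚ_; _⊕_; _⊖_; ∣_∣; IsReal; _=ᴿ_; _≤ᴿ_)

-- Rationals as an ordered commutative monoid.

0ℚ : ∀ {Γ} → Tm Γ 𝟎
0ℚ = natᵒ · 0̇

-- q codes the fraction (p − n) / d.
record Fraction {Γ} (H : List (Fm Γ)) (q p n d : Tm Γ 𝟎) : Set where
  constructor fraction
  field
    num⁺ : H ⊢ pos q ≐ p
    num⁻ : H ⊢ neg q ≐ n
    denominator : H ⊢ den q ≐ d
open Fraction public

module _ {Γ} {H : List (Fm Γ)} where

  pos-cong : ∀ {q r} → H ⊢ q ≐ r → H ⊢ pos q ≐ pos r
  pos-cong e = Eq-·ʳ leftᵒ (Eq-·ʳ leftᵒ e)

  neg-cong : ∀ {q r} → H ⊢ q ≐ r → H ⊢ neg q ≐ neg r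
  neg-cong e = Eq-·ʳ rightᵒ (Eq-·ʳ leftᵒ e)

  den-cong : ∀ {q r} → H ⊢ q ≐ r → H ⊢ den q ≐ den r
  den-cong e = +-cong (Eq-·ʳ rightᵒ e) (=-refl 1̇)

  fraction-self : ∀ q → Fraction H q (pos q) (neg q) (den q)
  fraction-self q = fraction (=-refl _) (=-refl _) (=-refl _)

  fraction-resp : ∀ {q r p n d} → H ⊢ q ≐ r → Fraction H r p n d → Fraction H q p n d
  fraction-resp e f = fraction (≐-trans (pos-cong e) (num⁺ f)) (≐-trans (neg-cong e) (num⁻ f))
    (≐-trans (den-cong e) (denominator f))

  fraction-cong : ∀ {q p n d p′ n′ d′} → H ⊢ p ≐ p′ → H ⊢ n ≐ n′ → H ⊢ d ≐ d′ →
                  Fraction H q p n d → Fraction H q p′ n′ d′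
  fraction-cong a b c f = fraction (≐-trans (num⁺ f) a) (≐-trans (num⁻ f) b) (≐-trans (denominator f) c)

  fraction-rat : ∀ a b d → Fraction H (ratᵗ a b d) a b (d +̇ 1̇)
  fraction-rat a b d = fraction
    (≐-trans (Eq-·ʳ leftᵒ (leftᵒ-pair _ _)) (leftᵒ-pair _ _))
    (≐-trans (Eq-·ʳ rightᵒ (leftᵒ-pair _ _)) (rightᵒ-pair _ _))
    (+-cong (rightᵒ-pair _ _) (=-refl 1̇))

module _ {Γ} {H : List (Fm Γ)} where

  ⊕-fraction : ∀ {q p n d r p′ n′ d′} → Fraction H q p n d → Fraction H r p′ n′ d′ →
               Fraction H (q ⊕ r) (p *̇ d′ +̇ p′ *̇ d) (n *̇ d′ +̇ n′ *̇ d) (d *̇ d′)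
  ⊕-fraction {q} {r = r} f g = fraction-resp
    (add-def q r)
    (fraction-cong
      (+-cong (*-cong (num⁺ f) (denominator g)) (*-cong (num⁺ g) (denominator f)))
      (+-cong (*-cong (num⁻ f) (denominator g)) (*-cong (num⁻ g) (denominator f)))
      (≐-trans (≐-sym (0≺⇒suc (*-positive (0≺suc _) (0≺suc _)))) (*-cong (denominator f) (denominator g)))
      (fraction-rat _ _ _))

  *-fraction : ∀ {q p n d r p′ n′ d′} → Fraction H q p n d → Fraction H r p′ n′ d′ →
               Fraction H (mulᵒ · q · r) (p *̇ p′ +̇ n *̇ n′) (p *̇ n′ +̇ n *̇ p′) (d *̇ d′)
  *-fraction {q} {r = r} f g = fraction-resp
    (mul-def q r)
    (fraction-cong
      (+-cong (*-cong (num⁺ f) (num⁺ g)) (*-cong (num⁻ f) (num⁻ g)))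
      (+-cong (*-cong (num⁺ f) (num⁻ g)) (*-cong (num⁻ f) (num⁺ g)))
      (≐-trans (≐-sym (0≺⇒suc (*-positive (0≺suc _) (0≺suc _)))) (*-cong (denominator f) (denominator g)))
      (fraction-rat _ _ _))

  neg-fraction : ∀ {q p n d} → Fraction H q p n d → Fraction H (ratᵗ (neg q) (pos q) (rightᵒ · q)) n p d
  neg-fraction f = fraction-cong (num⁻ f) (num⁺ f) (denominator f) (fraction-rat _ _ _)

  abs-fraction : ∀ {q p n d} → Fraction H q p n d → Fraction H ∣ q ∣ ((p ∸̇ n) +̇ (n ∸̇ p)) 0̇ d
  abs-fraction {q} f = fraction-resp
    (abs-def q)
    (fraction-cong (+-cong (∸-cong (num⁺ f) (num⁻ f)) (∸-cong (num⁻ f) (num⁺ f)))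
      (=-refl _) (denominator f) (fraction-rat _ _ _))

  nat-fraction : ∀ a → Fraction H (natᵒ · a) a 0̇ 1̇
  nat-fraction a = fraction-resp (nat-def a)
    (fraction-cong (=-refl _) (=-refl _) (≐-trans (ax (+-comm _ _)) (ax (+-zero 1̇))) (fraction-rat _ _ _))

  ⊖-fraction : ∀ {q p n d r p′ n′ d′} → Fraction H q p n d → Fraction H r p′ n′ d′ →
               Fraction H (q ⊖ r) (p *̇ d′ +̇ n′ *̇ d) (n *̇ d′ +̇ p′ *̇ d) (d *̇ d′)
  ⊖-fraction f g = fraction-resp (sub-def _ _) (⊕-fraction f (neg-fraction g))

  ≤ℚ-intro : ∀ {q p n d r p′ n′ d′} → Fraction H q p n d → Fraction H r p′ n′ d′ →
             H ⊢ p *̇ d′ +̇ n′ *̇ d ≼ p′ *̇ d +̇ n *̇ d′ → H ⊢ q ≤ℚ r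
  ≤ℚ-intro f g = ≼-resp
    (≐-sym (+-cong (*-cong (num⁺ f) (denominator g)) (*-cong (num⁻ g) (denominator f))))
    (≐-sym (+-cong (*-cong (num⁺ g) (denominator f)) (*-cong (num⁻ f) (denominator g))))

  ≤ℚ-elim : ∀ {q p n d r p′ n′ d′} → Fraction H q p n d → Fraction H r p′ n′ d′ →
            H ⊢ q ≤ℚ r → H ⊢ p *̇ d′ +̇ n′ *̇ d ≼ p′ *̇ d +̇ n *̇ d′
  ≤ℚ-elim f g = ≼-resp
    (+-cong (*-cong (num⁺ f) (denominator g)) (*-cong (num⁻ g) (denominator f)))
    (+-cong (*-cong (num⁺ g) (denominator f)) (*-cong (num⁻ f) (denominator g)))

  ≤ℚ-refl : ∀ {q} → H ⊢ q ≤ℚ q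
  ≤ℚ-refl = ≼-refl

  <ℚ⇒≤ℚ : ∀ {q r} → H ⊢ q <ℚ r → H ⊢ q ≤ℚ r
  <ℚ⇒≤ℚ = ≺⇒≼

  <ℚ-or-≥ℚ : ∀ q r → H ⊢ q <ℚ r ∨̇ r ≤ℚ q
  <ℚ-or-≥ℚ q r = ≺-or-≽ _ _

  <ℚ-≤ℚ-absurd : ∀ {q r φ} → H ⊢ q <ℚ r → H ⊢ r ≤ℚ q → H ⊢ φ
  <ℚ-≤ℚ-absurd d e = ≺-irrefl (≺-≼-trans d e)

infix 2 _⊢_≈_
-- Different numbers may code the same rational, so equality of rationals is not equality of codes.
-- The pair of inequalities is what the monoid solver runs on.
record _⊢_≈_ {Γ} (H : List (Fm Γ)) (q r : Tm Γ 𝟎) : Set where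
  constructor _,_
  field
    ≈⇒≤ : H ⊢ q ≤ℚ r
    ≈⇒≥ : H ⊢ r ≤ℚ q
open _⊢_≈_ public

module _ {Γ} {H : List (Fm Γ)} where

  -- Multiplied by the denominators of s and of q respectively, the hypotheses add up to the
  -- conclusion multiplied by the denominator of r, which is then cancelled.
  ≤ℚ-trans : ∀ {q r s} → H ⊢ q ≤ℚ r → H ⊢ r ≤ℚ s → H ⊢ q ≤ℚ s
  ≤ℚ-trans {q} {r} {s} d e = *-cancelʳ-≼ (den r) (0≺suc _)
    (≼-lin (+-mono-≼ (*-monoˡ-≼ (den s) d) (*-monoˡ-≼ (den q) e))
      (solve 9 (λ p₁ n₁ d₁ p₂ n₂ d₂ p₃ n₃ d₃ →
        (p₁ :* d₃ :+ n₃ :* d₁) :* d₂ :+ ((p₂ :* d₁ :+ n₁ :* d₂) :* d₃ :+ (p₃ :* d₂ :+ n₂ :* d₃) :* d₁)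
        := (p₃ :* d₁ :+ n₁ :* d₃) :* d₂ :+ ((p₁ :* d₂ :+ n₂ :* d₁) :* d₃ :+ (p₂ :* d₃ :+ n₃ :* d₂) :* d₁))
        (=-refl _) (pos q) (neg q) (den q) (pos r) (neg r) (den r) (pos s) (neg s) (den s)))

  ≈-cross : ∀ {q p n d r p′ n′ d′} → Fraction H q p n d → Fraction H r p′ n′ d′ →
            H ⊢ p *̇ d′ +̇ n′ *̇ d ≐ p′ *̇ d +̇ n *̇ d′ → H ⊢ q ≈ r
  ≈-cross f g e = ≤ℚ-intro f g (≐⇒≼ e) , ≤ℚ-intro g f (≐⇒≼ (≐-sym e))

  ≐⇒≈ : ∀ {q r} → H ⊢ q ≐ r → H ⊢ q ≈ r
  ≐⇒≈ {q} {r} e = ≈-cross (fraction-resp e (fraction-self r)) (fraction-self r) (=-refl _)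

  ⊕-monoˡ : ∀ {q r} s → H ⊢ q ≤ℚ r → H ⊢ q ⊕ s ≤ℚ r ⊕ s
  ⊕-monoˡ {q} {r} s d = ≤ℚ-intro (⊕-fraction (fraction-self q) (fraction-self s))
    (⊕-fraction (fraction-self r) (fraction-self s))
    (≼-lin (*-monoˡ-≼ (den s *̇ den s) d)
      (solve 9 (λ p₁ n₁ d₁ p₂ n₂ d₂ p₃ n₃ d₃ →
        (p₁ :* d₃ :+ p₃ :* d₁) :* (d₂ :* d₃) :+ (n₂ :* d₃ :+ n₃ :* d₂) :* (d₁ :* d₃)
          :+ (p₂ :* d₁ :+ n₁ :* d₂) :* (d₃ :* d₃)
        := (p₂ :* d₃ :+ p₃ :* d₂) :* (d₁ :* d₃) :+ (n₁ :* d₃ :+ n₃ :* d₁) :* (d₂ :* d₃)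
          :+ (p₁ :* d₂ :+ n₂ :* d₁) :* (d₃ :* d₃))
        (=-refl _) (pos q) (neg q) (den q) (pos r) (neg r) (den r) (pos s) (neg s) (den s)))

  ⊕-cancelʳ : ∀ {q r} s → H ⊢ q ⊕ s ≤ℚ r ⊕ s → H ⊢ q ≤ℚ r
  ⊕-cancelʳ {q} {r} s d = *-cancelʳ-≼ (den s *̇ den s) (*-positive (0≺suc _) (0≺suc _))
    (≼-lin (≤ℚ-elim (⊕-fraction (fraction-self q) (fraction-self s))
      (⊕-fraction (fraction-self r) (fraction-self s)) d)
      (solve 9 (λ p₁ n₁ d₁ p₂ n₂ d₂ p₃ n₃ d₃ →
        (p₁ :* d₂ :+ n₂ :* d₁) :* (d₃ :* d₃)
          :+ ((p₂ :* d₃ :+ p₃ :* d₂) :* (d₁ :* d₃) :+ (n₁ :* d₃ :+ n₃ :* d₁) :* (d₂ :* d₃))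
        := (p₂ :* d₁ :+ n₁ :* d₂) :* (d₃ :* d₃)
          :+ ((p₁ :* d₃ :+ p₃ :* d₁) :* (d₂ :* d₃) :+ (n₂ :* d₃ :+ n₃ :* d₂) :* (d₁ :* d₃)))
        (=-refl _) (pos q) (neg q) (den q) (pos r) (neg r) (den r) (pos s) (neg s) (den s)))

  ⊕-comm : ∀ q r → H ⊢ q ⊕ r ≤ℚ r ⊕ q
  ⊕-comm q r = ≈⇒≤ (≈-cross (⊕-fraction (fraction-self q) (fraction-self r))
    (⊕-fraction (fraction-self r) (fraction-self q))
    (solve 6 (λ p₁ n₁ d₁ p₂ n₂ d₂ → (p₁ :* d₂ :+ p₂ :* d₁) :* (d₂ :* d₁) :+ (n₂ :* d₁ :+ n₁ :* d₂) :* (d₁ :* d₂)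
      := (p₂ :* d₁ :+ p₁ :* d₂) :* (d₁ :* d₂) :+ (n₁ :* d₂ :+ n₂ :* d₁) :* (d₂ :* d₁))
      (=-refl _) (pos q) (neg q) (den q) (pos r) (neg r) (den r)))

  ⊕-assoc : ∀ q r s → H ⊢ q ⊕ r ⊕ s ≈ q ⊕ (r ⊕ s)
  ⊕-assoc q r s = ≈-cross
    (⊕-fraction (⊕-fraction (fraction-self q) (fraction-self r)) (fraction-self s))
    (⊕-fraction (fraction-self q) (⊕-fraction (fraction-self r) (fraction-self s)))
    (+-cong
      (*-cong
        (solve 6 (λ p₁ d₁ p₂ d₂ p₃ d₃ → (p₁ :* d₂ :+ p₂ :* d₁) :* d₃ :+ p₃ :* (d₁ :* d₂)
          := p₁ :* (d₂ :* d₃) :+ (p₂ :* d₃ :+ p₃ :* d₂) :* d₁) (=-refl _) (pos q) (den q) (pos r) (den r) (pos s) (den s))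
        (≐-sym (ax (*-assoc (den q) (den r) (den s)))))
      (*-cong
        (solve 6 (λ p₁ d₁ p₂ d₂ p₃ d₃ → p₁ :* (d₂ :* d₃) :+ (p₂ :* d₃ :+ p₃ :* d₂) :* d₁
          := (p₁ :* d₂ :+ p₂ :* d₁) :* d₃ :+ p₃ :* (d₁ :* d₂)) (=-refl _) (neg q) (den q) (neg r) (den r) (neg s) (den s))
        (ax (*-assoc (den q) (den r) (den s)))))

  ⊕-identityʳ : ∀ q → H ⊢ q ⊕ 0ℚ ≈ q
  ⊕-identityʳ q = ≈-cross (⊕-fraction (fraction-self q) (nat-fraction 0̇)) (fraction-self q)
    (solve 3 (λ p n d → (p :* :con 1 :+ :con 0 :* d) :* d :+ n :* (d :* :con 1)
      := p :* (d :* :con 1) :+ (n :* :con 1 :+ :con 0 :* d) :* d) (=-refl _) (pos q) (neg q) (den q))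

  -- Characterises a difference by adding the subtrahend back. Differences can therefore be atoms
  -- for the solver, and the estimates stay within a commutative monoid.
  ⊖-⊕ : ∀ q r → H ⊢ (q ⊖ r) ⊕ r ≈ q
  ⊖-⊕ q r = ≈-cross (⊕-fraction (⊖-fraction (fraction-self q) (fraction-self r)) (fraction-self r)) (fraction-self q)
    (solve 6 (λ p₁ n₁ d₁ p₂ n₂ d₂ →
      ((p₁ :* d₂ :+ n₂ :* d₁) :* d₂ :+ p₂ :* (d₁ :* d₂)) :* d₁ :+ n₁ :* (d₁ :* d₂ :* d₂)
      := p₁ :* (d₁ :* d₂ :* d₂) :+ ((n₁ :* d₂ :+ p₂ :* d₁) :* d₂ :+ n₂ :* (d₁ :* d₂)) :* d₁)
      (=-refl _) (pos q) (neg q) (den q) (pos r) (neg r) (den r))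

module _ {Γ} {H : List (Fm Γ)} where

  ⊕-mono : ∀ {q r s t} → H ⊢ q ≤ℚ r → H ⊢ s ≤ℚ t → H ⊢ q ⊕ s ≤ℚ r ⊕ t
  ⊕-mono d e = ≤ℚ-trans (⊕-monoˡ _ d) (≤ℚ-trans (⊕-comm _ _) (≤ℚ-trans (⊕-monoˡ _ e) (⊕-comm _ _)))

  ≈-sym : ∀ {q r} → H ⊢ q ≈ r → H ⊢ r ≈ q
  ≈-sym (a , b) = b , a

  ≈-trans : ∀ {q r s} → H ⊢ q ≈ r → H ⊢ r ≈ s → H ⊢ q ≈ s
  ≈-trans (a , b) (c , d) = ≤ℚ-trans a c , ≤ℚ-trans d b

  ≈-refl : ∀ {q} → H ⊢ q ≈ q
  ≈-refl = ≤ℚ-refl , ≤ℚ-refl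

  ⊕-cong : ∀ {q r s t} → H ⊢ q ≈ r → H ⊢ s ≈ t → H ⊢ q ⊕ s ≈ r ⊕ t
  ⊕-cong (a , b) (c , d) = ⊕-mono a c , ⊕-mono b d

ℚ-monoid : ∀ {Γ} → List (Fm Γ) → CommutativeMonoid 0ℓ 0ℓ
ℚ-monoid {Γ} H = record
  { Carrier = Tm Γ 𝟎
  ; _≈_ = λ q r → H ⊢ q ≈ r
  ; _∙_ = _⊕_
  ; ε = 0ℚ
  ; isCommutativeMonoid = record
    { isMonoid = record
      { isSemigroup = record
        { isMagma = record
          { isEquivalence = record { refl = ≈-refl ; sym = ≈-sym ; trans = ≈-trans }
          ; ∙-cong = ⊕-cong }
        ; assoc = ⊕-assoc }
      ; identity = (λ q → ≈-trans (⊕-comm _ _ , ⊕-comm _ _) (⊕-identityʳ q)) , ⊕-identityʳ }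
    ; comm = λ q r → ⊕-comm q r , ⊕-comm r q } }

module CM {Γ} {H : List (Fm Γ)} = CMSolver (ℚ-monoid H)

open CM using (_⊜_) renaming (solve to ℚ-solve)

module _ {Γ} {H : List (Fm Γ)} where

  -- Certificates for rational estimates: the known inequalities are added up to c ≤ d, and
  -- `ℚ-solve` checks that a + d and b + c have the same summands.
  ≤-lin : ∀ {a b c d} → H ⊢ c ≤ℚ d → H ⊢ a ⊕ d ≈ b ⊕ c → H ⊢ a ≤ℚ b
  ≤-lin {d = d} h e = ⊕-cancelʳ d (≤ℚ-trans (≈⇒≤ e) (⊕-mono ≤ℚ-refl h))

  ≤ℚ-resp : ∀ {q q′ r r′} → H ⊢ q ≐ q′ → H ⊢ r ≐ r′ → H ⊢ q ≤ℚ r → H ⊢ q′ ≤ℚ r′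
  ≤ℚ-resp d e h = ≤ℚ-trans (≈⇒≥ (≐⇒≈ d)) (≤ℚ-trans h (≈⇒≤ (≐⇒≈ e)))

  ⊕-identityˡ : ∀ q → H ⊢ 0ℚ ⊕ q ≈ q
  ⊕-identityˡ q = ≈-trans (⊕-comm _ _ , ⊕-comm _ _) (⊕-identityʳ q)

-- Dyadic fractions.

2̇ : ∀ {Γ} → Tm Γ 𝟎
2̇ = 1̇ +̇ 1̇

module _ {Γ} {H : List (Fm Γ)} where

  frac-fraction : ∀ a l → Fraction H (frac a l) a 0̇ (pow2 l)
  frac-fraction a l = fraction-cong (=-refl _) (=-refl _) (≐-sym (0≺⇒suc (0≺pow2 l))) (fraction-resp (frac-def a l) (fraction-rat a 0̇ _))

  frac-+ : ∀ a b l → H ⊢ frac (a +̇ b) l ≈ frac a l ⊕ frac b l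
  frac-+ a b l = ≈-cross (frac-fraction _ l) (⊕-fraction (frac-fraction a l) (frac-fraction b l))
    (solve 3 (λ a b d → (a :+ b) :* (d :* d) :+ (:con 0 :* d :+ :con 0 :* d) :* d
      := (a :* d :+ b :* d) :* d :+ :con 0 :* (d :* d)) (=-refl _) a b (pow2 l))

  frac-mono : ∀ {a b l m} → H ⊢ a *̇ pow2 m ≼ b *̇ pow2 l → H ⊢ frac a l ≤ℚ frac b m
  frac-mono {a} {b} {l} {m} h = ≤ℚ-intro (frac-fraction a l) (frac-fraction b m)
    (≼-resp (solve 2 (λ x y → x := x :+ :con 0 :* y) (=-refl _) (a *̇ pow2 m) (pow2 l))
            (solve 2 (λ x y → x := x :+ :con 0 :* y) (=-refl _) (b *̇ pow2 l) (pow2 m)) h)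

  frac-≤-elim : ∀ {a b l m} → H ⊢ frac a l ≤ℚ frac b m → H ⊢ a *̇ pow2 m ≼ b *̇ pow2 l
  frac-≤-elim {a} {b} {l} {m} h =
    ≼-resp (solve 2 (λ x y → x :+ :con 0 :* y := x) (=-refl _) (a *̇ pow2 m) (pow2 l))
           (solve 2 (λ x y → x :+ :con 0 :* y := x) (=-refl _) (b *̇ pow2 l) (pow2 m))
           (≤ℚ-elim (frac-fraction a l) (frac-fraction b m) h)

module _ {Γ} {H : List (Fm Γ)} where

  frac-monoˡ : ∀ {a b} l → H ⊢ a ≼ b → H ⊢ frac a l ≤ℚ frac b l
  frac-monoˡ l h = frac-mono (*-monoˡ-≼ (pow2 l) h)

  frac-cong : ∀ {a b} l → H ⊢ a ≐ b → H ⊢ frac a l ≈ frac b l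
  frac-cong l e = frac-monoˡ l (≐⇒≼ e) , frac-monoˡ l (≐⇒≼ (≐-sym e))

  frac-congʳ : ∀ a {l m} → H ⊢ l ≐ m → H ⊢ frac a l ≈ frac a m
  frac-congʳ a e = frac-mono (≐⇒≼ (*-cong (=-refl a) (Eq-·ʳ pow2ᵗ (≐-sym e)))) ,
                   frac-mono (≐⇒≼ (*-cong (=-refl a) (Eq-·ʳ pow2ᵗ e)))

  frac-zero : ∀ l → H ⊢ frac 0̇ l ≈ 0ℚ
  frac-zero l = ≈-cross (frac-fraction 0̇ l) (nat-fraction 0̇)
    (solve 1 (λ d → :con 0 :* :con 1 :+ :con 0 :* d := :con 0 :* d :+ :con 0 :* :con 1) (=-refl _) (pow2 l))

  nat-frac : ∀ a → H ⊢ natᵒ · a ≈ frac a 0̇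
  nat-frac a = ≈-cross (nat-fraction a) (fraction-cong (=-refl _) (=-refl _) pow2-zero (frac-fraction a 0̇))
    (=-refl _)

  frac-scale : ∀ a l b → H ⊢ frac (a *̇ pow2 b) (l +̇ b) ≈ frac a l
  frac-scale a l b = frac-mono (≐⇒≼ e) , frac-mono (≐⇒≼ (≐-sym e))
    where
    e : H ⊢ a *̇ pow2 b *̇ pow2 l ≐ a *̇ pow2 (l +̇ b)
    e = ≐-trans (solve 3 (λ a b l → a :* b :* l := a :* (l :* b)) (=-refl _) a (pow2 b) (pow2 l))
          (*-cong (=-refl a) (≐-sym (pow2-+ l b)))

module _ {Γ} {H : List (Fm Γ)} where

  0≤frac : ∀ a l → H ⊢ 0ℚ ≤ℚ frac a l
  0≤frac a l = ≤ℚ-trans (≈⇒≥ (frac-zero l)) (frac-monoˡ l (0≼ a))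

  ≤-⊕-frac : ∀ q a l → H ⊢ q ≤ℚ q ⊕ frac a l
  ≤-⊕-frac q a l = ≤ℚ-trans (≈⇒≥ (⊕-identityʳ q)) (⊕-mono ≤ℚ-refl (0≤frac a l))

  frac-half : ∀ l → H ⊢ frac 1̇ (l +̇ 1̇) ⊕ frac 1̇ (l +̇ 1̇) ≈ frac 1̇ l
  frac-half l = ≈-trans (≈-sym (frac-+ 1̇ 1̇ (l +̇ 1̇)))
    (≈-trans (frac-cong (l +̇ 1̇) (≐-trans (≐-sym (≐-trans (pow2-suc 0̇) (+-cong pow2-zero pow2-zero)))
      (≐-trans (Eq-·ʳ pow2ᵗ (solve 1 (λ i → :con 0 :+ i := i) (=-refl _) 1̇))
        (solve 1 (λ x → x := :con 1 :* x) (=-refl _) (pow2 1̇)))))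
      (frac-scale 1̇ l 1̇))

  frac-≰-zero : ∀ {l φ} → H ⊢ frac 1̇ l ≤ℚ 0ℚ → H ⊢ φ
  frac-≰-zero {l} h = ≺-irrefl (≺-≼-trans (0≺pow2 l)
    (≼-resp (solve 1 (λ x → :con 1 :* x := x) (=-refl _) (pow2 l))
            (solve 1 (λ x → :con 0 :* x := :con 0) (=-refl _) (pow2 l))
      (frac-≤-elim (≤ℚ-trans h (≈⇒≥ (frac-zero l))))))

  mul-zero : ∀ q → H ⊢ mulᵒ · 0ℚ · q ≈ 0ℚ
  mul-zero q = ≈-cross (*-fraction (nat-fraction 0̇) (fraction-self q)) (nat-fraction 0̇)
    (solve 3 (λ p n d → (:con 0 :* p :+ :con 0 :* n) :* :con 1 :+ :con 0 :* (:con 1 :* d)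
      := :con 0 :* (:con 1 :* d) :+ (:con 0 :* n :+ :con 0 :* p) :* :con 1) (=-refl _) (pos q) (neg q) (den q))

  mul-one : ∀ q → H ⊢ mulᵒ · (natᵒ · 1̇) · q ≈ q
  mul-one q = ≈-cross (*-fraction (nat-fraction 1̇) (fraction-self q)) (fraction-self q)
    (solve 3 (λ p n d → (:con 1 :* p :+ :con 0 :* n) :* d :+ n :* (:con 1 :* d)
      := p :* (:con 1 :* d) :+ (:con 1 :* n :+ :con 0 :* p) :* d) (=-refl _) (pos q) (neg q) (den q))

  ≼-∸-+ : ∀ p n → H ⊢ p ≼ (p ∸̇ n) +̇ n
  ≼-∸-+ p n = ∨-elim (≺-or-≽ p n)
    (≼-trans (≺⇒≼ h₀) (≼-lin (0≼ (p ∸̇ n)) (solve 2 (λ n x → n :+ x := x :+ n :+ :con 0) (=-refl _) n (p ∸̇ n))))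
    (≐⇒≼ (≐-trans (≼⇒+ h₀) (ax (+-comm _ _))))

-- Absolute values of rationals.

module _ {Γ} {H : List (Fm Γ)} where

  ≤∣∣ : ∀ q → H ⊢ q ≤ℚ ∣ q ∣
  ≤∣∣ q = ≤ℚ-intro (fraction-self q) (abs-fraction (fraction-self q))
    (≼-lin (*-monoˡ-≼ (den q) (+-mono-≼ (≼-∸-+ (pos q) (neg q)) (0≼ (neg q ∸̇ pos q))))
      (solve 5 (λ p n d x y → p :* d :+ :con 0 :* d :+ (x :+ n :+ y) :* d
        := (x :+ y) :* d :+ n :* d :+ (p :+ :con 0) :* d) (=-refl _)
        (pos q) (neg q) (den q) (pos q ∸̇ neg q) (neg q ∸̇ pos q)))

  -- The inequality -q ≤ |q| in a form free of negation, which suits the monoid solver.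
  0≤∣∣⊕ : ∀ q → H ⊢ 0ℚ ≤ℚ ∣ q ∣ ⊕ q
  0≤∣∣⊕ q = ≤ℚ-intro (nat-fraction 0̇) (⊕-fraction (abs-fraction (fraction-self q)) (fraction-self q))
    (≼-lin (*-monoˡ-≼ (den q) (+-mono-≼ (≼-∸-+ (neg q) (pos q)) (0≼ (pos q ∸̇ neg q))))
      (solve 5 (λ p n d x y → :con 0 :* (d :* d) :+ (:con 0 :* d :+ n :* d) :* :con 1 :+ (y :+ p :+ x) :* d
        := ((x :+ y) :* d :+ p :* d) :* :con 1 :+ :con 0 :* (d :* d) :+ (n :+ :con 0) :* d) (=-refl _)
        (pos q) (neg q) (den q) (pos q ∸̇ neg q) (neg q ∸̇ pos q)))

module _ {Γ} {H : List (Fm Γ)} where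

  abs-cases : ∀ q → H ⊢ ∣ q ∣ ≤ℚ q ∨̇ ∣ q ∣ ⊕ q ≤ℚ 0ℚ
  abs-cases q = ∨-elim (≺-or-≽ p n)
    (∨-intro₂ (≤ℚ-intro (⊕-fraction (abs-fraction (fraction-self q)) (fraction-self q)) (nat-fraction 0̇)
      (≐⇒≼ (≐-trans (solve 5 (λ p n d x y → ((x :+ y) :* d :+ p :* d) :* :con 1 :+ :con 0 :* (d :* d)
                := (x :+ (p :+ y)) :* d) (=-refl _) p n d (p ∸̇ n) (n ∸̇ p))
        (≐-trans (*-cong (+-cong (∸-≼ (≺⇒≼ h₀)) (≐-sym (≼⇒+ (≺⇒≼ h₀)))) (=-refl d))
          (solve 2 (λ n d → (:con 0 :+ n) :* d := :con 0 :* (d :* d) :+ (:con 0 :* d :+ n :* d) :* :con 1) (=-refl _) n d))))))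
    (∨-intro₁ (≤ℚ-intro (abs-fraction (fraction-self q)) (fraction-self q)
      (≐⇒≼ (≐-trans (solve 5 (λ p n d x y → (x :+ y) :* d :+ n :* d := (y :+ (n :+ x)) :* d) (=-refl _) p n d (p ∸̇ n) (n ∸̇ p))
        (≐-trans (*-cong (+-cong (∸-≼ h₀) (≐-sym (≼⇒+ h₀))) (=-refl d))
          (solve 2 (λ p d → (:con 0 :+ p) :* d := p :* d :+ :con 0 :* d) (=-refl _) p d))))))
    where
    p n d : Tm Γ 𝟎
    p = pos q
    n = neg q
    d = den q

  abs-intro : ∀ {q e} → H ⊢ q ≤ℚ e → H ⊢ 0ℚ ≤ℚ q ⊕ e → H ⊢ ∣ q ∣ ≤ℚ e
  abs-intro {q} {e} a b = ∨-elim (abs-cases q) (≤ℚ-trans h₀ (w a))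
    (≤-lin (⊕-mono h₀ (w b)) (ℚ-solve 3 (λ a q e → a :⊕ (:0 :⊕ (q :⊕ e)) ⊜ e :⊕ ((a :⊕ q) :⊕ :0)) ≈-refl ∣ q ∣ q e))

  ∣⊖∣-intro : ∀ {q r e} → H ⊢ q ≤ℚ r ⊕ e → H ⊢ r ≤ℚ q ⊕ e → H ⊢ ∣ q ⊖ r ∣ ≤ℚ e
  ∣⊖∣-intro {q} {r} {e} a b = abs-intro
    (≤-lin (⊕-mono a (≈⇒≤ (⊖-⊕ q r))) (ℚ-solve 4 (λ q r e d → d :⊕ ((r :⊕ e) :⊕ q) ⊜ e :⊕ (q :⊕ (d :⊕ r))) ≈-refl q r e (q ⊖ r)))
    (≤-lin (⊕-mono b (≈⇒≥ (⊖-⊕ q r))) (ℚ-solve 4 (λ q r e d → :0 :⊕ ((q :⊕ e) :⊕ (d :⊕ r)) ⊜ (d :⊕ e) :⊕ (r :⊕ q)) ≈-refl q r e (q ⊖ r)))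

  ∣⊖∣-elimˡ : ∀ {q r e} → H ⊢ ∣ q ⊖ r ∣ ≤ℚ e → H ⊢ q ≤ℚ r ⊕ e
  ∣⊖∣-elimˡ {q} {r} {e} h = ≤-lin (⊕-mono (≤ℚ-trans (≤∣∣ (q ⊖ r)) h) (≈⇒≥ (⊖-⊕ q r)))
    (ℚ-solve 4 (λ q r e d → q :⊕ (e :⊕ (d :⊕ r)) ⊜ (r :⊕ e) :⊕ (d :⊕ q)) ≈-refl q r e (q ⊖ r))

  ∣⊖∣-elimʳ : ∀ {q r e} → H ⊢ ∣ q ⊖ r ∣ ≤ℚ e → H ⊢ r ≤ℚ q ⊕ e
  ∣⊖∣-elimʳ {q} {r} {e} h = ≤-lin (⊕-mono (0≤∣∣⊕ (q ⊖ r)) (⊕-mono h (≈⇒≤ (⊖-⊕ q r))))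
    (ℚ-solve 5 (λ q r e d a → r :⊕ ((a :⊕ d) :⊕ (e :⊕ q)) ⊜ (q :⊕ e) :⊕ (:0 :⊕ (a :⊕ (d :⊕ r)))) ≈-refl q r e (q ⊖ r) ∣ q ⊖ r ∣)

-- Reals through their rational approximations.

module _ {Γ} {H : List (Fm Γ)} where

  isReal-at : ∀ {x} → H ⊢ IsReal x → ∀ a b → H ⊢ ∣ x · a ⊖ x · (a +̇ b) ∣ ≤ℚ frac 1̇ a
  isReal-at {x} d a b = ≤ℚ-resp (=-refl _) (2⁻-def a) (<ℚ⇒≤ℚ
    (∀E (∅ ▸ x ▸ a) φ (∀E (∅ ▸ x) (∀[ 𝟎 ] φ) d a) b))
    where
    φ : Fp (𝟎 ∷ 𝟎 ∷ 𝟏 ∷ [])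
    φ = ∣ x₂ · x₁ ⊖ᵖ x₂ · (x₁ +ᵖ x₀) ∣ᵖ <ℚᵖ cst (λ _ → 2⁻ᵒ) 2⁻ᵒ-sub · x₁

module _ {Γ} {H : List (Fm Γ)} {Θ : Cxt} (s : Sub Θ Γ) (x y : Tp Θ 𝟏) where

  ≤ᴿ-at : H ⊢ ⟪ x ≤ᴿᵖ y ⟫ s → ∀ n → H ⊢ eval x s · n ≤ℚ eval y s · n ⊕ frac 2̇ n
  ≤ᴿ-at d n = ≤ℚ-trans
    (subst₂ (λ a b → H ⊢ a · n ≤ℚ b · n ⊕ 2·2⁻ᵒ · n) (eval-upᵖ (s ▸ n) x) (eval-upᵖ (s ▸ n) y)
      (∀E s (upᵖ x · x₀ ≤ℚᵖ upᵖ y · x₀ ⊕ᵖ cst (λ _ → 2·2⁻ᵒ) 2·2⁻ᵒ-sub · x₀) d n))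
    (⊕-mono ≤ℚ-refl (≈⇒≤ (≐⇒≈ (2·2⁻-def n))))

  =ᴿ-at : H ⊢ ⟪ x =ᴿᵖ y ⟫ s → ∀ n → H ⊢ ∣ eval x s · n ⊖ eval y s · n ∣ ≤ℚ frac 2̇ n
  =ᴿ-at d n = ≤ℚ-resp (=-refl _) (2·2⁻-def n)
    (subst₂ (λ a b → H ⊢ ∣ a · n ⊖ b · n ∣ ≤ℚ 2·2⁻ᵒ · n) (eval-upᵖ (s ▸ n) x) (eval-upᵖ (s ▸ n) y)
      (∀E s (∣ upᵖ x · x₀ ⊖ᵖ upᵖ y · x₀ ∣ᵖ ≤ℚᵖ cst (λ _ → 2·2⁻ᵒ) 2·2⁻ᵒ-sub · x₀) d n))

  ≤ᴿ-intro : map ↑ᶠ_ H ⊢ eval x (⇑ s) · v₀ ≤ℚ eval y (⇑ s) · v₀ ⊕ frac 2̇ v₀ → H ⊢ ⟪ x ≤ᴿᵖ y ⟫ s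
  ≤ᴿ-intro d = ∀-intro (≤ℚ-trans
    (subst₂ (λ a b → map ↑ᶠ_ H ⊢ a · v₀ ≤ℚ b · v₀ ⊕ frac 2̇ v₀) (sym (eval-upᵖ (lift s) x)) (sym (eval-upᵖ (lift s) y)) d)
    (⊕-mono ≤ℚ-refl (≈⇒≥ (≐⇒≈ (2·2⁻-def v₀)))))

  =ᴿ-intro : map ↑ᶠ_ H ⊢ eval x (⇑ s) · v₀ ≈ eval y (⇑ s) · v₀ → H ⊢ ⟪ x =ᴿᵖ y ⟫ s
  =ᴿ-intro d = ∀-intro (≤ℚ-resp (=-refl _) (≐-sym (2·2⁻-def v₀))
    (∣⊖∣-intro (≤ℚ-trans (≈⇒≤ d′) (≤-⊕-frac _ _ _)) (≤ℚ-trans (≈⇒≥ d′) (≤-⊕-frac _ _ _))))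
    where
    d′ = subst₂ (λ a b → map ↑ᶠ_ H ⊢ a · v₀ ≈ b · v₀) (sym (eval-upᵖ (lift s) x)) (sym (eval-upᵖ (lift s) y)) d

module _ {Γ} {H : List (Fm Γ)} {Θ : Cxt} (s : Sub Θ Γ) where

  -- All differences of a constant sequence are at most 0 in absolute value. The strict inequality
  -- follows by contradiction, since 2^-n ≤ 0 is absurd.
  isReal-constant : ∀ (x : Tp Θ 𝟏) → map ↑ᶠ_ (map ↑ᶠ_ H) ⊢ eval x (⇑ ⇑ s) · v₁ ≐ eval x (⇑ ⇑ s) · (v₁ +̇ v₀) →
                    H ⊢ ⟪ IsRealᵖ x ⟫ s
  isReal-constant x d = ∀-intro (∀-intro (∨-elim (<ℚ-or-≥ℚ _ _) h₀
    (frac-≰-zero (≤ℚ-trans (≈⇒≥ (≐⇒≈ (2⁻-def v₁))) (≤ℚ-trans h₀ (w (∣⊖∣-intro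
      (≤ℚ-trans (≈⇒≤ (≐⇒≈ d′)) (≈⇒≥ (⊕-identityʳ _)))
      (≤ℚ-trans (≈⇒≥ (≐⇒≈ d′)) (≈⇒≥ (⊕-identityʳ _))))))))))
    where
    d′ = subst (λ a → map ↑ᶠ_ (map ↑ᶠ_ H) ⊢ a · v₁ ≐ a · (v₁ +̇ v₀))
           (sym (trans (eval-upᵖ (lift (lift s)) (upᵖ x)) (eval-upᵖ (⇑ lift s) x))) d

infix 12 _−_<2⁻_
_−_<2⁻_ : ∀ {Γ} → Tm Γ 𝟏 → Tm Γ 𝟏 → Tm Γ 𝟎 → Fm Γ
x − y <2⁻ m = ⟪ subᴿᵖ · x₂ · x₁ <ᴿᵖ 2⁻ᴿᵖ · x₀ ⟫ (∅ ▸ x ▸ y ▸ m)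

module _ {Γ} {H : List (Fm Γ)} where

  2⁻ᴿ-at : ∀ m n → H ⊢ 2⁻ᴿᵒ · m · n ≐ frac 1̇ m
  2⁻ᴿ-at m n = ≐-trans (2⁻ᴿ-def m n) (2⁻-def m)

module _ {Γ} {H : List (Fm Γ)} {x : Tm Γ 𝟏} (d : H ⊢ IsReal x) where

  near-+ˡ : ∀ a b → H ⊢ x · a ≤ℚ x · (a +̇ b) ⊕ frac 1̇ a
  near-+ˡ a b = ∣⊖∣-elimˡ (isReal-at d a b)

  near-+ʳ : ∀ a b → H ⊢ x · (a +̇ b) ≤ℚ x · a ⊕ frac 1̇ a
  near-+ʳ a b = ∣⊖∣-elimʳ (isReal-at d a b)

-- `IsReal` compares an index only with later ones; the symmetric bound covers both orders of a and
-- b.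
near : ∀ {Γ} {H : List (Fm Γ)} {x : Tm Γ 𝟏} → H ⊢ IsReal x → ∀ a b →
       H ⊢ x · a ≤ℚ x · b ⊕ (frac 1̇ a ⊕ frac 1̇ b)
near {x = x} d a b = ∨-elim (≺-or-≽ a b)
  (≤ℚ-trans (≤ℚ-trans (near-+ˡ (w d) a (b ∸̇ a))
      (⊕-mono (≈⇒≥ (≐⇒≈ (Eq-·ʳ x (≼⇒+ (≺⇒≼ h₀))))) (≤-⊕-frac _ 1̇ b))) ≤ℚ-refl)
  (≤ℚ-trans (≈⇒≤ (≐⇒≈ (Eq-·ʳ x (≼⇒+ h₀)))) (≤ℚ-trans (near-+ʳ (w d) b (a ∸̇ b))
      (⊕-mono ≤ℚ-refl (≤ℚ-trans (≤-⊕-frac _ 1̇ a) (⊕-comm _ _)))))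

module _ {Γ} {H : List (Fm Γ)} {x : Tm Γ 𝟏} (d : H ⊢ IsReal x) (e c : Tm Γ 𝟎) where

  private
    error : H ⊢ frac 1̇ e ⊕ frac c (e +̇ c) ≤ℚ frac 2̇ e
    error = ≤ℚ-trans (⊕-mono ≤ℚ-refl (≤ℚ-trans
      (frac-monoˡ (e +̇ c) (≼-trans (≺⇒≼ (≺-suc c)) (≼-trans (suc≼pow2 c)
        (≐⇒≼ (solve 1 (λ p → p := :con 1 :* p) (=-refl _) (pow2 c))))))
      (≈⇒≤ (frac-scale 1̇ e c)))) (≈⇒≥ (frac-+ 1̇ 1̇ e))

  -- Since c < 2^c, an error of c·2^-(e+c) at index e + c is at most 2^-e. Returning to index e
  -- costs another 2^-e, and the sum is the tolerance in the definition of ≤ on reals. Errors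
  -- accumulated over many steps are thus absorbed by a higher precision.
  lower-limit : ∀ {a} → H ⊢ a ≤ℚ x · (e +̇ c) ⊕ frac c (e +̇ c) → H ⊢ a ≤ℚ x · e ⊕ frac 2̇ e
  lower-limit {a} h = ≤-lin (⊕-mono h (⊕-mono (near-+ʳ d e c) error))
    (ℚ-solve 6 (λ a xl xe f g k → a :⊕ ((xl :⊕ f) :⊕ ((xe :⊕ g) :⊕ k)) ⊜ (xe :⊕ k) :⊕ (a :⊕ (xl :⊕ (g :⊕ f))))
      ≈-refl a (x · (e +̇ c)) (x · e) (frac c (e +̇ c)) (frac 1̇ e) (frac 2̇ e))

  upper-limit : ∀ {b} → H ⊢ x · (e +̇ c) ≤ℚ b ⊕ frac c (e +̇ c) → H ⊢ x · e ≤ℚ b ⊕ frac 2̇ e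
  upper-limit {b} h = ≤-lin (⊕-mono h (⊕-mono (near-+ˡ d e c) error))
    (ℚ-solve 6 (λ b xl xe f g k → xe :⊕ ((b :⊕ f) :⊕ ((xl :⊕ g) :⊕ k)) ⊜ (b :⊕ k) :⊕ (xl :⊕ (xe :⊕ (g :⊕ f))))
      ≈-refl b (x · (e +̇ c)) (x · e) (frac c (e +̇ c)) (frac 1̇ e) (frac 2̇ e))

module _ {Γ} {H : List (Fm Γ)} where

  -- The strict inequality negates a universal statement, which is refuted at the single index n.
  -- `subᴿ` reads its arguments at n + 1, and the tolerance 2·2^-n of ≤ is added to δ.
  ∣−∣<2⁻-intro : ∀ {Θ} (s : Sub Θ Γ) (x y : Tp Θ 𝟏) (m : Tp Θ 𝟎) {δ} n →
    H ⊢ eval x s · (n +̇ 1̇) ≤ℚ eval y s · (n +̇ 1̇) ⊕ δ → H ⊢ eval y s · (n +̇ 1̇) ≤ℚ eval x s · (n +̇ 1̇) ⊕ δ →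
    H ⊢ δ ⊕ frac 2̇ n <ℚ frac 1̇ (eval m s) → H ⊢ ⟪ absᴿᵖ · (subᴿᵖ · x · y) <ᴿᵖ 2⁻ᴿᵖ · m ⟫ s
  ∣−∣<2⁻-intro s x y m n a b c = ⇒-intro (<ℚ-≤ℚ-absurd (w c)
    (≤ℚ-trans (≈⇒≥ (≐⇒≈ (2⁻ᴿ-at (eval m s) n))) (≤ℚ-trans (≤ᴿ-at s (2⁻ᴿᵖ · m) (absᴿᵖ · (subᴿᵖ · x · y)) h₀ n)
      (⊕-mono (≤ℚ-trans (≈⇒≤ (≐⇒≈ (≐-trans (absᴿ-def _ n) (Eq-·ʳ absᵒ (subᴿ-def _ _ n)))))
        (∣⊖∣-intro (w a) (w b))) ≤ℚ-refl))))

  -- A violation at one index l would persist at every index e and prove 2^-n ≤ y - x. Moving x and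
  -- y from index l to e + 1 costs 2·2^-l, the slack in the statement, and 2^-e, which the tolerance
  -- 2·2^-e of ≤ covers.
  sub<2⁻-elim : ∀ {x y n} → H ⊢ IsReal x → H ⊢ IsReal y → H ⊢ y − x <2⁻ n →
               ∀ l → H ⊢ y · l ≤ℚ x · l ⊕ (frac 1̇ n ⊕ frac 2̇ l)
  sub<2⁻-elim {x} {y} {n} dx dy d l = ∨-elim (<ℚ-or-≥ℚ Q (y · l)) (⊥-elimᵈ (⇒-elim (w d) bad)) h₀
    where
    Q : Tm Γ 𝟎
    Q = x · l ⊕ (frac 1̇ n ⊕ frac 2̇ l)
    bad : (Q <ℚ y · l) ∷ H ⊢ ⟪ 2⁻ᴿᵖ · x₀ ≤ᴿᵖ subᴿᵖ · x₂ · x₁ ⟫ (∅ ▸ y ▸ x ▸ n)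
    bad = ≤ᴿ-intro (∅ ▸ y ▸ x ▸ n) (2⁻ᴿᵖ · x₀) (subᴿᵖ · x₂ · x₁) (bad′ (↑E (∅ ▸ x) (IsRealᵖ x₀) (w dx)) (↑E (∅ ▸ y) (IsRealᵖ x₀) (w dy))
      (↑E (∅ ▸ x ▸ y ▸ n ▸ l) (x₃ · x₀ ⊕ᵖ (fracᵖ 1ᵖ x₁ ⊕ᵖ fracᵖ (1ᵖ +ᵖ 1ᵖ) x₀) <ℚᵖ x₂ · x₀) h₀))
      where
      bad′ : ∀ {Δ} {K : List (Fm Δ)} {x y n l e} → K ⊢ IsReal x → K ⊢ IsReal y →
             K ⊢ x · l ⊕ (frac 1̇ n ⊕ frac 2̇ l) <ℚ y · l →
             K ⊢ 2⁻ᴿᵒ · n · e ≤ℚ subᴿᵒ · y · x · e ⊕ frac 2̇ e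
      bad′ {x = x} {y} {n} {l} {e} dx dy h = ≤ℚ-trans (≈⇒≤ (≐⇒≈ (2⁻ᴿ-at n e)))
        (≤ℚ-trans
          (≤-lin (⊕-mono (<ℚ⇒≤ℚ h) (⊕-mono (near dy l e′) (⊕-mono (near dx e′ l)
            (⊕-mono (≈⇒≤ (frac-half e)) (⊕-mono (0≤frac 1̇ e) (⊕-mono (≈⇒≥ (⊖-⊕ (y · e′) (x · e′)))
              (⊕-mono (≈⇒≥ (frac-+ 1̇ 1̇ l)) (≈⇒≥ (frac-+ 1̇ 1̇ e)))))))))
            (ℚ-solve 11 (λ xl yl xe ye fn f1l f2l fe′ f1e f2e s →
              fn :⊕ (yl :⊕ ((ye :⊕ (f1l :⊕ fe′)) :⊕ ((xl :⊕ (fe′ :⊕ f1l)) :⊕ (f1e :⊕ (f1e :⊕ ((s :⊕ xe) :⊕ (f2l :⊕ f2e)))))))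
              ⊜ (s :⊕ f2e) :⊕ ((xl :⊕ (fn :⊕ f2l)) :⊕ (yl :⊕ (xe :⊕ ((fe′ :⊕ fe′) :⊕ (:0 :⊕ (ye :⊕ ((f1l :⊕ f1l) :⊕ (f1e :⊕ f1e)))))))))
              ≈-refl (x · l) (y · l) (x · e′) (y · e′) (frac 1̇ n) (frac 1̇ l) (frac 2̇ l) (frac 1̇ e′) (frac 1̇ e) (frac 2̇ e)
              (y · e′ ⊖ x · e′)))
          (⊕-mono (≈⇒≥ (≐⇒≈ (subᴿ-def y x e))) ≤ℚ-refl))
        where e′ = e +̇ 1̇

-- Tagged partitions at one precision.

4̇ 8̇ : ∀ {Γ} → Tm Γ 𝟎
4̇ = 2̇ +̇ 2̇
8̇ = 4̇ +̇ 4̇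

2ᵖ 4ᵖ 8ᵖ : ∀ {Γ} → Tp Γ 𝟎
2ᵖ = 1ᵖ +ᵖ 1ᵖ
4ᵖ = 2ᵖ +ᵖ 2ᵖ
8ᵖ = 4ᵖ +ᵖ 4ᵖ

module _ {Γ} {H : List (Fm Γ)} where

  frac-2+2 : ∀ l → H ⊢ frac 2̇ l ⊕ frac 2̇ l ≤ℚ frac 4̇ l
  frac-2+2 l = ≈⇒≥ (frac-+ 2̇ 2̇ l)

  frac-4≤8 : ∀ l → H ⊢ frac 4̇ l ≤ℚ frac 8̇ l
  frac-4≤8 l = frac-monoˡ l (≼-+ʳ 4̇ 4̇)

  frac-2≤4 : ∀ l → H ⊢ frac 2̇ l ≤ℚ frac 4̇ l
  frac-2≤4 l = frac-monoˡ l (≼-+ʳ 2̇ 2̇)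

  -- 8·2^-l is the error allowed per interval: comparing consecutive partition points costs 4·2^-l,
  -- and exchanging two approximations of a length costs another 4·2^-l.
  frac-8*suc : ∀ j l → H ⊢ frac (8̇ *̇ (j +̇ 1̇)) l ≈ frac (8̇ *̇ j) l ⊕ frac 8̇ l
  frac-8*suc j l = ≈-trans (frac-cong l (≐-trans (ax (distrib 8̇ j 1̇)) (+-cong (=-refl _) (ax (*-one 8̇)))))
    (frac-+ (8̇ *̇ j) 8̇ l)

TaggedPartition : ∀ {Γ} → Tm Γ 𝟎 → Tm Γ (𝟎 ⟶ 𝟏) → Tm Γ (𝟎 ⟶ 𝟏) → Fm Γ
TaggedPartition k x t = ⟪ TaggedPartitionᵖ x₂ x₁ x₀ ⟫ (∅ ▸ k ▸ x ▸ t)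

Mesh : ∀ {Γ} → Tm Γ 𝟎 → Tm Γ (𝟎 ⟶ 𝟏) → Tm Γ 𝟎 → Fm Γ
Mesh k x n = ⟪ Meshᵖ x₂ x₁ x₀ ⟫ (∅ ▸ k ▸ x ▸ n)

module Partition {Γ} {H : List (Fm Γ)} {k : Tm Γ 𝟎} {x t : Tm Γ (𝟎 ⟶ 𝟏)}
                 (P : H ⊢ TaggedPartition k x t) where

  private
    s : Sub ((𝟎 ⟶ 𝟏) ∷ (𝟎 ⟶ 𝟏) ∷ 𝟎 ∷ []) Γ
    s = ∅ ▸ k ▸ x ▸ t

    tagged : ∀ {j} → H ⊢ j ≺ k → H ⊢ ⟪ IsRealᵖ (x₁ · x₀) ∧̇ x₂ · x₀ ≤ᴿᵖ x₁ · x₀ ∧̇ x₁ · x₀ ≤ᴿᵖ x₂ · (x₀ +ᵖ 1ᵖ) ⟫ (s ▸ j)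
    tagged {j} h = ⇒-elim (∀E s (x₀ ≺ x₃ ⇒ IsRealᵖ (x₁ · x₀) ∧̇ x₂ · x₀ ≤ᴿᵖ x₁ · x₀ ∧̇ x₁ · x₀ ≤ᴿᵖ x₂ · (x₀ +ᵖ 1ᵖ))
      (∧-elim₂ (∧-elim₂ (∧-elim₂ P))) j) h

    start : ∀ l → H ⊢ ∣ x · 0̇ · l ⊖ natᴿᵒ · 0̇ · l ∣ ≤ℚ frac 2̇ l
    start = =ᴿ-at s (x₁ · 0ᵖ) (natᴿᵖ · 0ᵖ) (∧-elim₁ (∧-elim₂ P))

    end : ∀ l → H ⊢ ∣ x · k · l ⊖ natᴿᵒ · 1̇ · l ∣ ≤ℚ frac 2̇ l
    end = =ᴿ-at s (x₁ · x₂) (natᴿᵖ · 1ᵖ) (∧-elim₁ (∧-elim₂ (∧-elim₂ P)))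

  x-real : ∀ {j} → H ⊢ j ≼ k → H ⊢ IsReal (x · j)
  x-real {j} h = ⇒-elim (∀E s (x₀ ≼ᵖ x₃ ⇒ IsRealᵖ (x₂ · x₀)) (∧-elim₁ P) j) h

  t-real : ∀ {j} → H ⊢ j ≺ k → H ⊢ IsReal (t · j)
  t-real h = ∧-elim₁ (tagged h)

  x-suc-real : ∀ {j} → H ⊢ j ≺ k → H ⊢ IsReal (x · (j +̇ 1̇))
  x-suc-real h = x-real (≺⇒suc≼ h)

  x≤t : ∀ {j} → H ⊢ j ≺ k → ∀ l → H ⊢ x · j · l ≤ℚ t · j · l ⊕ frac 2̇ l
  x≤t {j} h = ≤ᴿ-at (s ▸ j) (x₂ · x₀) (x₁ · x₀) (∧-elim₁ (∧-elim₂ (tagged h)))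

  t≤x : ∀ {j} → H ⊢ j ≺ k → ∀ l → H ⊢ t · j · l ≤ℚ x · (j +̇ 1̇) · l ⊕ frac 2̇ l
  t≤x {j} h = ≤ᴿ-at (s ▸ j) (x₁ · x₀) (x₂ · (x₀ +ᵖ 1ᵖ)) (∧-elim₂ (∧-elim₂ (tagged h)))

  x≤x-4 : ∀ {j} → H ⊢ j ≺ k → ∀ l → H ⊢ x · j · l ≤ℚ x · (j +̇ 1̇) · l ⊕ frac 4̇ l
  x≤x-4 {j} h l = ≤-lin (⊕-mono (x≤t h l) (⊕-mono (t≤x h l) (frac-2+2 l)))
    (ℚ-solve 5 (λ a b c e f → a :⊕ ((b :⊕ e) :⊕ ((c :⊕ e) :⊕ f)) ⊜ (c :⊕ f) :⊕ (a :⊕ (b :⊕ (e :⊕ e)))) ≈-refl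
      (x · j · l) (t · j · l) (x · (j +̇ 1̇) · l) (frac 2̇ l) (frac 4̇ l))

  x≤x : ∀ {j} → H ⊢ j ≺ k → ∀ l → H ⊢ x · j · l ≤ℚ x · (j +̇ 1̇) · l ⊕ frac 8̇ l
  x≤x h l = ≤ℚ-trans (x≤x-4 h l) (⊕-mono ≤ℚ-refl (frac-4≤8 l))

  x-start-lower : ∀ l → H ⊢ 0ℚ ≤ℚ x · 0̇ · l ⊕ frac 2̇ l
  x-start-lower l = ≤ℚ-trans (≈⇒≥ (≐⇒≈ (natᴿ-def 0̇ l))) (∣⊖∣-elimʳ (start l))

  x-start-upper : ∀ l → H ⊢ x · 0̇ · l ≤ℚ 0ℚ ⊕ frac 2̇ l
  x-start-upper l = ≤ℚ-trans (∣⊖∣-elimˡ (start l)) (⊕-mono (≈⇒≤ (≐⇒≈ (natᴿ-def 0̇ l))) ≤ℚ-refl)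

  x-end-lower : ∀ l → H ⊢ natᵒ · 1̇ ≤ℚ x · k · l ⊕ frac 2̇ l
  x-end-lower l = ≤ℚ-trans (≈⇒≥ (≐⇒≈ (natᴿ-def 1̇ l))) (∣⊖∣-elimʳ (end l))

  x-end-upper : ∀ l → H ⊢ x · k · l ≤ℚ natᵒ · 1̇ ⊕ frac 2̇ l
  x-end-upper l = ≤ℚ-trans (∣⊖∣-elimˡ (end l)) (⊕-mono (≈⇒≤ (≐⇒≈ (natᴿ-def 1̇ l))) ≤ℚ-refl)

  mesh : ∀ {n j} → H ⊢ Mesh k x n → H ⊢ j ≺ k → ∀ l →
         H ⊢ x · (j +̇ 1̇) · l ≤ℚ x · j · l ⊕ (frac 1̇ n ⊕ frac 2̇ l)
  mesh {n} {j} M h = sub<2⁻-elim (x-real (≺⇒≼ h)) (x-suc-real h)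
    (⇒-elim (∀E (∅ ▸ k ▸ x ▸ n) (x₀ ≺ x₃ ⇒ subᴿᵖ · (x₂ · (x₀ +ᵖ 1ᵖ)) · (x₂ · x₀) <ᴿᵖ 2⁻ᴿᵖ · x₁) M j) h)

TaggedPartition-↑ : ∀ {Γ σ} {H : List (Fm Γ)} {k x t} → H ⊢ TaggedPartition k x t →
                    map (↑ᶠ_ {σ = σ}) H ⊢ TaggedPartition (↑ k) (↑ x) (↑ t)
TaggedPartition-↑ {k = k} {x} {t} = ↑E (∅ ▸ k ▸ x ▸ t) (TaggedPartitionᵖ x₂ x₁ x₀)

module _ {Γ} {H : List (Fm Γ)} {k : Tm Γ 𝟎} {x t : Tm Γ (𝟎 ⟶ 𝟏)} where

  -- The tolerance of one step is rounded up to 8·2^-l and accumulates to 8d·2^-l. The bound i + d ≤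
  -- k is a premise inside the induction formula, since the points are ordered only up to index k.
  x-mono : H ⊢ TaggedPartition k x t → ∀ l i d → H ⊢ i +̇ d ≼ k →
           H ⊢ x · i · l ≤ℚ x · (i +̇ d) · l ⊕ frac (8̇ *̇ d) l
  x-mono P l i d = ⇒-elim (IND (∅ ▸ k ▸ x ▸ l ▸ i)
    (x₁ +ᵖ x₀ ≼ᵖ x₄ ⇒ x₃ · x₁ · x₂ ≤ℚᵖ x₃ · (x₁ +ᵖ x₀) · x₂ ⊕ᵖ fracᵖ (8ᵖ *ᵖ x₀) x₂)
    (imp (or lt eq) (or lt eq))
    (⇒-intro (≤ℚ-trans (≈⇒≤ (≐⇒≈ (Eq-·ˡ (Eq-·ʳ x (≐-sym (ax (+-zero i)))) l))) (≤-⊕-frac _ _ _)))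
    (⇒-intro (step (w (w (TaggedPartition-↑ P))) h₁ h₀)) d)
    where
    step : ∀ {Δ} {K : List (Fm Δ)} {k x t l i d} → K ⊢ TaggedPartition k x t →
           K ⊢ i +̇ d ≼ k ⇒ x · i · l ≤ℚ x · (i +̇ d) · l ⊕ frac (8̇ *̇ d) l →
           K ⊢ i +̇ (d +̇ 1̇) ≼ k →
           K ⊢ x · i · l ≤ℚ x · (i +̇ (d +̇ 1̇)) · l ⊕ frac (8̇ *̇ (d +̇ 1̇)) l
    step {x = x} {l = l} {i} {d} P ih h = ≤-lin
      (⊕-mono (⇒-elim ih (≺⇒≼ i+d≺k)) (⊕-mono (Partition.x≤x P i+d≺k l)
        (⊕-mono (≈⇒≤ (≐⇒≈ (Eq-·ˡ (Eq-·ʳ x (ax (+-assoc i d 1̇))) l))) (≈⇒≥ (frac-8*suc d l)))))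
      (ℚ-solve 7 (λ a b b′ b″ e η e′ → a :⊕ ((b :⊕ e) :⊕ ((b′ :⊕ η) :⊕ (b″ :⊕ e′)))
        ⊜ (b″ :⊕ e′) :⊕ (a :⊕ (b :⊕ (b′ :⊕ (e :⊕ η))))) ≈-refl
        (x · i · l) (x · (i +̇ d) · l) (x · (i +̇ d +̇ 1̇) · l) (x · (i +̇ (d +̇ 1̇)) · l)
        (frac (8̇ *̇ d) l) (frac 8̇ l) (frac (8̇ *̇ (d +̇ 1̇)) l))
      where
      i+d≺k : _ ⊢ i +̇ d ≺ _
      i+d≺k = ≺-≼-trans (≺-suc (i +̇ d)) (≼-resp (≐-sym (ax (+-assoc i d 1̇))) (=-refl _) h)

module _ {Γ} {H : List (Fm Γ)} {k : Tm Γ 𝟎} {x t : Tm Γ (𝟎 ⟶ 𝟏)}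
         (P : H ⊢ TaggedPartition k x t) {j : Tm Γ 𝟎} (h : H ⊢ j ≺ k) where
  open Partition P

  -- A tagged partition relates only neighbouring points, so 0 ≤ t_j is an accumulated estimate. It
  -- is made at precision e + c, where the error is c units of 2^-(e+c), and carried back to index e
  -- by `lower-limit`.
  t-lower : ∀ e → H ⊢ 0ℚ ≤ℚ t · j · e ⊕ frac 2̇ e
  t-lower e = lower-limit (t-real h) e c (≤-lin
    (⊕-mono (x-start-lower l) (⊕-mono (x-mono P l 0̇ j (≼-resp (≐-sym 0+j) (=-refl k) (≺⇒≼ h)))
      (⊕-mono (≈⇒≤ (≐⇒≈ (Eq-·ˡ (Eq-·ʳ x 0+j) l))) (⊕-mono (x≤t h l) (⊕-mono (frac-2+2 l) (≈⇒≥ (frac-+ (8̇ *̇ j) 4̇ l)))))))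
    (ℚ-solve 8 (λ a b b′ d e f g i → :0 :⊕ ((a :⊕ e) :⊕ ((b :⊕ f) :⊕ (b′ :⊕ ((d :⊕ e) :⊕ (g :⊕ i)))))
      ⊜ (d :⊕ i) :⊕ (:0 :⊕ (a :⊕ (b :⊕ (b′ :⊕ ((e :⊕ e) :⊕ (f :⊕ g))))))) ≈-refl
      (x · 0̇ · l) (x · (0̇ +̇ j) · l) (x · j · l) (t · j · l) (frac 2̇ l) (frac (8̇ *̇ j) l) (frac 4̇ l) (frac c l)))
    where
    c l : Tm Γ 𝟎
    -- 8 for each interval before x_j, 2 for x_0 = 0 and 2 for x_j ≤ t_j.
    c = 8̇ *̇ j +̇ 4̇
    l = e +̇ c
    0+j : H ⊢ 0̇ +̇ j ≐ j
    0+j = ≐-trans (ax (+-comm 0̇ j)) (ax (+-zero j))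

  t-upper : ∀ e → H ⊢ t · j · e ≤ℚ natᵒ · 1̇ ⊕ frac 2̇ e
  t-upper e = upper-limit (t-real h) e c (≤-lin
    (⊕-mono (x-end-upper l) (⊕-mono (x-mono P l (j +̇ 1̇) d (≐⇒≼ (≐-sym k≐)))
      (⊕-mono (≈⇒≤ (≐⇒≈ (Eq-·ˡ (Eq-·ʳ x (≐-sym k≐)) l))) (⊕-mono (t≤x h l) (⊕-mono (frac-2+2 l) (≈⇒≥ (frac-+ (8̇ *̇ d) 4̇ l)))))))
    (ℚ-solve 9 (λ u a b b′ d e f g i → d :⊕ ((u :⊕ e) :⊕ ((b :⊕ f) :⊕ (a :⊕ ((b′ :⊕ e) :⊕ (g :⊕ i)))))
      ⊜ (u :⊕ i) :⊕ (a :⊕ (b′ :⊕ (b :⊕ (d :⊕ ((e :⊕ e) :⊕ (f :⊕ g))))))) ≈-refl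
      (natᵒ · 1̇) (x · k · l) (x · (j +̇ 1̇ +̇ d) · l) (x · (j +̇ 1̇) · l) (t · j · l) (frac 2̇ l) (frac (8̇ *̇ d) l) (frac 4̇ l) (frac c l)))
    where
    d c l : Tm Γ 𝟎
    d = k ∸̇ (j +̇ 1̇)
    c = 8̇ *̇ d +̇ 4̇
    l = e +̇ c
    k≐ : H ⊢ k ≐ j +̇ 1̇ +̇ d
    k≐ = ≼⇒+ (≺⇒suc≼ h)

InI : ∀ {Γ} → Tm Γ 𝟏 → Fm Γ
InI u = ⟪ x₀ ∈Iᵖ ⟫ (∅ ▸ u)

≺-↑ : ∀ {Γ σ} {H : List (Fm Γ)} {a b} → H ⊢ a ≺ b → map (↑ᶠ_ {σ = σ}) H ⊢ ↑ a ≺ ↑ b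
≺-↑ {a = a} {b} = ↑E (∅ ▸ a ▸ b) (x₁ ≺ x₀)

-- Needed because injectivity of `Y` is assumed only for points of [0,1].
t∈I : ∀ {Γ} {H : List (Fm Γ)} {k : Tm Γ 𝟎} {x t : Tm Γ (𝟎 ⟶ 𝟏)} → H ⊢ TaggedPartition k x t →
      ∀ {j} → H ⊢ j ≺ k → H ⊢ InI (t · j)
t∈I {t = t} P {j} h = ∧-intro (Partition.t-real P h) (∧-intro
  (≤ᴿ-intro (∅ ▸ t · j) (natᴿᵖ · 0ᵖ) x₀ (≤ℚ-trans (≈⇒≤ (≐⇒≈ (natᴿ-def 0̇ v₀)))
    (t-lower (TaggedPartition-↑ P) (≺-↑ h) v₀)))
  (≤ᴿ-intro (∅ ▸ t · j) x₀ (natᴿᵖ · 1ᵖ) (≤ℚ-trans (t-upper (TaggedPartition-↑ P) (≺-↑ h) v₀)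
    (⊕-mono (≈⇒≥ (≐⇒≈ (natᴿ-def 1̇ v₀))) ≤ℚ-refl))))

-- oneF is the limit f = 1, and stepF Y · n is f_n.

indicator : ∀ {Γ} → Tm Γ 𝟎 → Tm Γ 𝟎 → Tm Γ 𝟎
indicator y n = 1̇ ∸̇ ((y +̇ 1̇) ∸̇ n)

opaque
  unfolding leftᵒ

  oneF : ∀ {Γ} → Tm Γ (𝟏 ⟶ 𝟏)
  oneF = ƛ natᴿ · 1̇

  oneF-sub : ∀ {Γ Δ} (s : Sub Γ Δ) → subT s oneF ≡ oneF
  oneF-sub s = refl

  stepF : ∀ {Γ} → Tm Γ (𝟏 ⟶ 𝟎) → Tm Γ (𝟎 ⟶ 𝟏 ⟶ 𝟏)
  stepF Y = subT (∅ ▸ Y) (ƛ ƛ natᴿ · indicator (v₂ · v₀) v₁)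

  stepF-sub : ∀ {Γ Δ} (s : Sub Γ Δ) Y → subT s (stepF Y) ≡ stepF (subT s Y)
  stepF-sub s Y = trans (subT-subT s (∅ ▸ Y) (ƛ ƛ natᴿ · indicator (v₂ · v₀) v₁))
    (subT-cong {s = s ∘ₛ (∅ ▸ Y)} {∅ ▸ subT s Y} (λ { (here refl) → refl }) (ƛ ƛ natᴿ · indicator (v₂ · v₀) v₁))

  oneF-at : ∀ {Γ} {H : List (Fm Γ)} u m → H ⊢ oneF · u · m ≐ natᵒ · 1̇
  oneF-at u m = ≐-trans (Eq-·ˡ (βₛ ∅ (natᴿ · 1̇) u) m) (natᴿ-def 1̇ m)

  stepF-at : ∀ {Γ} {H : List (Fm Γ)} Y n u m → H ⊢ stepF Y · n · u · m ≐ natᵒ · indicator (Y · u) n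
  stepF-at Y n u m = ≐-trans (Eq-·ˡ (β₂ₛ (∅ ▸ Y) (natᴿ · indicator (v₂ · v₀) v₁) n u) m) (natᴿ-def _ m)

module _ {Γ} {H : List (Fm Γ)} where

  indicator-one : ∀ {y n} → H ⊢ y ≺ n → H ⊢ indicator y n ≐ 1̇
  indicator-one h = ≐-trans (∸-cong (=-refl 1̇) (∸-≼ (≺⇒suc≼ h))) (∸-zero 1̇)

  -- For n ≤ y the inner difference is at least 1, so the outer one is truncated to 0.
  indicator-zero : ∀ {y n} → H ⊢ n ≼ y → H ⊢ indicator y n ≐ 0̇
  indicator-zero {y} {n} h = ∸-≼ (≼-lin (+-mono-≼ h (≐⇒≼ (≼⇒+ (≼-trans h (≺⇒≼ (≺-suc y))))))
    (solve 4 (λ y n d i → i :+ (y :+ (n :+ d)) := d :+ (n :+ (y :+ i))) (=-refl _) y n ((y +̇ 1̇) ∸̇ n) 1̇))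

-- x_{j+1} − x_j as it occurs in the Riemann sum: the index exceeds the common
-- precision l by an amount that depends on j and on the integrand.

gap : ∀ {Γ} → Tm Γ (𝟎 ⟶ 𝟏) → Tm Γ 𝟎 → Tm Γ 𝟎 → Tm Γ 𝟎 → Tm Γ 𝟎
gap x j l b = x · (j +̇ 1̇) · (l +̇ b +̇ 1̇) ⊖ x · j · (l +̇ b +̇ 1̇)

module _ {Γ} {H : List (Fm Γ)} {k : Tm Γ 𝟎} {x t : Tm Γ (𝟎 ⟶ 𝟏)}
         (P : H ⊢ TaggedPartition k x t) {j : Tm Γ 𝟎} (h : H ⊢ j ≺ k) (l : Tm Γ 𝟎) where
  open Partition P

  private
    far≤ : ∀ {y} → H ⊢ IsReal y → ∀ b → H ⊢ y · (l +̇ b +̇ 1̇) ≤ℚ y · l ⊕ frac 1̇ l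
    far≤ {y} d b = ≤ℚ-trans (≈⇒≤ (≐⇒≈ (Eq-·ʳ y (ax (+-assoc l b 1̇))))) (near-+ʳ d l (b +̇ 1̇))

    ≤far : ∀ {y} → H ⊢ IsReal y → ∀ b → H ⊢ y · l ≤ℚ y · (l +̇ b +̇ 1̇) ⊕ frac 1̇ l
    ≤far {y} d b = ≤ℚ-trans (near-+ˡ d l (b +̇ 1̇))
      (⊕-mono (≈⇒≥ (≐⇒≈ (Eq-·ʳ y (ax (+-assoc l b 1̇))))) ≤ℚ-refl)

  gap-upper : ∀ b → H ⊢ gap x j l b ⊕ x · j · l ≤ℚ x · (j +̇ 1̇) · l ⊕ frac 2̇ l
  gap-upper b = ≤-lin (⊕-mono (≈⇒≤ (⊖-⊕ _ _)) (⊕-mono (far≤ (x-suc-real h) b)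
      (⊕-mono (≤far (x-real (≺⇒≼ h)) b) (≈⇒≥ (frac-+ 1̇ 1̇ l)))))
    (ℚ-solve 7 (λ d p q p′ q′ e f → (d :⊕ p) :⊕ (q′ :⊕ ((q :⊕ e) :⊕ ((p′ :⊕ e) :⊕ f)))
      ⊜ (q :⊕ f) :⊕ ((d :⊕ p′) :⊕ (q′ :⊕ (p :⊕ (e :⊕ e))))) ≈-refl
      (gap x j l b) (x · j · l) (x · (j +̇ 1̇) · l) (x · j · (l +̇ b +̇ 1̇)) (x · (j +̇ 1̇) · (l +̇ b +̇ 1̇)) (frac 1̇ l) (frac 2̇ l))

  gap-lower : ∀ b → H ⊢ x · (j +̇ 1̇) · l ≤ℚ gap x j l b ⊕ x · j · l ⊕ frac 2̇ l
  gap-lower b = ≤-lin (⊕-mono (≈⇒≥ (⊖-⊕ _ _)) (⊕-mono (≤far (x-suc-real h) b)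
      (⊕-mono (far≤ (x-real (≺⇒≼ h)) b) (≈⇒≥ (frac-+ 1̇ 1̇ l)))))
    (ℚ-solve 7 (λ d p q p′ q′ e f → q :⊕ ((d :⊕ p′) :⊕ ((q′ :⊕ e) :⊕ ((p :⊕ e) :⊕ f)))
      ⊜ ((d :⊕ p) :⊕ f) :⊕ (q′ :⊕ (q :⊕ (p′ :⊕ (e :⊕ e))))) ≈-refl
      (gap x j l b) (x · j · l) (x · (j +̇ 1̇) · l) (x · j · (l +̇ b +̇ 1̇)) (x · (j +̇ 1̇) · (l +̇ b +̇ 1̇)) (frac 1̇ l) (frac 2̇ l))

  gap-nonneg : ∀ b → H ⊢ 0ℚ ≤ℚ gap x j l b ⊕ frac 8̇ l
  gap-nonneg b = ≤-lin (⊕-mono (gap-lower b) (⊕-mono (x≤x-4 h l) (⊕-mono (frac-2≤4 l) (≈⇒≥ (frac-+ 4̇ 4̇ l)))))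
    (ℚ-solve 6 (λ d p q e f g → :0 :⊕ (((d :⊕ p) :⊕ e) :⊕ ((q :⊕ f) :⊕ (f :⊕ g)))
      ⊜ (d :⊕ g) :⊕ (q :⊕ (p :⊕ (e :⊕ (f :⊕ f))))) ≈-refl
      (gap x j l b) (x · j · l) (x · (j +̇ 1̇) · l) (frac 2̇ l) (frac 4̇ l) (frac 8̇ l))

  -- The same interval enters the sums of two integrands at two different indices; both lengths are
  -- compared with the difference at the common precision l.
  gap-close : ∀ b b′ → H ⊢ gap x j l b ≤ℚ gap x j l b′ ⊕ frac 4̇ l
  gap-close b b′ = ≤-lin (⊕-mono (gap-upper b) (⊕-mono (gap-lower b′) (frac-2+2 l)))
    (ℚ-solve 6 (λ d d′ p q e f → d :⊕ ((q :⊕ e) :⊕ (((d′ :⊕ p) :⊕ e) :⊕ f))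
      ⊜ (d′ :⊕ f) :⊕ ((d :⊕ p) :⊕ (q :⊕ (e :⊕ e)))) ≈-refl
      (gap x j l b) (gap x j l b′) (x · j · l) (x · (j +̇ 1̇) · l) (frac 2̇ l) (frac 4̇ l))

-- Riemann sums at one precision.

Sum : ∀ {Γ} → Tm Γ (𝟏 ⟶ 𝟏) → Tm Γ 𝟎 → Tm Γ (𝟎 ⟶ 𝟏) → Tm Γ (𝟎 ⟶ 𝟏) → Tm Γ 𝟎 → Tm Γ 𝟎 → Tm Γ 𝟎
Sum f k x t n j = sumTo (summand f x t) k n · j

Sumᵖ : ∀ {Γ} → Tp Γ (𝟏 ⟶ 𝟏) → Tp Γ 𝟎 → Tp Γ (𝟎 ⟶ 𝟏) → Tp Γ (𝟎 ⟶ 𝟏) → Tp Γ 𝟎 → Tp Γ 𝟎 → Tp Γ 𝟎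
Sumᵖ f k x t n j = sumToᵖ (summandᵖ f x t) k n · j

stepFᵖ : ∀ {Γ} → Tp Γ (𝟏 ⟶ 𝟎) → Tp Γ (𝟎 ⟶ 𝟏 ⟶ 𝟏)
stepFᵖ Y = fun {Θ = (𝟏 ⟶ 𝟎) ∷ []} (λ s → stepF (s (here refl))) (λ e → cong stepF (e (here refl)))
  (λ r s → stepF-sub r _) (εᵖ ▹ Y)

oneFᵖ : ∀ {Γ} → Tp Γ (𝟏 ⟶ 𝟏)
oneFᵖ = cst (λ _ → oneF) oneF-sub

precision : ∀ {Γ} → Tm Γ (𝟏 ⟶ 𝟏) → Tm Γ (𝟎 ⟶ 𝟏) → Tm Γ (𝟎 ⟶ 𝟏) → Tm Γ 𝟎 → Tm Γ 𝟎
precision f x t j = shift (f · (t · j)) (subᴿᵒ · (x · (j +̇ 1̇)) · (x · j))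

module _ {Γ} {H : List (Fm Γ)} (f : Tm Γ (𝟏 ⟶ 𝟏)) (k : Tm Γ 𝟎) (x t : Tm Γ (𝟎 ⟶ 𝟏)) (n : Tm Γ 𝟎) where

  riemannSum-at : H ⊢ riemannSumᵒ f k x t · n ≐ Sum f k x t n k
  riemannSum-at = subst (λ z → H ⊢ z · n ≐ Sum f k x t n k) (sym (riemannSum-def f k x t)) (sumᴿ-at (summand f x t) k n)

  Sum-zero : H ⊢ Sum f k x t n 0̇ ≈ 0ℚ
  Sum-zero = ≐⇒≈ (sumTo-zero _ _ _)

  Sum-suc : ∀ j → H ⊢ Sum f k x t n (j +̇ 1̇) ≐ Sum f k x t n j ⊕
    (mulᵒ · (f · (t · j) · (n +̇ k +̇ precision f x t j)) · gap x j (n +̇ k) (precision f x t j))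
  Sum-suc j = ≐-trans (sumTo-suc _ _ _ j) (Eq-·ʳ _
    (≐-trans (Eq-·ˡ (summand-at f x t j) (n +̇ k)) (≐-trans (mulᴿ-at _ _ _) (Eq-·ʳ _ (subᴿ-def _ _ _)))))

  -- The integrands have exactly the rational value 1 or 0 at every index. A product of
  -- approximations is therefore a gap or 0, and `mulᴿ` needs no error estimate.
  Sum-suc-one : ∀ j → H ⊢ f · (t · j) · (n +̇ k +̇ precision f x t j) ≐ natᵒ · 1̇ →
                H ⊢ Sum f k x t n (j +̇ 1̇) ≈ Sum f k x t n j ⊕ gap x j (n +̇ k) (precision f x t j)
  Sum-suc-one j e = ≈-trans (≐⇒≈ (Sum-suc j)) (⊕-cong ≈-refl
    (≈-trans (≐⇒≈ (Eq-·ˡ (Eq-·ʳ mulᵒ e) _)) (mul-one _)))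

  Sum-suc-zero : ∀ j → H ⊢ f · (t · j) · (n +̇ k +̇ precision f x t j) ≐ natᵒ · 0̇ →
                 H ⊢ Sum f k x t n (j +̇ 1̇) ≈ Sum f k x t n j
  Sum-suc-zero j e = ≈-trans (≐⇒≈ (Sum-suc j)) (≈-trans (⊕-cong ≈-refl
    (≈-trans (≐⇒≈ (Eq-·ˡ (Eq-·ʳ mulᵒ e) _)) (mul-zero _))) (⊕-identityʳ _))

module _ {Γ} {H : List (Fm Γ)} where

  frac-2≤8 : ∀ l → H ⊢ frac 2̇ l ≤ℚ frac 8̇ l
  frac-2≤8 l = ≤ℚ-trans (frac-2≤4 l) (frac-4≤8 l)

  suc≼⇒≺ : ∀ {j k} → H ⊢ j +̇ 1̇ ≼ k → H ⊢ j ≺ k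
  suc≼⇒≺ {j} h = ≺-≼-trans (≺-suc j) h

module _ {Γ} {H : List (Fm Γ)} {k : Tm Γ 𝟎} {x t : Tm Γ (𝟎 ⟶ 𝟏)} where

  -- With integrand 1 each step adds a gap, which is x_(j+1) - x_j at precision l up to 2·2^-l. The
  -- starting point is added on the side of the sum so that no difference appears.
  telescope : H ⊢ TaggedPartition k x t → ∀ n j → H ⊢ j ≼ k →
              H ⊢ Sum oneF k x t n j ⊕ x · 0̇ · (n +̇ k) ≤ℚ x · j · (n +̇ k) ⊕ frac (8̇ *̇ j) (n +̇ k) ∧̇
                  x · j · (n +̇ k) ≤ℚ (Sum oneF k x t n j ⊕ x · 0̇ · (n +̇ k)) ⊕ frac (8̇ *̇ j) (n +̇ k)
  telescope P n j = ⇒-elim (IND (∅ ▸ k ▸ x ▸ t ▸ n)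
    (x₀ ≼ᵖ x₄ ⇒ S ⊕ᵖ X0 ≤ℚᵖ Xj ⊕ᵖ Ej ∧̇ Xj ≤ℚᵖ (S ⊕ᵖ X0) ⊕ᵖ Ej)
    (imp (or lt eq) (and (or lt eq) (or lt eq)))
    (⇒-intro (∧-intro
      (≤ℚ-trans (≤-lin (≈⇒≤ (Sum-zero oneF k x t n)) (ℚ-solve 2 (λ s a → (s :⊕ a) :⊕ :0 ⊜ a :⊕ s) ≈-refl _ _)) (≤-⊕-frac _ _ _))
      (≤ℚ-trans (≤-lin (≈⇒≥ (Sum-zero oneF k x t n)) (ℚ-solve 2 (λ s a → a :⊕ s ⊜ (s :⊕ a) :⊕ :0) ≈-refl _ _)) (≤-⊕-frac _ _ _))))
    (⇒-intro (step (w (w (TaggedPartition-↑ P))) h₁ h₀)) j)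
    where
    S = Sumᵖ oneFᵖ x₄ x₃ x₂ x₁ x₀
    X0 = x₃ · 0ᵖ · (x₁ +ᵖ x₄)
    Xj = x₃ · x₀ · (x₁ +ᵖ x₄)
    Ej = fracᵖ (8ᵖ *ᵖ x₀) (x₁ +ᵖ x₄)
    Q : ∀ {Δ} (k : Tm Δ 𝟎) (x t : Tm Δ (𝟎 ⟶ 𝟏)) (n j : Tm Δ 𝟎) → Fm Δ
    Q k x t n j = Sum oneF k x t n j ⊕ x · 0̇ · (n +̇ k) ≤ℚ x · j · (n +̇ k) ⊕ frac (8̇ *̇ j) (n +̇ k) ∧̇
                  x · j · (n +̇ k) ≤ℚ (Sum oneF k x t n j ⊕ x · 0̇ · (n +̇ k)) ⊕ frac (8̇ *̇ j) (n +̇ k)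
    step : ∀ {Δ} {K : List (Fm Δ)} {k x t n j} → K ⊢ TaggedPartition k x t →
           K ⊢ j ≼ k ⇒ Q k x t n j → K ⊢ j +̇ 1̇ ≼ k → K ⊢ Q k x t n (j +̇ 1̇)
    step {K = K} {k} {x} {t} {n} {j} P ih h = ∧-intro
      (≤-lin (⊕-mono (∧-elim₁ ih′) (⊕-mono (≈⇒≤ suc) (⊕-mono (gap-upper P j≺k l b) (⊕-mono (frac-2≤8 l) (≈⇒≥ (frac-8*suc j l))))))
        (ℚ-solve 10 (λ s s′ d a p q e e′ f g → (s′ :⊕ a) :⊕ ((p :⊕ e) :⊕ ((s :⊕ d) :⊕ ((q :⊕ f) :⊕ (g :⊕ e′))))
          ⊜ (q :⊕ e′) :⊕ ((s :⊕ a) :⊕ (s′ :⊕ ((d :⊕ p) :⊕ (f :⊕ (e :⊕ g)))))) ≈-refl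
          s₀ s₁ d a p q e e′ f g))
      (≤-lin (⊕-mono (∧-elim₂ ih′) (⊕-mono (≈⇒≥ suc) (⊕-mono (gap-lower P j≺k l b) (⊕-mono (frac-2≤8 l) (≈⇒≥ (frac-8*suc j l))))))
        (ℚ-solve 10 (λ s s′ d a p q e e′ f g → q :⊕ (((s :⊕ a) :⊕ e) :⊕ (s′ :⊕ (((d :⊕ p) :⊕ f) :⊕ (g :⊕ e′))))
          ⊜ ((s′ :⊕ a) :⊕ e′) :⊕ (p :⊕ ((s :⊕ d) :⊕ (q :⊕ (f :⊕ (e :⊕ g)))))) ≈-refl
          s₀ s₁ d a p q e e′ f g))
      where
      j≺k = suc≼⇒≺ {H = K} h
      ih′ = ⇒-elim ih (≺⇒≼ j≺k)
      l = n +̇ k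
      b = precision oneF x t j
      s₀ = Sum oneF k x t n j
      s₁ = Sum oneF k x t n (j +̇ 1̇)
      suc = Sum-suc-one {H = K} oneF k x t n j (oneF-at _ _)
      d = gap x j l b
      a = x · 0̇ · l
      p = x · j · l
      q = x · (j +̇ 1̇) · l
      e = frac (8̇ *̇ j) l
      e′ = frac (8̇ *̇ (j +̇ 1̇)) l
      f = frac 2̇ l
      g = frac 8̇ l

-- The sums of the step functions.

stepSum : ∀ {Γ} → Tm Γ (𝟏 ⟶ 𝟎) → Tm Γ 𝟎 → Tm Γ 𝟎 → Tm Γ (𝟎 ⟶ 𝟏) → Tm Γ (𝟎 ⟶ 𝟏) → Tm Γ 𝟎 → Tm Γ 𝟎 → Tm Γ 𝟎
stepSum Y m k x t n j = Sum (stepF Y · m) k x t n j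

stepSumᵖ : ∀ {Γ} → Tp Γ (𝟏 ⟶ 𝟎) → Tp Γ 𝟎 → Tp Γ 𝟎 → Tp Γ (𝟎 ⟶ 𝟏) → Tp Γ (𝟎 ⟶ 𝟏) → Tp Γ 𝟎 → Tp Γ 𝟎 → Tp Γ 𝟎
stepSumᵖ Y m k x t n j = Sumᵖ (stepFᵖ Y · m) k x t n j

module _ {Γ} {H : List (Fm Γ)} (Y : Tm Γ (𝟏 ⟶ 𝟎)) (m k : Tm Γ 𝟎) (x t : Tm Γ (𝟎 ⟶ 𝟏)) (n j : Tm Γ 𝟎) where

  stepSum-on : H ⊢ Y · (t · j) ≺ m →
    H ⊢ stepSum Y m k x t n (j +̇ 1̇) ≈ stepSum Y m k x t n j ⊕ gap x j (n +̇ k) (precision (stepF Y · m) x t j)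
  stepSum-on h = Sum-suc-one (stepF Y · m) k x t n j
    (≐-trans (stepF-at Y m (t · j) _) (Eq-·ʳ natᵒ (indicator-one h)))

  stepSum-off : H ⊢ m ≼ Y · (t · j) → H ⊢ stepSum Y m k x t n (j +̇ 1̇) ≈ stepSum Y m k x t n j
  stepSum-off h = Sum-suc-zero (stepF Y · m) k x t n j
    (≐-trans (stepF-at Y m (t · j) _) (Eq-·ʳ natᵒ (indicator-zero h)))

module _ {Γ} {H : List (Fm Γ)} (Y : Tm Γ (𝟏 ⟶ 𝟎)) {k : Tm Γ 𝟎} {x t : Tm Γ (𝟎 ⟶ 𝟏)} where

  -- No value of `Y` is below 0, so no interval contributes. This starts the induction on the values
  -- of `Y`.
  stepSum-zero : ∀ n j → H ⊢ stepSum Y 0̇ k x t n j ≤ℚ 0ℚ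
  stepSum-zero n = IND (∅ ▸ Y ▸ k ▸ x ▸ t ▸ n)
    (stepSumᵖ x₅ 0ᵖ x₄ x₃ x₂ x₁ x₀ ≤ℚᵖ cst (λ _ → natᵒ) natᵒ-sub · 0ᵖ) (or lt eq)
    (≈⇒≤ (Sum-zero _ k x t n))
    (≤ℚ-trans (≈⇒≤ (stepSum-off _ _ _ _ _ _ _ (0≼ _))) h₀)

  -- An approximated length may be slightly negative; each one costs at most 8·2^-l.
  stepSum-lower : H ⊢ TaggedPartition k x t → ∀ m n j → H ⊢ j ≼ k →
                  H ⊢ 0ℚ ≤ℚ stepSum Y m k x t n j ⊕ frac (8̇ *̇ j) (n +̇ k)
  stepSum-lower P m n j = ⇒-elim (IND (∅ ▸ Y ▸ m ▸ k ▸ x ▸ t ▸ n)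
    (x₀ ≼ᵖ x₄ ⇒ cst (λ _ → natᵒ) natᵒ-sub · 0ᵖ ≤ℚᵖ stepSumᵖ x₆ x₅ x₄ x₃ x₂ x₁ x₀ ⊕ᵖ fracᵖ (8ᵖ *ᵖ x₀) (x₁ +ᵖ x₄))
    (imp (or lt eq) (or lt eq))
    (⇒-intro (≤ℚ-trans (≈⇒≥ (Sum-zero _ k x t n)) (≤-⊕-frac _ _ _)))
    (⇒-intro (step (w (w (TaggedPartition-↑ P))) h₁ h₀)) j)
    where
    step : ∀ {Δ} {K : List (Fm Δ)} {Y m k x t n j} → K ⊢ TaggedPartition k x t →
           K ⊢ j ≼ k ⇒ 0ℚ ≤ℚ stepSum Y m k x t n j ⊕ frac (8̇ *̇ j) (n +̇ k) → K ⊢ j +̇ 1̇ ≼ k →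
           K ⊢ 0ℚ ≤ℚ stepSum Y m k x t n (j +̇ 1̇) ⊕ frac (8̇ *̇ (j +̇ 1̇)) (n +̇ k)
    step {K = K} {Y} {m} {k} {x} {t} {n} {j} P ih h = ∨-elim (≺-or-≽ (Y · (t · j)) m)
      (≤-lin (⊕-mono (w ih′) (⊕-mono (≈⇒≥ (stepSum-on Y m k x t n j h₀)) (⊕-mono (gap-nonneg (w P) (w j≺k) l _) (≈⇒≥ (frac-8*suc j l)))))
        (ℚ-solve 6 (λ s s′ d e e′ g → :0 :⊕ ((s :⊕ e) :⊕ (s′ :⊕ ((d :⊕ g) :⊕ e′)))
          ⊜ (s′ :⊕ e′) :⊕ (:0 :⊕ ((s :⊕ d) :⊕ (:0 :⊕ (e :⊕ g))))) ≈-refl _ _ _ _ _ _))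
      (≤-lin (⊕-mono (w ih′) (⊕-mono (≈⇒≥ (stepSum-off Y m k x t n j h₀)) (⊕-mono (0≤frac 8̇ l) (≈⇒≥ (frac-8*suc j l)))))
        (ℚ-solve 5 (λ s s′ e e′ g → :0 :⊕ ((s :⊕ e) :⊕ (s′ :⊕ (g :⊕ e′)))
          ⊜ (s′ :⊕ e′) :⊕ (:0 :⊕ (s :⊕ (:0 :⊕ (e :⊕ g))))) ≈-refl _ _ _ _ _))
      where
      j≺k = suc≼⇒≺ {H = K} h
      ih′ = ⇒-elim ih (≺⇒≼ j≺k)
      l = n +̇ k

-- Let g₁ and g₀ be the sums of f_{m+1} and f_m up to a partition point p.  They
-- differ by the intervals tagged by points with Y-value m, which lie between
-- τ − α and τ + α; so g₁ − g₀ ≤ p − (τ − α) once such an interval has occurred, and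
-- at the last of them p ≤ τ + α.  The error e grows with every interval.

Inv : ∀ {Γ} → Tm Γ 𝟎 → Tm Γ 𝟎 → Tm Γ 𝟎 → Tm Γ 𝟎 → Tm Γ 𝟎 → Tm Γ 𝟎 → Fm Γ
Inv g₁ g₀ τ α p e = g₁ ≤ℚ g₀ ⊕ (α ⊕ α) ⊕ e ∧̇ (g₁ ≤ℚ g₀ ⊕ e ∨̇ g₁ ⊕ τ ≤ℚ g₀ ⊕ p ⊕ α ⊕ e)

module _ {Γ} {H : List (Fm Γ)} {g₁ g₀ τ α p e g₁′ g₀′ q e′ η f : Tm Γ 𝟎} where

  -- The interval from p to q is tagged with value m. If it is the first such interval, p ≥ τ - α
  -- yields the second alternative; otherwise that alternative advances from p to q by the length d.
  -- Now q ≤ τ + α turns it into the bound 2α of the first conjunct.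
  Inv-on : ∀ {d} → H ⊢ Inv g₁ g₀ τ α p e → H ⊢ τ ≤ℚ p ⊕ α → H ⊢ q ≤ℚ τ ⊕ α →
           H ⊢ d ⊕ p ≤ℚ q ⊕ f → H ⊢ f ≤ℚ η → H ⊢ e ⊕ η ≤ℚ e′ →
           H ⊢ g₁′ ≤ℚ g₁ ⊕ d → H ⊢ g₀ ≤ℚ g₀′ → H ⊢ Inv g₁′ g₀′ τ α q e′
  Inv-on {d} ih a b c u v y z = ∧-intro
    (≤-lin (⊕-mono near′ b)
      (ℚ-solve 6 (λ g₁′ g₀′ τ α q e′ → g₁′ :⊕ ((((g₀′ :⊕ q) :⊕ α) :⊕ e′) :⊕ (τ :⊕ α))
        ⊜ ((g₀′ :⊕ (α :⊕ α)) :⊕ e′) :⊕ ((g₁′ :⊕ τ) :⊕ q)) ≈-refl _ _ _ _ _ _))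
    (∨-intro₂ near′)
    where
    near′ : H ⊢ g₁′ ⊕ τ ≤ℚ g₀′ ⊕ q ⊕ α ⊕ e′
    near′ = ∨-elim (∧-elim₂ ih)
      (≤-lin (⊕-mono h₀ (⊕-mono (w y) (⊕-mono (w z) (⊕-mono (w a) (⊕-mono (w c) (⊕-mono (w u) (w v)))))))
        (ℚ-solve 13 (λ g₁ g₀ τ α p e g₁′ g₀′ q e′ η f d →
          (g₁′ :⊕ τ) :⊕ ((g₀ :⊕ e) :⊕ ((g₁ :⊕ d) :⊕ (g₀′ :⊕ ((p :⊕ α) :⊕ ((q :⊕ f) :⊕ (η :⊕ e′))))))
          ⊜ (((g₀′ :⊕ q) :⊕ α) :⊕ e′) :⊕ (g₁ :⊕ (g₁′ :⊕ (g₀ :⊕ (τ :⊕ ((d :⊕ p) :⊕ (f :⊕ (e :⊕ η)))))))) ≈-refl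
          g₁ g₀ τ α p e g₁′ g₀′ q e′ η f d))
      (≤-lin (⊕-mono h₀ (⊕-mono (w y) (⊕-mono (w z) (⊕-mono (w c) (⊕-mono (w u) (w v))))))
        (ℚ-solve 13 (λ g₁ g₀ τ α p e g₁′ g₀′ q e′ η f d →
          (g₁′ :⊕ τ) :⊕ ((((g₀ :⊕ p) :⊕ α) :⊕ e) :⊕ ((g₁ :⊕ d) :⊕ (g₀′ :⊕ ((q :⊕ f) :⊕ (η :⊕ e′)))))
          ⊜ (((g₀′ :⊕ q) :⊕ α) :⊕ e′) :⊕ ((g₁ :⊕ τ) :⊕ (g₁′ :⊕ (g₀ :⊕ ((d :⊕ p) :⊕ (f :⊕ (e :⊕ η))))))) ≈-refl
          g₁ g₀ τ α p e g₁′ g₀′ q e′ η f d))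

  -- The interval has another value: both sums take it, with lengths that differ by at most f, or
  -- neither does. The second alternative also spends f on p ≤ q + f, whence the premise f + f ≤ η.
  Inv-same : ∀ {d₁ d₀} → H ⊢ Inv g₁ g₀ τ α p e → H ⊢ d₁ ≤ℚ d₀ ⊕ f → H ⊢ p ≤ℚ q ⊕ f →
             H ⊢ 0ℚ ≤ℚ f → H ⊢ f ⊕ f ≤ℚ η → H ⊢ e ⊕ η ≤ℚ e′ →
             H ⊢ g₁′ ≤ℚ g₁ ⊕ d₁ → H ⊢ g₀ ⊕ d₀ ≤ℚ g₀′ → H ⊢ Inv g₁′ g₀′ τ α q e′
  Inv-same {d₁} {d₀} ih a b n u v y z = ∧-intro
    (≤-lin (⊕-mono (∧-elim₁ ih) common)
      (ℚ-solve 11 (λ g₁ g₀ α e g₁′ g₀′ e′ η f d₁ d₀ →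
        g₁′ :⊕ (((g₀ :⊕ (α :⊕ α)) :⊕ e) :⊕ ((g₁ :⊕ d₁) :⊕ (g₀′ :⊕ ((d₀ :⊕ f) :⊕ (f :⊕ (η :⊕ e′))))))
        ⊜ ((g₀′ :⊕ (α :⊕ α)) :⊕ e′) :⊕ (g₁ :⊕ (g₁′ :⊕ ((g₀ :⊕ d₀) :⊕ (d₁ :⊕ (:0 :⊕ ((f :⊕ f) :⊕ (e :⊕ η)))))))) ≈-refl
        g₁ g₀ α e g₁′ g₀′ e′ η f d₁ d₀))
    (∨-elim (∧-elim₂ ih)
      (∨-intro₁ (≤-lin (⊕-mono h₀ (w common))
        (ℚ-solve 10 (λ g₁ g₀ e g₁′ g₀′ e′ η f d₁ d₀ →
          g₁′ :⊕ ((g₀ :⊕ e) :⊕ ((g₁ :⊕ d₁) :⊕ (g₀′ :⊕ ((d₀ :⊕ f) :⊕ (f :⊕ (η :⊕ e′))))))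
          ⊜ (g₀′ :⊕ e′) :⊕ (g₁ :⊕ (g₁′ :⊕ ((g₀ :⊕ d₀) :⊕ (d₁ :⊕ (:0 :⊕ ((f :⊕ f) :⊕ (e :⊕ η)))))))) ≈-refl
          g₁ g₀ e g₁′ g₀′ e′ η f d₁ d₀)))
      (∨-intro₂ (≤-lin (⊕-mono h₀ (⊕-mono (w y) (⊕-mono (w z) (⊕-mono (w a) (⊕-mono (w b) (⊕-mono (w u) (w v)))))))
        (ℚ-solve 14 (λ g₁ g₀ τ α p e g₁′ g₀′ q e′ η f d₁ d₀ →
          (g₁′ :⊕ τ) :⊕ ((((g₀ :⊕ p) :⊕ α) :⊕ e) :⊕ ((g₁ :⊕ d₁) :⊕ (g₀′ :⊕ ((d₀ :⊕ f) :⊕ ((q :⊕ f) :⊕ (η :⊕ e′))))))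
          ⊜ (((g₀′ :⊕ q) :⊕ α) :⊕ e′) :⊕ ((g₁ :⊕ τ) :⊕ (g₁′ :⊕ ((g₀ :⊕ d₀) :⊕ (d₁ :⊕ (p :⊕ ((f :⊕ f) :⊕ (e :⊕ η)))))))) ≈-refl
          g₁ g₀ τ α p e g₁′ g₀′ q e′ η f d₁ d₀))))
    where
    common = ⊕-mono y (⊕-mono z (⊕-mono a (⊕-mono n (⊕-mono u v))))

x₈ : ∀ {Γ a b c d e f g h i} → Tp (i ∷ h ∷ g ∷ f ∷ e ∷ d ∷ c ∷ b ∷ a ∷ Γ) a
x₈ = upᵖ x₇

tagsᵖ : Fp (𝟎 ∷ 𝟎 ∷ 𝟎 ∷ 𝟎 ∷ 𝟎 ∷ (𝟎 ⟶ 𝟏) ∷ (𝟎 ⟶ 𝟏) ∷ 𝟎 ∷ (𝟏 ⟶ 𝟎) ∷ [])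
tagsᵖ = x₀ ≺ x₇ ⇒ (x₈ · (x₅ · x₀) ≐ x₃) ⇒
  (x₂ ≤ℚᵖ x₆ · x₀ · (x₄ +ᵖ x₇) ⊕ᵖ x₁) ∧̇ (x₆ · (x₀ +ᵖ 1ᵖ) · (x₄ +ᵖ x₇) ≤ℚᵖ x₂ ⊕ᵖ x₁)

-- All intervals tagged by a point with Y-value m lie between τ − α and τ + α.
Tags : ∀ {Γ} → Tm Γ (𝟏 ⟶ 𝟎) → Tm Γ 𝟎 → Tm Γ (𝟎 ⟶ 𝟏) → Tm Γ (𝟎 ⟶ 𝟏) → Tm Γ 𝟎 → Tm Γ 𝟎 → Tm Γ 𝟎 → Tm Γ 𝟎 → Fm Γ
Tags Y k x t n m τ α = ⟪ ∀[ 𝟎 ] tagsᵖ ⟫ (∅ ▸ Y ▸ k ▸ x ▸ t ▸ n ▸ m ▸ τ ▸ α)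

Invᵖ : ∀ {Γ} → Tp Γ 𝟎 → Tp Γ 𝟎 → Tp Γ 𝟎 → Tp Γ 𝟎 → Tp Γ 𝟎 → Tp Γ 𝟎 → Fp Γ
Invᵖ g₁ g₀ τ α p e = (g₁ ≤ℚᵖ g₀ ⊕ᵖ (α ⊕ᵖ α) ⊕ᵖ e) ∧̇ ((g₁ ≤ℚᵖ g₀ ⊕ᵖ e) ∨̇ (g₁ ⊕ᵖ τ ≤ℚᵖ g₀ ⊕ᵖ p ⊕ᵖ α ⊕ᵖ e))

InvAt : ∀ {Γ} → Tm Γ (𝟏 ⟶ 𝟎) → Tm Γ 𝟎 → Tm Γ (𝟎 ⟶ 𝟏) → Tm Γ (𝟎 ⟶ 𝟏) → Tm Γ 𝟎 → Tm Γ 𝟎 → Tm Γ 𝟎 → Tm Γ 𝟎 → Tm Γ 𝟎 → Fm Γ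
InvAt Y k x t n m τ α j = Inv (stepSum Y (m +̇ 1̇) k x t n j) (stepSum Y m k x t n j) τ α (x · j · (n +̇ k)) (frac (8̇ *̇ j) (n +̇ k))

module _ {Γ} {H : List (Fm Γ)} {Y : Tm Γ (𝟏 ⟶ 𝟎)} {k : Tm Γ 𝟎} {x t : Tm Γ (𝟎 ⟶ 𝟏)} {n m τ α : Tm Γ 𝟎} where

  -- Trichotomy of the Y-value of the tag against m: below m both sums take the interval, at m only
  -- the sum of f_(m+1) does, and above m neither does.
  InvAt-suc : H ⊢ TaggedPartition k x t → H ⊢ Tags Y k x t n m τ α → ∀ {j} → H ⊢ j ≼ k ⇒ InvAt Y k x t n m τ α j →
              H ⊢ j +̇ 1̇ ≼ k → H ⊢ InvAt Y k x t n m τ α (j +̇ 1̇)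
  InvAt-suc P A {j} ih h = ∨-elim (ax (<-total y m))
    (Inv-same (w ih′) (gap-close (w P) (w j≺k) l _ _) (Partition.x≤x-4 (w P) (w j≺k) l) (0≤frac 4̇ l)
      (≈⇒≥ (frac-+ 4̇ 4̇ l)) (≈⇒≥ (frac-8*suc j l))
      (≈⇒≤ (stepSum-on Y (m +̇ 1̇) k x t n j (≺-trans h₀ (≺-suc m)))) (≈⇒≥ (stepSum-on Y m k x t n j h₀)))
    (∨-elim h₀
      (Inv-on (w (w ih′)) (∧-elim₁ at) (∧-elim₂ at)
        (gap-upper (w (w P)) (w (w j≺k)) l _) (frac-2≤8 l) (≈⇒≥ (frac-8*suc j l))
        (≈⇒≤ (stepSum-on Y (m +̇ 1̇) k x t n j (≺-resp (≐-sym h₀) (=-refl _) (≺-suc m))))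
        (≈⇒≥ (stepSum-off Y m k x t n j (≐⇒≼ (≐-sym h₀)))))
      (Inv-same (w (w ih′)) (0≤frac′) (Partition.x≤x-4 (w (w P)) (w (w j≺k)) l) (0≤frac 4̇ l)
        (≈⇒≥ (frac-+ 4̇ 4̇ l)) (≈⇒≥ (frac-8*suc j l))
        (≈⇒≤ (≈-trans (stepSum-off Y (m +̇ 1̇) k x t n j (≺⇒suc≼ h₀)) (≈-sym (⊕-identityʳ _))))
        (≈⇒≤ (≈-trans (⊕-identityʳ _) (≈-sym (stepSum-off Y m k x t n j (≺⇒≼ h₀)))))))
    where
    y = Y · (t · j)
    l = n +̇ k
    j≺k : H ⊢ j ≺ k
    j≺k = suc≼⇒≺ h
    ih′ = ⇒-elim ih (≺⇒≼ j≺k)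
    0≤frac′ : ∀ {K : List (Fm Γ)} → K ⊢ 0ℚ ≤ℚ 0ℚ ⊕ frac 4̇ l
    0≤frac′ = ≤-⊕-frac 0ℚ 4̇ l
    at : (y ≐ m) ∷ (y ≐ m ∨̇ m ≺ y) ∷ H ⊢ τ ≤ℚ x · j · l ⊕ α ∧̇ x · (j +̇ 1̇) · l ≤ℚ τ ⊕ α
    at = ⇒-elim (⇒-elim (w (w (∀E (∅ ▸ Y ▸ k ▸ x ▸ t ▸ n ▸ m ▸ τ ▸ α) tagsᵖ A j))) (w (w j≺k))) h₀

Tags-↑ : ∀ {Γ σ} {H : List (Fm Γ)} {Y k x t n m τ α} → H ⊢ Tags Y k x t n m τ α →
         map (↑ᶠ_ {σ = σ}) H ⊢ Tags (↑ Y) (↑ k) (↑ x) (↑ t) (↑ n) (↑ m) (↑ τ) (↑ α)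
Tags-↑ {Y = Y} {k} {x} {t} {n} {m} {τ} {α} = ↑E (∅ ▸ Y ▸ k ▸ x ▸ t ▸ n ▸ m ▸ τ ▸ α) (∀[ 𝟎 ] tagsᵖ)

module _ {Γ} {H : List (Fm Γ)} {Y : Tm Γ (𝟏 ⟶ 𝟎)} {k : Tm Γ 𝟎} {x t : Tm Γ (𝟎 ⟶ 𝟏)} {n m τ α : Tm Γ 𝟎} where

  -- `Tags` is universally quantified and remains a hypothesis. The induction formula consists of j
  -- ≤ k and the inequalities of `Inv`, with τ and α as parameters. The premise α ≥ 0 serves the
  -- empty sum.
  inv : H ⊢ TaggedPartition k x t → H ⊢ Tags Y k x t n m τ α → H ⊢ 0ℚ ≤ℚ α →
        ∀ j → H ⊢ j ≼ k → H ⊢ InvAt Y k x t n m τ α j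
  inv P A α≥0 j = ⇒-elim (IND (∅ ▸ Y ▸ k ▸ x ▸ t ▸ n ▸ m ▸ τ ▸ α)
    ((x₀ ≼ᵖ x₇) ⇒ Invᵖ (stepSumᵖ x₈ (x₃ +ᵖ 1ᵖ) x₇ x₆ x₅ x₄ x₀) (stepSumᵖ x₈ x₃ x₇ x₆ x₅ x₄ x₀) x₂ x₁
      (x₆ · x₀ · (x₄ +ᵖ x₇)) (fracᵖ (8ᵖ *ᵖ x₀) (x₄ +ᵖ x₇)))
    (imp (or lt eq) (and (or lt eq) (or (or lt eq) (or lt eq))))
    (⇒-intro (w base)) (⇒-intro (InvAt-suc (w (w (TaggedPartition-↑ P))) (w (w (Tags-↑ A))) h₁ h₀)) j)
    where
    zeros : ∀ {m m′} → H ⊢ stepSum Y m k x t n 0̇ ≤ℚ stepSum Y m′ k x t n 0̇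
    zeros = ≤ℚ-trans (≈⇒≤ (Sum-zero _ k x t n)) (≈⇒≥ (Sum-zero _ k x t n))
    base : H ⊢ InvAt Y k x t n m τ α 0̇
    base = ∧-intro
      (≤ℚ-trans (≤-lin (⊕-mono zeros (⊕-mono α≥0 α≥0))
        (ℚ-solve 3 (λ g g′ a → g :⊕ (g′ :⊕ (a :⊕ a)) ⊜ (g′ :⊕ (a :⊕ a)) :⊕ (g :⊕ (:0 :⊕ :0))) ≈-refl _ _ _)) (≤-⊕-frac _ _ _))
      (∨-intro₁ (≤ℚ-trans zeros (≤-⊕-frac _ _ _)))

Injᵖ : Fp ((𝟏 ⟶ 𝟎) ∷ [])
Injᵖ = ∀[ 𝟏 ] ∀[ 𝟏 ] (x₁ ∈Iᵖ ⇒ x₀ ∈Iᵖ ⇒ (x₂ · x₁ ≐ x₂ · x₀) ⇒ x₁ =ᴿᵖ x₀)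

Inj : ∀ {Γ} → Tm Γ (𝟏 ⟶ 𝟎) → Fm Γ
Inj Y = ⟪ Injᵖ ⟫ (∅ ▸ Y)

inj-at : ∀ {Γ} {H : List (Fm Γ)} {Y u v} → H ⊢ Inj Y → H ⊢ InI u → H ⊢ InI v → H ⊢ Y · u ≐ Y · v → H ⊢ u =ᴿ v
inj-at {Y = Y} {u} {v} I a b e = ⇒-elim (⇒-elim (⇒-elim
  (∀E (∅ ▸ Y ▸ u) (x₁ ∈Iᵖ ⇒ x₀ ∈Iᵖ ⇒ (x₂ · x₁ ≐ x₂ · x₀) ⇒ x₁ =ᴿᵖ x₀)
    (∀E (∅ ▸ Y) (∀[ 𝟏 ] (x₁ ∈Iᵖ ⇒ x₀ ∈Iᵖ ⇒ (x₂ · x₁ ≐ x₂ · x₀) ⇒ x₁ =ᴿᵖ x₀)) I u) v) a) b) e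

module _ {Γ} {H : List (Fm Γ)} {Y : Tm Γ (𝟏 ⟶ 𝟎)} {k : Tm Γ 𝟎} {x t : Tm Γ (𝟎 ⟶ 𝟏)} {n′ : Tm Γ 𝟎} where

  -- By injectivity the tags t_j and t_p are equal reals, and the interval of t_j is shorter than
  -- the mesh. The equality, the order of tag and partition point, and the mesh each have tolerance
  -- 2·2^-l; the total 6·2^-l is rounded up to 8·2^-l.
  tags-body : H ⊢ TaggedPartition k x t → H ⊢ Mesh k x n′ → H ⊢ Inj Y → ∀ l {j p} → H ⊢ j ≺ k → H ⊢ p ≺ k →
              H ⊢ Y · (t · j) ≐ Y · (t · p) →
              H ⊢ t · p · l ≤ℚ x · j · l ⊕ (frac 1̇ n′ ⊕ frac 8̇ l) ∧̇ x · (j +̇ 1̇) · l ≤ℚ t · p · l ⊕ (frac 1̇ n′ ⊕ frac 8̇ l)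
  tags-body P M I l {j} {p} hj hp e = ∧-intro
    (≤-lin (⊕-mono (∣⊖∣-elimʳ close) (⊕-mono (t≤x hj l) (⊕-mono (mesh M hj l) slack)))
      (ℚ-solve 7 (λ tp tj xj xj′ μ f g → tp :⊕ ((tj :⊕ f) :⊕ ((xj′ :⊕ f) :⊕ ((xj :⊕ (μ :⊕ f)) :⊕ g)))
        ⊜ (xj :⊕ (μ :⊕ g)) :⊕ (tp :⊕ (tj :⊕ (xj′ :⊕ ((f :⊕ f) :⊕ f))))) ≈-refl
        (t · p · l) (t · j · l) (x · j · l) (x · (j +̇ 1̇) · l) (frac 1̇ n′) (frac 2̇ l) (frac 8̇ l)))
    (≤-lin (⊕-mono (mesh M hj l) (⊕-mono (x≤t hj l) (⊕-mono (∣⊖∣-elimˡ close) slack)))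
      (ℚ-solve 7 (λ tp tj xj xj′ μ f g → xj′ :⊕ ((xj :⊕ (μ :⊕ f)) :⊕ ((tj :⊕ f) :⊕ ((tp :⊕ f) :⊕ g)))
        ⊜ (tp :⊕ (μ :⊕ g)) :⊕ (xj′ :⊕ (xj :⊕ (tj :⊕ ((f :⊕ f) :⊕ f))))) ≈-refl
        (t · p · l) (t · j · l) (x · j · l) (x · (j +̇ 1̇) · l) (frac 1̇ n′) (frac 2̇ l) (frac 8̇ l)))
    where
    open Partition P
    close = =ᴿ-at (∅ ▸ t · j ▸ t · p) x₁ x₀ (inj-at I (t∈I P hj) (t∈I P hp) e) l
    slack : H ⊢ frac 2̇ l ⊕ frac 2̇ l ⊕ frac 2̇ l ≤ℚ frac 8̇ l
    slack = ≤ℚ-trans (⊕-mono (frac-2+2 l) (frac-2≤4 l)) (≈⇒≥ (frac-+ 4̇ 4̇ l))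

Mesh-↑ : ∀ {Γ σ} {H : List (Fm Γ)} {k x n} → H ⊢ Mesh k x n → map (↑ᶠ_ {σ = σ}) H ⊢ Mesh (↑ k) (↑ x) (↑ n)
Mesh-↑ {k = k} {x} {n} = ↑E (∅ ▸ k ▸ x ▸ n) (Meshᵖ x₂ x₁ x₀)

Inj-↑ : ∀ {Γ σ} {H : List (Fm Γ)} {Y} → H ⊢ Inj Y → map (↑ᶠ_ {σ = σ}) H ⊢ Inj (↑ Y)
Inj-↑ {Y = Y} = ↑E (∅ ▸ Y) Injᵖ

width : ∀ {Γ} → Tm Γ 𝟎 → Tm Γ 𝟎 → Tm Γ 𝟎
width n′ l = frac 1̇ n′ ⊕ frac 8̇ l

increment : ∀ {Γ} → Tm Γ 𝟎 → Tm Γ 𝟎 → Tm Γ 𝟎 → Tm Γ 𝟎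
increment k n′ l = (width n′ l ⊕ width n′ l) ⊕ frac (8̇ *̇ k) l

module _ {Γ} {H : List (Fm Γ)} {Y : Tm Γ (𝟏 ⟶ 𝟎)} {k : Tm Γ 𝟎} {x t : Tm Γ (𝟎 ⟶ 𝟏)} {n′ : Tm Γ 𝟎} where

  tags-near : H ⊢ TaggedPartition k x t → H ⊢ Mesh k x n′ → H ⊢ Inj Y → ∀ n m {p} → H ⊢ p ≺ k →
              H ⊢ Y · (t · p) ≐ m → H ⊢ Tags Y k x t n m (t · p · (n +̇ k)) (width n′ (n +̇ k))
  -- `width` contains the opaque `frac`, so its weakening under the quantifier of `Tags` has to be
  -- rewritten by `eval-↑`.
  tags-near P M I n m {p} hp e = ∀-intro (⇒-intro (⇒-intro (subst
    (λ α → (↑ Y · (↑ t · v₀) ≐ ↑ m) ∷ (v₀ ≺ ↑ k) ∷ map ↑ᶠ_ H ⊢ ↑ t · ↑ p · (↑ n +̇ ↑ k) ≤ℚ ↑ x · v₀ · (↑ n +̇ ↑ k) ⊕ α ∧̇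
               ↑ x · (v₀ +̇ 1̇) · (↑ n +̇ ↑ k) ≤ℚ ↑ t · ↑ p · (↑ n +̇ ↑ k) ⊕ α)
    (sym (eval-↑ (∅ ▸ n′ ▸ n ▸ k) (fracᵖ 1ᵖ x₂ ⊕ᵖ fracᵖ 8ᵖ (x₁ +ᵖ x₀))))
    (tags-body (w (w (TaggedPartition-↑ P))) (w (w (Mesh-↑ M))) (w (w (Inj-↑ I))) (↑ n +̇ ↑ k) h₁ (w (w (≺-↑ hp)))
      (≐-trans h₀ (≐-sym (w (w (↑E (∅ ▸ Y ▸ t ▸ p ▸ m) (x₃ · (x₂ · x₁) ≐ x₀) e)))))))))

  tags-none : ∀ n m τ α → H ⊢ ⟪ (∃[ 𝟎 ] ((x₀ ≺ x₃) ∧̇ (x₄ · (x₂ · x₀) ≐ x₁))) ⇒ ⊥̇ ⟫ (∅ ▸ Y ▸ k ▸ t ▸ m) →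
              H ⊢ Tags Y k x t n m τ α
  tags-none n m τ α d = ∀-intro (⇒-intro (⇒-intro (⊥-elimᵈ (⇒-elim
    (w (w (↑E (∅ ▸ Y ▸ k ▸ t ▸ m) ((∃[ 𝟎 ] ((x₀ ≺ x₃) ∧̇ (x₄ · (x₂ · x₀) ≐ x₁))) ⇒ ⊥̇) d)))
    (∃I (⇑ (∅ ▸ Y ▸ k ▸ t ▸ m)) ((x₀ ≺ x₃) ∧̇ (x₄ · (x₂ · x₀) ≐ x₁)) v₀ (∧-intro h₁ h₀))))))

  0≤width : ∀ l → H ⊢ 0ℚ ≤ℚ width n′ l
  0≤width l = ≤ℚ-trans (0≤frac 1̇ n′) (≤-⊕-frac _ 8̇ l)

module _ {Γ} {H : List (Fm Γ)} {Y : Tm Γ (𝟏 ⟶ 𝟎)} {k : Tm Γ 𝟎} {x t : Tm Γ (𝟎 ⟶ 𝟏)} {n′ : Tm Γ 𝟎} where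

  inv⇒increment : ∀ {n m τ} → H ⊢ TaggedPartition k x t → H ⊢ Tags Y k x t n m τ (width n′ (n +̇ k)) →
    H ⊢ stepSum Y (m +̇ 1̇) k x t n k ≤ℚ stepSum Y m k x t n k ⊕ increment k n′ (n +̇ k)
  inv⇒increment {n} P A = ≤ℚ-trans (∧-elim₁ (inv P A (0≤width {Y = Y} {k} {x} {t} {n′} (n +̇ k)) k ≼-refl)) (≈⇒≤ (⊕-assoc _ _ _))

module _ {Γ} {H : List (Fm Γ)} {Y : Tm Γ (𝟏 ⟶ 𝟎)} {k : Tm Γ 𝟎} {x t : Tm Γ (𝟎 ⟶ 𝟏)} {n′ : Tm Γ 𝟎} where

  -- The case distinction on the existence of a tag with value m is made here, outside both
  -- induction formulas: the inner induction is run with τ already fixed, and the outer one uses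
  -- only the resulting inequality.
  stepSum-suc : H ⊢ TaggedPartition k x t → H ⊢ Mesh k x n′ → H ⊢ Inj Y → ∀ n m →
    H ⊢ stepSum Y (m +̇ 1̇) k x t n k ≤ℚ stepSum Y m k x t n k ⊕ increment k n′ (n +̇ k)
  stepSum-suc P M I n m = by-cases D
    (∃E (∅ ▸ Y ▸ k ▸ x ▸ t ▸ n ▸ m ▸ n′)
      (stepSumᵖ x₆ (x₁ +ᵖ 1ᵖ) x₅ x₄ x₃ x₂ x₅ ≤ℚᵖ stepSumᵖ x₆ x₁ x₅ x₄ x₃ x₂ x₅ ⊕ᵖ incrementᵖ x₅ x₀ (x₂ +ᵖ x₅))
      h₀ witnessed)
    -- Without such a tag `Tags` holds vacuously, so 0 can serve as τ.
    (inv⇒increment {Y = Y} {k} {x} {t} {n′} {n} {m} {0ℚ} (w P) (tags-none {n′ = n′} n m 0ℚ (width n′ (n +̇ k)) h₀))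
    where
    φ : Fp (𝟎 ∷ 𝟎 ∷ (𝟎 ⟶ 𝟏) ∷ 𝟎 ∷ (𝟏 ⟶ 𝟎) ∷ [])
    φ = (x₀ ≺ x₃) ∧̇ (x₄ · (x₂ · x₀) ≐ x₁)
    s = ∅ ▸ Y ▸ k ▸ t ▸ m
    D : Fm Γ
    D = ⟪ ∃[ 𝟎 ] φ ⟫ s
    H′ : List (Fm (𝟎 ∷ Γ))
    H′ = ⟪ φ ⟫ (lift s) ∷ map ↑ᶠ_ (D ∷ H)
    tagged : H′ ⊢ TaggedPartition (↑ k) (↑ x) (↑ t)
    tagged = w (TaggedPartition-↑ {H = D ∷ H} (w P))
    near′ : H′ ⊢ Tags (↑ Y) (↑ k) (↑ x) (↑ t) (↑ n) (↑ m) (↑ t · v₀ · (↑ n +̇ ↑ k)) (width (↑ n′) (↑ n +̇ ↑ k))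
    near′ = tags-near tagged (w (Mesh-↑ {H = D ∷ H} (w M))) (w (Inj-↑ {H = D ∷ H} (w I))) (↑ n) (↑ m) (∧-elim₁ h₀) (∧-elim₂ h₀)
    witnessed : H′ ⊢ stepSum (↑ Y) (↑ m +̇ 1̇) (↑ k) (↑ x) (↑ t) (↑ n) (↑ k) ≤ℚ
                     stepSum (↑ Y) (↑ m) (↑ k) (↑ x) (↑ t) (↑ n) (↑ k) ⊕ increment (↑ k) (↑ n′) (↑ n +̇ ↑ k)
    witnessed = inv⇒increment tagged near′
    incrementᵖ : ∀ {Θ} → Tp Θ 𝟎 → Tp Θ 𝟎 → Tp Θ 𝟎 → Tp Θ 𝟎
    incrementᵖ k n′ l = ((fracᵖ 1ᵖ n′ ⊕ᵖ fracᵖ 8ᵖ l) ⊕ᵖ (fracᵖ 1ᵖ n′ ⊕ᵖ fracᵖ 8ᵖ l)) ⊕ᵖ fracᵖ (8ᵖ *ᵖ k) l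

module _ {Γ} {H : List (Fm Γ)} {Y : Tm Γ (𝟏 ⟶ 𝟎)} {k : Tm Γ 𝟎} {x t : Tm Γ (𝟎 ⟶ 𝟏)} {n′ : Tm Γ 𝟎} where

  -- Each value contributes twice the width and 8k·2^-l, that is 2·2^-n′ from the mesh and (8k +
  -- 16)·2^-l from the precision l = n + k.
  stepSum-upper : H ⊢ TaggedPartition k x t → H ⊢ Mesh k x n′ → H ⊢ Inj Y → ∀ n m →
    H ⊢ stepSum Y m k x t n k ≤ℚ frac (2̇ *̇ m) n′ ⊕ frac (m *̇ (8̇ *̇ k +̇ (8̇ +̇ 8̇))) (n +̇ k)
  stepSum-upper P M I n = IND (∅ ▸ Y ▸ k ▸ x ▸ t ▸ n′ ▸ n)
    (stepSumᵖ x₆ x₀ x₅ x₄ x₃ x₁ x₅ ≤ℚᵖ fracᵖ (2ᵖ *ᵖ x₀) x₂ ⊕ᵖ fracᵖ (x₀ *ᵖ (8ᵖ *ᵖ x₅ +ᵖ (8ᵖ +ᵖ 8ᵖ))) (x₁ +ᵖ x₅)) (or lt eq)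
    (≤ℚ-trans (stepSum-zero Y n k) (≤ℚ-trans (0≤frac (2̇ *̇ 0̇) n′) (≤-⊕-frac _ _ _)))
    (step (w (TaggedPartition-↑ P)) (w (Mesh-↑ M)) (w (Inj-↑ I)) h₀)
    where
    step : ∀ {Δ} {K : List (Fm Δ)} {Y k x t n n′ m} → K ⊢ TaggedPartition k x t → K ⊢ Mesh k x n′ → K ⊢ Inj Y →
           K ⊢ stepSum Y m k x t n k ≤ℚ frac (2̇ *̇ m) n′ ⊕ frac (m *̇ (8̇ *̇ k +̇ (8̇ +̇ 8̇))) (n +̇ k) →
           K ⊢ stepSum Y (m +̇ 1̇) k x t n k ≤ℚ
               frac (2̇ *̇ (m +̇ 1̇)) n′ ⊕ frac ((m +̇ 1̇) *̇ (8̇ *̇ k +̇ (8̇ +̇ 8̇))) (n +̇ k)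
    step {K = K} {Y} {k} {x} {t} {n} {n′} {m} P M I ih = ≤-lin
      (⊕-mono (stepSum-suc P M I n m) (⊕-mono ih (⊕-mono (≈⇒≥ a) (⊕-mono (≈⇒≥ b) (⊕-mono (≈⇒≥ (frac-+ 1̇ 1̇ n′))
        (⊕-mono (≈⇒≥ (frac-+ (8̇ *̇ k) (8̇ +̇ 8̇) l)) (≈⇒≥ (frac-+ 8̇ 8̇ l))))))))
      (ℚ-solve 12 (λ g g′ A A′ B B′ μ μ2 ε8 ε16 ek e →
        g′ :⊕ ((g :⊕ (((μ :⊕ ε8) :⊕ (μ :⊕ ε8)) :⊕ ek)) :⊕ ((A :⊕ B) :⊕ (A′ :⊕ (B′ :⊕ (μ2 :⊕ (e :⊕ ε16))))))
        ⊜ (A′ :⊕ B′) :⊕ (g′ :⊕ (g :⊕ ((A :⊕ μ2) :⊕ ((B :⊕ e) :⊕ ((μ :⊕ μ) :⊕ ((ek :⊕ ε16) :⊕ (ε8 :⊕ ε8)))))))) ≈-refl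
        (stepSum Y m k x t n k) (stepSum Y (m +̇ 1̇) k x t n k)
        (frac (2̇ *̇ m) n′) (frac (2̇ *̇ (m +̇ 1̇)) n′) (frac (m *̇ c) l) (frac ((m +̇ 1̇) *̇ c) l)
        (frac 1̇ n′) (frac 2̇ n′) (frac 8̇ l) (frac (8̇ +̇ 8̇) l) (frac (8̇ *̇ k) l) (frac c l))
      where
      l = n +̇ k
      c = 8̇ *̇ k +̇ (8̇ +̇ 8̇)
      a : K ⊢ frac (2̇ *̇ (m +̇ 1̇)) n′ ≈ frac (2̇ *̇ m) n′ ⊕ frac 2̇ n′
      a = ≈-trans (frac-cong n′ (≐-trans (ax (distrib 2̇ m 1̇)) (+-cong (=-refl _) (ax (*-one 2̇))))) (frac-+ (2̇ *̇ m) 2̇ n′)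
      b : K ⊢ frac ((m +̇ 1̇) *̇ c) l ≈ frac (m *̇ c) l ⊕ frac c l
      b = ≈-trans (frac-cong l (solve 2 (λ m c → (m :+ :con 1) :* c := m :* c :+ c) (=-refl _) m c)) (frac-+ (m *̇ c) c l)

-- Choice of precision and mesh.

3̇ : ∀ {Γ} → Tm Γ 𝟎
3̇ = 1̇ +̇ 1̇ +̇ 1̇

-- The index at which the Riemann sums of f_n are compared with the integral,
-- and the mesh required, for an error below 2^{-m}.
index fineness : ∀ {Γ} → Tm Γ 𝟎 → Tm Γ 𝟎 → Tm Γ 𝟎
index m n = (m +̇ 3̇) +̇ (n +̇ 3̇)
fineness m n = (m +̇ 3̇) +̇ (n +̇ 1̇)

module _ {Γ} {H : List (Fm Γ)} where

  frac≤frac1 : ∀ {c} l b → H ⊢ c ≼ pow2 b → H ⊢ frac c (l +̇ b) ≤ℚ frac 1̇ l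
  frac≤frac1 l b h = ≤ℚ-trans (frac-monoˡ (l +̇ b)
    (≼-resp (=-refl _) (solve 1 (λ p → p := :con 1 :* p) (=-refl _) (pow2 b)) h)) (≈⇒≤ (frac-scale 1̇ l b))

  index-small : ∀ m n → H ⊢ frac 2̇ (index m n) ≤ℚ frac 1̇ (m +̇ 3̇)
  index-small m n = frac≤frac1 (m +̇ 3̇) (n +̇ 3̇) (≼-trans
    (≼-lin (0≼ (n +̇ 1̇ +̇ 1̇)) (solve 1 (λ n → :con 1 :+ :con 1 :+ (n :+ :con 1 :+ :con 1)
      := n :+ (:con 1 :+ :con 1 :+ :con 1) :+ :con 1 :+ :con 0) (=-refl _) n))
    (suc≼pow2 (n +̇ 3̇)))

  mesh-small : ∀ m n → H ⊢ frac (2̇ *̇ n) (fineness m n) ≤ℚ frac 1̇ (m +̇ 3̇)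
  mesh-small m n = frac≤frac1 (m +̇ 3̇) (n +̇ 1̇) (≼-resp (solve 1 (λ n → n :+ n := (:con 1 :+ :con 1) :* n) (=-refl _) n)
    (≐-sym (pow2-suc n)) (+-mono-≼ n≼ n≼))
    where n≼ = ≼-trans (≺⇒≼ (≺-suc n)) (suc≼pow2 n)

  -- The precision is (m+3) + (n + (k+4)), and (n+1)·8·(k+2) ≤ 2^n·8·2^(k+1) = 2^(n+k+4). The k
  -- inside the precision compensates the k in the error.
  error-small : ∀ m n k {c} → H ⊢ c ≼ (n +̇ 1̇) *̇ (8̇ *̇ (k +̇ 1̇ +̇ 1̇)) →
                H ⊢ frac c (index m n +̇ 1̇ +̇ k) ≤ℚ frac 1̇ (m +̇ 3̇)
  error-small m n k {c} h = ≤ℚ-trans (≈⇒≤ (frac-congʳ c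
      (solve 3 (λ m n k → m :+ (:con 1 :+ :con 1 :+ :con 1) :+ (n :+ (:con 1 :+ :con 1 :+ :con 1)) :+ :con 1 :+ k
        := m :+ (:con 1 :+ :con 1 :+ :con 1) :+ (n :+ (k :+ :con 1 :+ :con 1 :+ :con 1 :+ :con 1))) (=-refl _) m n k)))
    (frac≤frac1 (m +̇ 3̇) (n +̇ (k +̇ 1̇ +̇ 1̇ +̇ 1̇ +̇ 1̇)) (≼-trans h (≼-resp (=-refl _) (≐-sym (pow2-+ n _))
      (*-mono-≼ (suc≼pow2 n) (≼-resp (=-refl _) (≐-sym pow8) (*-mono-≼ ≼-refl (suc≼pow2 (k +̇ 1̇))))))))
    where
    pow8 : H ⊢ pow2 (k +̇ 1̇ +̇ 1̇ +̇ 1̇ +̇ 1̇) ≐ 8̇ *̇ pow2 (k +̇ 1̇)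
    pow8 = ≐-trans (pow2-suc _) (≐-trans (+-cong e₂ e₂)
      (solve 1 (λ p → (p :+ p) :+ (p :+ p) :+ ((p :+ p) :+ (p :+ p)) :=
         (:con 1 :+ :con 1 :+ (:con 1 :+ :con 1) :+ (:con 1 :+ :con 1 :+ (:con 1 :+ :con 1))) :* p) (=-refl _) (pow2 (k +̇ 1̇))))
      where
      e₂ = ≐-trans (pow2-suc (k +̇ 1̇ +̇ 1̇)) (+-cong (pow2-suc (k +̇ 1̇)) (pow2-suc (k +̇ 1̇)))

  -- At most three errors of size 2^-(m+3) arise: from the mesh, from the precision of the sum, and
  -- from the tolerance in ≤ on reals. As 3 < 8, they stay below 2^-m.
  three-eighths : ∀ m {q} → H ⊢ q ≤ℚ frac 1̇ (m +̇ 3̇) ⊕ frac 1̇ (m +̇ 3̇) ⊕ frac 1̇ (m +̇ 3̇) → H ⊢ q <ℚ frac 1̇ m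
  three-eighths m {q} h = ∨-elim (<ℚ-or-≥ℚ q (frac 1̇ m)) h₀ (≺-irrefl (≺-≼-trans
    (≺-resp (=-refl _) (≐-sym (≐-trans (ax (*-comm 1̇ _)) (≐-trans (ax (*-one _)) pow8))) small)
    (frac-≤-elim (≤ℚ-trans h₀ (w (≤ℚ-trans h (≤ℚ-trans (⊕-mono (≈⇒≥ (frac-+ 1̇ 1̇ (m +̇ 3̇))) ≤ℚ-refl) (≈⇒≥ (frac-+ 2̇ 1̇ (m +̇ 3̇))))))))))
    where
    p = pow2 m
    pow8 : ∀ {K : List (Fm Γ)} → K ⊢ pow2 (m +̇ 3̇) ≐ (p +̇ p +̇ (p +̇ p)) +̇ (p +̇ p +̇ (p +̇ p))
    pow8 = ≐-trans (Eq-·ʳ pow2ᵗ (solve 1 (λ m → m :+ (:con 1 :+ :con 1 :+ :con 1) := m :+ :con 1 :+ :con 1 :+ :con 1) (=-refl _) m))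
      (≐-trans (pow2-suc _) (+-cong e₂ e₂))
      where
      e₂ : ∀ {K : List (Fm Γ)} → K ⊢ pow2 (m +̇ 1̇ +̇ 1̇) ≐ p +̇ p +̇ (p +̇ p)
      e₂ = ≐-trans (pow2-suc (m +̇ 1̇)) (+-cong (pow2-suc m) (pow2-suc m))
    small : ∀ {K : List (Fm Γ)} → K ⊢ (2̇ +̇ 1̇) *̇ p ≺ (p +̇ p +̇ (p +̇ p)) +̇ (p +̇ p +̇ (p +̇ p))
    small = ≺-≼-trans (≺-lin (0≺pow2 m) (solve 1 (λ p → (:con 1 :+ :con 1 :+ :con 1) :* p :+ p
        := (p :+ p :+ (p :+ p)) :+ :con 0) (=-refl _) p)) (≼-+ʳ _ _)

module _ {Γ} {H : List (Fm Γ)} {k : Tm Γ 𝟎} {x t : Tm Γ (𝟎 ⟶ 𝟏)} where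

  oneF-close : H ⊢ TaggedPartition k x t → ∀ m →
               H ⊢ ⟪ absᴿᵖ · (subᴿᵖ · riemannSumᵖ oneFᵖ x₃ x₂ x₁ · (natᴿᵖ · 1ᵖ)) <ᴿᵖ 2⁻ᴿᵖ · x₀ ⟫ (∅ ▸ k ▸ x ▸ t ▸ m)
  oneF-close P m = ∣−∣<2⁻-intro (∅ ▸ k ▸ x ▸ t ▸ m) (riemannSumᵖ oneFᵖ x₃ x₂ x₁) (natᴿᵖ · 1ᵖ) x₀ {δ} N
    (≤ℚ-trans (≈⇒≤ (≐⇒≈ at)) (≤ℚ-trans
      (≤-lin (⊕-mono (∧-elim₁ tel) (⊕-mono (x-end-upper l) (⊕-mono (x-start-lower l) (⊕-mono (frac-2+2 l) (≈⇒≥ (frac-+ (8̇ *̇ k) 4̇ l))))))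
        (ℚ-solve 8 (λ S a z u e f g d → S :⊕ ((z :⊕ e) :⊕ ((u :⊕ f) :⊕ ((a :⊕ f) :⊕ (g :⊕ d))))
          ⊜ (u :⊕ d) :⊕ ((S :⊕ a) :⊕ (z :⊕ (:0 :⊕ ((f :⊕ f) :⊕ (e :⊕ g)))))) ≈-refl
          S (x · 0̇ · l) (x · k · l) (natᵒ · 1̇) (frac (8̇ *̇ k) l) (frac 2̇ l) (frac 4̇ l) δ))
      (⊕-mono (≈⇒≥ (≐⇒≈ (natᴿ-def 1̇ _))) ≤ℚ-refl)))
    (≤ℚ-trans (≈⇒≤ (≐⇒≈ (natᴿ-def 1̇ _))) (≤ℚ-trans
      (≤-lin (⊕-mono (∧-elim₂ tel) (⊕-mono (x-end-lower l) (⊕-mono (x-start-upper l) (⊕-mono (frac-2+2 l) (≈⇒≥ (frac-+ (8̇ *̇ k) 4̇ l))))))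
        (ℚ-solve 8 (λ S a z u e f g d → u :⊕ (((S :⊕ a) :⊕ e) :⊕ ((z :⊕ f) :⊕ ((:0 :⊕ f) :⊕ (g :⊕ d))))
          ⊜ (S :⊕ d) :⊕ (z :⊕ (u :⊕ (a :⊕ ((f :⊕ f) :⊕ (e :⊕ g)))))) ≈-refl
          S (x · 0̇ · l) (x · k · l) (natᵒ · 1̇) (frac (8̇ *̇ k) l) (frac 2̇ l) (frac 4̇ l) δ))
      (⊕-mono (≈⇒≥ (≐⇒≈ at)) ≤ℚ-refl)))
    (three-eighths m (≤ℚ-trans (⊕-mono (error-small m 0̇ k bound) (index-small m 0̇)) (≤-⊕-frac _ _ _)))
    where
    open Partition P
    N l δ S : Tm Γ 𝟎
    N = index m 0̇
    l = N +̇ 1̇ +̇ k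
    -- 8 for each interval from `telescope`, and 2 for each end point of the partition.
    δ = frac (8̇ *̇ k +̇ 4̇) l
    S = Sum oneF k x t (N +̇ 1̇) k
    tel = telescope P (N +̇ 1̇) k ≼-refl
    at : H ⊢ riemannSumᵒ oneF k x t · (N +̇ 1̇) ≐ S
    at = riemannSum-at oneF k x t (N +̇ 1̇)
    bound : H ⊢ 8̇ *̇ k +̇ 4̇ ≼ (0̇ +̇ 1̇) *̇ (8̇ *̇ (k +̇ 1̇ +̇ 1̇))
    bound = ≼-lin (0≼ (8̇ +̇ 4̇)) (solve 2 (λ k i →
      ((i :+ i) :+ (i :+ i) :+ ((i :+ i) :+ (i :+ i))) :* k :+ (i :+ i :+ (i :+ i))
        :+ ((i :+ i) :+ (i :+ i) :+ ((i :+ i) :+ (i :+ i)) :+ (i :+ i :+ (i :+ i)))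
      := (:con 0 :+ :con 1) :* (((i :+ i) :+ (i :+ i) :+ ((i :+ i) :+ (i :+ i))) :* (k :+ :con 1 :+ :con 1)) :+ :con 0) (=-refl _) k 1̇)

module _ {Γ} {H : List (Fm Γ)} {Y : Tm Γ (𝟏 ⟶ 𝟎)} {k : Tm Γ 𝟎} {x t : Tm Γ (𝟎 ⟶ 𝟏)} where

  stepF-close : H ⊢ TaggedPartition k x t → ∀ m n → H ⊢ Mesh k x (fineness m n) → H ⊢ Inj Y →
    H ⊢ ⟪ absᴿᵖ · (subᴿᵖ · riemannSumᵖ (stepFᵖ x₅ · x₄) x₃ x₂ x₁ · (natᴿᵖ · 0ᵖ)) <ᴿᵖ 2⁻ᴿᵖ · x₀ ⟫
        (∅ ▸ Y ▸ n ▸ k ▸ x ▸ t ▸ m)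
  stepF-close P m n M I = ∣−∣<2⁻-intro (∅ ▸ Y ▸ n ▸ k ▸ x ▸ t ▸ m) (riemannSumᵖ (stepFᵖ x₅ · x₄) x₃ x₂ x₁) (natᴿᵖ · 0ᵖ) x₀ {δ} N
    (≤ℚ-trans (≈⇒≤ (≐⇒≈ at)) (≤ℚ-trans
      (≤-lin (⊕-mono (stepSum-upper P M I (N +̇ 1̇) n) (⊕-mono (0≤frac (8̇ *̇ k) l) (≈⇒≥ (frac-+ (n *̇ c) (8̇ *̇ k) l))))
        (ℚ-solve 5 (λ S a b e d → S :⊕ ((a :⊕ b) :⊕ (e :⊕ d)) ⊜ (:0 :⊕ (a :⊕ d)) :⊕ (S :⊕ (:0 :⊕ (b :⊕ e)))) ≈-refl
          S (frac (2̇ *̇ n) (fineness m n)) (frac (n *̇ c) l) (frac (8̇ *̇ k) l) (frac (n *̇ c +̇ 8̇ *̇ k) l)))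
      (⊕-mono (≈⇒≥ (≐⇒≈ (natᴿ-def 0̇ _))) ≤ℚ-refl)))
    (≤ℚ-trans (≈⇒≤ (≐⇒≈ (natᴿ-def 0̇ _))) (≤ℚ-trans
      (≤-lin (⊕-mono (stepSum-lower Y P n (N +̇ 1̇) k ≼-refl) (⊕-mono (0≤frac (n *̇ c) l) (⊕-mono (0≤frac (2̇ *̇ n) (fineness m n)) (≈⇒≥ (frac-+ (n *̇ c) (8̇ *̇ k) l)))))
        (ℚ-solve 5 (λ S a b e d → :0 :⊕ ((S :⊕ e) :⊕ (b :⊕ (a :⊕ d))) ⊜ (S :⊕ (a :⊕ d)) :⊕ (:0 :⊕ (:0 :⊕ (:0 :⊕ (b :⊕ e))))) ≈-refl
          S (frac (2̇ *̇ n) (fineness m n)) (frac (n *̇ c) l) (frac (8̇ *̇ k) l) (frac (n *̇ c +̇ 8̇ *̇ k) l)))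
      (⊕-mono (≈⇒≥ (≐⇒≈ at)) ≤ℚ-refl)))
    (three-eighths m (⊕-mono (⊕-mono (mesh-small m n) (error-small m n k bound)) (index-small m n)))
    where
    N c l δ S : Tm Γ 𝟎
    N = index m n
    c = 8̇ *̇ k +̇ (8̇ +̇ 8̇)
    l = N +̇ 1̇ +̇ k
    -- One bound for both sides: the mesh term and n·c come from `stepSum-upper`, and 8k comes from
    -- `stepSum-lower`.
    δ = frac (2̇ *̇ n) (fineness m n) ⊕ frac (n *̇ c +̇ 8̇ *̇ k) l
    S = stepSum Y n k x t (N +̇ 1̇) k
    at : H ⊢ riemannSumᵒ (stepF Y · n) k x t · (N +̇ 1̇) ≐ S
    at = riemannSum-at (stepF Y · n) k x t (N +̇ 1̇)
    bound : H ⊢ n *̇ c +̇ 8̇ *̇ k ≼ (n +̇ 1̇) *̇ (8̇ *̇ (k +̇ 1̇ +̇ 1̇))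
    bound = ≼-lin (0≼ (8̇ +̇ 8̇)) (solve 3 (λ n k e →
      n :* (e :* k :+ (e :+ e)) :+ e :* k :+ (e :+ e) := (n :+ :con 1) :* (e :* (k :+ :con 1 :+ :con 1)) :+ :con 0) (=-refl _) n k 8̇)

-- The hypotheses of the convergence theorem.

module _ {Γ} {H : List (Fm Γ)} where

  natᴿ-real : ∀ {Θ} (s : Sub Θ Γ) (a : Tp Θ 𝟎) → H ⊢ ⟪ IsRealᵖ (natᴿᵖ · a) ⟫ s
  natᴿ-real s a = isReal-constant s (natᴿᵖ · a) (≐-trans (natᴿ-def _ _) (≐-sym (natᴿ-def _ _)))

  oneF-integral : H ⊢ ⟪ HasIntegralᵖ oneFᵖ (natᴿᵖ · 1ᵖ) ⟫ ∅
  oneF-integral = ∧-intro (natᴿ-real ∅ 1ᵖ)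
    -- The estimate for the constant function holds for every tagged partition, so any mesh exponent
    -- serves; 0 is taken.
    (∀-intro (∃I (lift ∅) (T.SumsWithin oneFᵖ (natᴿᵖ · 1ᵖ) x₁ x₀) 0̇
      (∀-intro (∀-intro (∀-intro (⇒-intro (oneF-close (∧-elim₁ h₀) v₃)))))))

  stepF-integral : ∀ {Y} → H ⊢ Inj Y → ∀ n → H ⊢ ⟪ HasIntegralᵖ (stepFᵖ x₁ · x₀) (natᴿᵖ · 0ᵖ) ⟫ (∅ ▸ Y ▸ n)
  stepF-integral {Y} I n = ∧-intro (natᴿ-real (∅ ▸ Y ▸ n) 0ᵖ)
    (∀-intro (∃I (lift (∅ ▸ Y ▸ n)) (T.SumsWithin (stepFᵖ x₃ · x₂) (natᴿᵖ · 0ᵖ) x₁ x₀) (fineness v₀ (↑ n))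
      (∀-intro (∀-intro (∀-intro (⇒-intro
        (stepF-close (∧-elim₁ h₀) v₃ (↑ ↑ ↑ ↑ n) (∧-elim₂ h₀) (w (Inj-↑ (Inj-↑ (Inj-↑ (Inj-↑ I))))))))))))

  I→ℕ-at : ∀ {Y u v} → H ⊢ ⟪ I→ℕᵖ x₀ ⟫ (∅ ▸ Y) → H ⊢ InI u ∧̇ InI v ∧̇ u =ᴿ v → H ⊢ Y · u ≐ Y · v
  I→ℕ-at {Y} {u} {v} d e = ⇒-elim (∀E (∅ ▸ Y ▸ u) φ (∀E (∅ ▸ Y) (∀[ 𝟏 ] φ) d u) v) e
    where φ = x₁ ∈Iᵖ ∧̇ x₀ ∈Iᵖ ∧̇ x₁ =ᴿᵖ x₀ ⇒ (x₂ · x₁ ≐ x₂ · x₀)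

I→ℕ-↑ : ∀ {Γ σ} {H : List (Fm Γ)} {Y} → H ⊢ ⟪ I→ℕᵖ x₀ ⟫ (∅ ▸ Y) → map (↑ᶠ_ {σ = σ}) H ⊢ ⟪ I→ℕᵖ x₀ ⟫ (∅ ▸ ↑ Y)
I→ℕ-↑ {Y = Y} = ↑E (∅ ▸ Y) (I→ℕᵖ x₀)

module _ {Γ} {H : List (Fm Γ)} where

  oneF-I→ℝ : H ⊢ ⟪ I→ℝᵖ oneFᵖ ⟫ ∅
  oneF-I→ℝ = ∧-intro
    (∀-intro (⇒-intro (isReal-constant (∅ ▸ v₀) (oneFᵖ · x₀) (≐-trans (oneF-at _ _) (≐-sym (oneF-at _ _))))))
    (∀-intro (∀-intro (⇒-intro (=ᴿ-intro (∅ ▸ v₁ ▸ v₀) (oneFᵖ · x₁) (oneFᵖ · x₀)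
      (≐⇒≈ (≐-trans (oneF-at _ _) (≐-sym (oneF-at _ _))))))))

  stepF-I→ℝ : ∀ {Y} → H ⊢ ⟪ I→ℕᵖ x₀ ⟫ (∅ ▸ Y) → ∀ n → H ⊢ ⟪ I→ℝᵖ (stepFᵖ x₁ · x₀) ⟫ (∅ ▸ Y ▸ n)
  stepF-I→ℝ {Y} d n = ∧-intro
    (∀-intro (⇒-intro (isReal-constant (∅ ▸ ↑ Y ▸ ↑ n ▸ v₀) (stepFᵖ x₂ · x₁ · x₀)
      (≐-trans (stepF-at _ _ _ _) (≐-sym (stepF-at _ _ _ _))))))
    (∀-intro (∀-intro (⇒-intro (=ᴿ-intro (∅ ▸ ↑ ↑ Y ▸ ↑ ↑ n ▸ v₁ ▸ v₀) (stepFᵖ x₃ · x₂ · x₁) (stepFᵖ x₃ · x₂ · x₀)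
      (≐⇒≈ (≐-trans (stepF-at _ _ _ _) (≐-trans (Eq-·ʳ natᵒ (∸-cong (=-refl 1̇) (∸-cong (+-cong
        (↑E (∅ ▸ ↑ ↑ Y ▸ v₁ ▸ v₀) (x₂ · x₁ ≐ x₂ · x₀) (I→ℕ-at (w (I→ℕ-↑ (I→ℕ-↑ d))) h₀))
        (=-refl 1̇)) (=-refl _)))) (≐-sym (stepF-at _ _ _ _)))))))))

  stepF-limit : ∀ Y → H ⊢ ⟪ T.LimitOnI (stepFᵖ x₀) oneFᵖ ⟫ (∅ ▸ Y)
  stepF-limit Y = ∀-intro (⇒-intro (∀-intro
    -- From n = Y(x) + 1 on, f_n(x) is exactly 1, so the distance δ is 0.
    (∃I (∅ ▸ ↑ ↑ Y ▸ v₁ ▸ v₀) (T.CloseFrom (stepFᵖ x₃) oneFᵖ x₂ x₁ x₀) (↑ ↑ Y · v₁ +̇ 1̇)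
      (∀-intro (⇒-intro (∣−∣<2⁻-intro (∅ ▸ ↑ ↑ ↑ Y ▸ v₂ ▸ v₁ ▸ v₀) (stepFᵖ x₃ · x₀ · x₂) (oneFᵖ · x₂) x₁ {0ℚ} (index v₁ 0̇)
        (≤ℚ-trans (≈⇒≤ same) (≈⇒≥ (⊕-identityʳ _)))
        (≤ℚ-trans (≈⇒≥ same) (≈⇒≥ (⊕-identityʳ _)))
        (three-eighths v₁ (≤-lin (⊕-mono (index-small v₁ 0̇) (⊕-mono (0≤frac 1̇ (v₁ +̇ 3̇)) (0≤frac 1̇ (v₁ +̇ 3̇))))
          (ℚ-solve 2 (λ a b → (:0 :⊕ a) :⊕ (b :⊕ (b :⊕ b)) ⊜ ((b :⊕ b) :⊕ b) :⊕ (a :⊕ (:0 :⊕ :0))) ≈-refl _ _)))))))))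
    where
    same : ∀ {Δ} {K : List (Fm Δ)} {Y u n i} → (Y · u +̇ 1̇ ≼ n) ∷ K ⊢ stepF Y · n · u · i ≈ oneF · u · i
    same {Y = Y} {u} = ≐⇒≈ (≐-trans (stepF-at _ _ _ _) (≐-trans (Eq-·ʳ natᵒ (indicator-one (≺-≼-trans (≺-suc (Y · u)) h₀)))
      (≐-sym (oneF-at _ _))))

  indicator-cases : ∀ y n → H ⊢ indicator y n ≐ 1̇ ∨̇ indicator y n ≐ 0̇
  indicator-cases y n = ∨-elim (≺-or-≽ y n) (∨-intro₁ (indicator-one h₀)) (∨-intro₂ (indicator-zero h₀))

module _ {Γ} {H : List (Fm Γ)} where

  indicator≼1 : ∀ y n → H ⊢ indicator y n ≼ 1̇
  indicator≼1 y n = ∨-elim (indicator-cases y n) (≐⇒≼ h₀) (≼-trans (≐⇒≼ h₀) (0≼ 1̇))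

  natᵒ-mono : ∀ {a b} → H ⊢ a ≼ b → H ⊢ natᵒ · a ≤ℚ natᵒ · b
  natᵒ-mono h = ≤ℚ-trans (≈⇒≤ (nat-frac _)) (≤ℚ-trans (frac-monoˡ 0̇ h) (≈⇒≥ (nat-frac _)))

module _ {Γ} {H : List (Fm Γ)} where

  stepF-bounded : ∀ Y → H ⊢ ⟪ T.UniformlyBounded (stepFᵖ x₀) ⟫ (∅ ▸ Y)
  -- The bound required is M + 1, so M = 0 suffices for values 0 and 1.
  stepF-bounded Y = ∃I (∅ ▸ Y) (T.BoundedBy (stepFᵖ x₁) x₀) 0̇ (∀-intro (∀-intro (⇒-intro
    (≤ᴿ-intro (∅ ▸ ↑ ↑ Y ▸ v₁ ▸ v₀) (absᴿᵖ · (stepFᵖ x₂ · x₁ · x₀)) (natᴿᵖ · (0ᵖ +ᵖ 1ᵖ))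
      (≤ℚ-trans (≈⇒≤ (≐⇒≈ (≐-trans (absᴿ-def _ _) (Eq-·ʳ absᵒ (stepF-at _ _ _ _)))))
        (≤ℚ-trans (abs-intro (natᵒ-mono ≼1) (≤ℚ-trans (≈⇒≥ (⊕-identityʳ _)) (⊕-mono (natᵒ-mono (0≼ _)) (natᵒ-mono (0≼ _)))))
          (≤ℚ-trans (≈⇒≥ (≐⇒≈ (natᴿ-def _ _))) (≤-⊕-frac _ _ _))))))))
    where
    ≼1 : ∀ {Δ} {K : List (Fm Δ)} {y n} → K ⊢ indicator y n ≼ 0̇ +̇ 1̇
    ≼1 = ≼-trans (indicator≼1 _ _) (≐⇒≼ (solve 1 (λ i → i := :con 0 :+ i) (=-refl _) 1̇))

-- Deduction of the non-injectivity statement.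

arzBody : Fp ((𝟎 ⟶ 𝟏 ⟶ 𝟏) ∷ (𝟏 ⟶ 𝟏) ∷ [])
arzBody = T.RiemannIntegrable x₁ ∧̇ (∀[ 𝟎 ] T.RiemannIntegrable (x₁ · x₀)) ∧̇
  T.LimitOnI x₀ x₁ ∧̇ T.UniformlyBounded x₀ ⇒ T.IntegralsConverge x₀ x₁

Arzᵖ : Fp []
Arzᵖ = ∀[ 𝟏 ⟶ 𝟏 ] ∀[ 𝟎 ⟶ 𝟏 ⟶ 𝟏 ] arzBody

module _ {Γ} {H : List (Fm Γ)} where

  -- At every index |0 - 1| is at least 1, which is 2^-0.
  limits-differ : H ⊢ ⟪ absᴿᵖ · (subᴿᵖ · (natᴿᵖ · 0ᵖ) · (natᴿᵖ · 1ᵖ)) <ᴿᵖ 2⁻ᴿᵖ · 0ᵖ ⟫ ∅ → H ⊢ ⊥̇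
  limits-differ d = ⇒-elim d (≤ᴿ-intro ∅ (2⁻ᴿᵖ · 0ᵖ) (absᴿᵖ · (subᴿᵖ · (natᴿᵖ · 0ᵖ) · (natᴿᵖ · 1ᵖ)))
    (≤ℚ-trans (≈⇒≤ (≐⇒≈ (2⁻ᴿ-at 0̇ v₀))) (≤ℚ-trans (≈⇒≥ (nat-frac 1̇))
      (≤ℚ-trans (∣⊖∣-elimʳ ≤ℚ-refl)
        (≤ℚ-trans (≈⇒≤ (⊕-identityˡ _)) (≤ℚ-trans (≈⇒≥ (≐⇒≈ at)) (≤-⊕-frac _ _ _)))))))
    where
    at : ∀ {Δ} {K : List (Fm Δ)} {i} → K ⊢ absᴿᵒ · (subᴿᵒ · (natᴿᵒ · 0̇) · (natᴿᵒ · 1̇)) · i ≐ ∣ natᵒ · 0̇ ⊖ natᵒ · 1̇ ∣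
    at = ≐-trans (absᴿ-def _ _) (Eq-·ʳ absᵒ (≐-trans (subᴿ-def _ _ _) (Eq-· (Eq-·ʳ subᵒ (natᴿ-def _ _)) (natᴿ-def _ _))))

-- Both quantifiers are instantiated in one template substitution, so the first term is not weakened
-- under the second quantifier.
sentence-∀E₂ : ∀ {Γ} {H : List (Fm Γ)} {Θ σ τ} (s : Sub Θ Γ) {ψ} (φ : Fp (τ ∷ σ ∷ [])) (t : Tp Θ σ) (u : Tp Θ τ) →
               ψ ≡ (∀[ σ ] ∀[ τ ] φ) → H ⊢ ⟪ ψ ⟫ ∅ → H ⊢ ⟪ fsub (εᵖ ▹ t ▹ u) φ ⟫ s
sentence-∀E₂ {H = H} {τ = τ} s φ t u refl d = subst (H ⊢_)
  (sym (trans (⟪⟫-fsub s (εᵖ ▹ t ▹ u) φ)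
    (⟪⟫-cong {s = λ x → eval ((εᵖ ▹ t ▹ u) x) s} {∅ ▸ eval t s ▸ eval u s}
      (λ { (here refl) → refl ; (there (here refl)) → refl }) φ)))
  (∀E (∅ ▸ eval t s) φ (∀E ∅ (∀[ τ ] φ) d (eval t s)) (eval u s))

module _ {Γ} {H : List (Fm Γ)} {Y : Tm Γ (𝟏 ⟶ 𝟎)} where

  Arz-contradicts-Inj : H ⊢ ⟪ Arzᵖ ⟫ ∅ → H ⊢ ⟪ I→ℕᵖ x₀ ⟫ (∅ ▸ Y) → H ⊢ Inj Y → H ⊢ ⊥̇
  -- Precision 2^-0 is enough: at n = N, the integral 0 of f_n would be at distance less than 1 from
  -- 1.
  Arz-contradicts-Inj A d I = ∃E s ⊥̇ (∀Eᵖ s (∃[ 𝟎 ] ∀[ 𝟎 ] (x₁ ≼ᵖ x₀ ⇒ T.IntegralsCloseAt (stepFᵖ x₃) (natᴿᵖ · 1ᵖ) x₂ x₀)) 0ᵖ convergence) apart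
    where
    s : Sub ((𝟏 ⟶ 𝟎) ∷ []) Γ
    s = ∅ ▸ Y
    arz : H ⊢ ⟪ T.RiemannIntegrable oneFᵖ ∧̇ (∀[ 𝟎 ] T.RiemannIntegrable (stepFᵖ x₁ · x₀)) ∧̇
                T.LimitOnI (stepFᵖ x₀) oneFᵖ ∧̇ T.UniformlyBounded (stepFᵖ x₀) ⇒ T.IntegralsConverge (stepFᵖ x₀) oneFᵖ ⟫ s
    arz = sentence-∀E₂ s {Arzᵖ} arzBody oneFᵖ (stepFᵖ x₀) refl A
    oneF-integrable : H ⊢ ⟪ T.RiemannIntegrable oneFᵖ ⟫ s
    oneF-integrable = ∧-intro oneF-I→ℝ (∃Iᵖ s (HasIntegralᵖ oneFᵖ x₀) (natᴿᵖ · 1ᵖ) oneF-integral)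
    stepF-integrable : map ↑ᶠ_ H ⊢ ⟪ T.RiemannIntegrable (stepFᵖ x₁ · x₀) ⟫ (∅ ▸ ↑ Y ▸ v₀)
    stepF-integrable = ∧-intro (stepF-I→ℝ (I→ℕ-↑ d) v₀)
      (∃Iᵖ (∅ ▸ ↑ Y ▸ v₀) (HasIntegralᵖ (stepFᵖ x₂ · x₁) x₀) (natᴿᵖ · 0ᵖ) (stepF-integral (Inj-↑ I) v₀))
    convergence : H ⊢ ⟪ ∀[ 𝟎 ] ∃[ 𝟎 ] ∀[ 𝟎 ] (x₁ ≼ᵖ x₀ ⇒ T.IntegralsCloseAt (stepFᵖ x₃) (natᴿᵖ · 1ᵖ) x₂ x₀) ⟫ s
    convergence = ⇒-elim (∀Eᵖ s (HasIntegralᵖ oneFᵖ x₀ ⇒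
        ∀[ 𝟎 ] ∃[ 𝟎 ] ∀[ 𝟎 ] (x₁ ≼ᵖ x₀ ⇒ T.IntegralsCloseAt (stepFᵖ x₄) x₃ x₂ x₀)) (natᴿᵖ · 1ᵖ)
      (⇒-elim arz (∧-intro oneF-integrable (∧-intro (∀-intro stepF-integrable) (∧-intro (stepF-limit Y) (stepF-bounded Y))))))
      oneF-integral
    apart : ⟪ ∀[ 𝟎 ] (x₁ ≼ᵖ x₀ ⇒ T.IntegralsCloseAt (stepFᵖ x₂) (natᴿᵖ · 1ᵖ) 0ᵖ x₀) ⟫ (lift s) ∷ map ↑ᶠ_ H ⊢ ⊥̇
    apart = limits-differ (⇒-elim
      (∀Eᵖ (lift s ▸ v₀) (HasIntegralᵖ (stepFᵖ x₃ · x₁) x₀ ⇒ absᴿᵖ · (subᴿᵖ · x₀ · (natᴿᵖ · 1ᵖ)) <ᴿᵖ 2⁻ᴿᵖ · 0ᵖ) (natᴿᵖ · 0ᵖ)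
        (⇒-elim (∀E (lift s) (x₁ ≼ᵖ x₀ ⇒ T.IntegralsCloseAt (stepFᵖ x₂) (natᴿᵖ · 1ᵖ) 0ᵖ x₀) h₀ v₀) ≼-refl))
      (w (stepF-integral (Inj-↑ I) v₀)))

ninBody : Fp (𝟏 ∷ 𝟏 ∷ (𝟏 ⟶ 𝟎) ∷ [])
ninBody = x₁ ∈Iᵖ ∧̇ x₀ ∈Iᵖ ∧̇ ¬ᵖ (x₁ =ᴿᵖ x₀) ∧̇ (x₂ · x₁ ≐ x₂ · x₀)

¬NIN⇒Inj : ∀ {Γ} {H : List (Fm Γ)} {Y} → H ⊢ ⟪ (∃[ 𝟏 ] ∃[ 𝟏 ] ninBody) ⇒ ⊥̇ ⟫ (∅ ▸ Y) → H ⊢ Inj Y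
¬NIN⇒Inj {Y = Y} d = ∀-intro (∀-intro (⇒-intro (⇒-intro (⇒-intro (raa (⇒-elim
  (w (w (w (w (↑E (∅ ▸ ↑ Y) (¬ᵖ (∃[ 𝟏 ] ∃[ 𝟏 ] ninBody)) (↑E (∅ ▸ Y) (¬ᵖ (∃[ 𝟏 ] ∃[ 𝟏 ] ninBody)) d))))))
  (∃I (∅ ▸ ↑ ↑ Y) (∃[ 𝟏 ] ninBody) v₁ (∃I (∅ ▸ ↑ ↑ Y ▸ v₁) ninBody v₀
    (∧-intro (w h₂) (∧-intro h₂ (∧-intro h₀ h₁)))))))))))

sentence-↑ : ∀ {Γ σ} {H : List (Fm Γ)} (φ : Fp []) → H ⊢ ⟪ φ ⟫ ∅ → map (↑ᶠ_ {σ = σ}) H ⊢ ⟪ φ ⟫ ∅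
sentence-↑ φ d = subst (_ ⊢_) (⟪⟫-cong (λ ()) φ) (↑E ∅ φ d)

Arz⇒NIN : ∀ {H : List (Fm [])} → H ⊢ ⟪ Arzᵖ ⟫ ∅ → H ⊢ ⟪ T.NIN ⟫ ∅
Arz⇒NIN {H} A = ∀-intro (⇒-intro (raa absurd))
  where
  K : List (Fm ((𝟏 ⟶ 𝟎) ∷ []))
  K = ⟪ (∃[ 𝟏 ] ∃[ 𝟏 ] ninBody) ⇒ ⊥̇ ⟫ (∅ ▸ v₀) ∷ ⟪ I→ℕᵖ x₀ ⟫ (∅ ▸ v₀) ∷ map ↑ᶠ_ H
  inj : K ⊢ Inj v₀
  inj = ¬NIN⇒Inj h₀
  absurd : K ⊢ ⊥̇
  absurd = Arz-contradicts-Inj {Y = v₀} (w (w (sentence-↑ Arzᵖ A))) h₁ inj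

-- The templates evaluate to the sentences over the opaque operations.

up-eval : ∀ {Γ Δ σ τ} (s : Sub Γ Δ) (t : Tp Γ τ) → eval (upᵖ {σ = σ} t) (lift s) ≡ ↑ eval t s
up-eval s t = trans (eval-upᵖ (lift s) t) (sym (eval-↑ s t))

module _ {Θ Γ} (s : Sub Θ Γ) (x y : Tp Θ 𝟏) where

  -- Weakening an opaque constant does not compute, so under the quantifier the template and the
  -- formula agree only by `up-eval`. The comparisons below rest on this and its analogue for
  -- equality.
  ≤ᴿ-eq : ⟪ x ≤ᴿᵖ y ⟫ s ≡ (eval x s O.≤ᴿ eval y s)
  ≤ᴿ-eq = cong₂ (λ u v → ∀[ 𝟎 ] (u · v₀ O.≤ℚ v · v₀ O.⊕ 2·2⁻ᵒ · v₀)) (up-eval s x) (up-eval s y)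

  =ᴿ-eq : ⟪ x =ᴿᵖ y ⟫ s ≡ (eval x s O.=ᴿ eval y s)
  =ᴿ-eq = cong₂ (λ u v → ∀[ 𝟎 ] (O.∣ u · v₀ O.⊖ v · v₀ ∣ O.≤ℚ 2·2⁻ᵒ · v₀)) (up-eval s x) (up-eval s y)

  <ᴿ-eq : ⟪ y <ᴿᵖ x ⟫ s ≡ (eval y s O.<ᴿ eval x s)
  <ᴿ-eq = cong (_⇒ ⊥̇) ≤ᴿ-eq

module _ {Γ : Cxt} where

  ∈I-eq : (x : Tm Γ 𝟏) → ⟪ x₀ ∈Iᵖ ⟫ (∅ ▸ x) ≡ (x O.∈I)
  ∈I-eq x = cong₂ (λ a b → O.IsReal x ∧̇ a ∧̇ b) (≤ᴿ-eq (∅ ▸ x) (natᴿᵖ · 0ᵖ) x₀) (≤ᴿ-eq (∅ ▸ x) x₀ (natᴿᵖ · 1ᵖ))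

I→ℕ-eq : ∀ {Γ} (Y : Tm Γ (𝟏 ⟶ 𝟎)) → ⟪ I→ℕᵖ x₀ ⟫ (∅ ▸ Y) ≡ O.I→ℕ Y
I→ℕ-eq Y = cong₂ (λ a b → ∀[ 𝟏 ] ∀[ 𝟏 ] (a ∧̇ b ∧̇ v₁ O.=ᴿ v₀ ⇒ ↑ ↑ Y · v₁ ≐ ↑ ↑ Y · v₀)) (∈I-eq v₁) (∈I-eq v₀)

I→ℝ-eq : ∀ {Γ} (f : Tm Γ (𝟏 ⟶ 𝟏)) → ⟪ I→ℝᵖ x₀ ⟫ (∅ ▸ f) ≡ O.I→ℝ f
I→ℝ-eq f = cong₂ _∧̇_
  (cong (λ a → ∀[ 𝟏 ] (a ⇒ O.IsReal (↑ f · v₀))) (∈I-eq v₀))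
  (cong₂ (λ a b → ∀[ 𝟏 ] ∀[ 𝟏 ] (a ∧̇ b ∧̇ v₁ O.=ᴿ v₀ ⇒ ↑ ↑ f · v₁ O.=ᴿ ↑ ↑ f · v₀)) (∈I-eq v₁) (∈I-eq v₀))

TaggedPartition-eq : ∀ {Γ} (k : Tm Γ 𝟎) x t → ⟪ TaggedPartitionᵖ x₂ x₁ x₀ ⟫ (∅ ▸ k ▸ x ▸ t) ≡ O.TaggedPartition k x t
TaggedPartition-eq k x t = cong₂
  (λ a b → (∀[ 𝟎 ] (v₀ ≼ ↑ k ⇒ O.IsReal (↑ x · v₀))) ∧̇ a ∧̇ b ∧̇
    (∀[ 𝟎 ] (v₀ ≺ ↑ k ⇒ O.IsReal (↑ t · v₀) ∧̇ ↑ x · v₀ O.≤ᴿ ↑ t · v₀ ∧̇ ↑ t · v₀ O.≤ᴿ ↑ x · (v₀ +̇ O.1̇))))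
  (=ᴿ-eq (∅ ▸ k ▸ x ▸ t) (x₁ · 0ᵖ) (natᴿᵖ · 0ᵖ)) (=ᴿ-eq (∅ ▸ k ▸ x ▸ t) (x₁ · x₂) (natᴿᵖ · 1ᵖ))

Mesh-eq : ∀ {Γ} (k : Tm Γ 𝟎) x n → ⟪ Meshᵖ x₂ x₁ x₀ ⟫ (∅ ▸ k ▸ x ▸ n) ≡ O.Mesh<2⁻ k x n
Mesh-eq k x n = cong (λ a → ∀[ 𝟎 ] (v₀ ≺ ↑ k ⇒ a))
  (<ᴿ-eq (lift (∅ ▸ k ▸ x ▸ n)) (2⁻ᴿᵖ · x₁) (subᴿᵖ · (x₂ · (x₀ +ᵖ 1ᵖ)) · (x₂ · x₀)))

SumsWithin-eq : ∀ {Γ} (f : Tm Γ (𝟏 ⟶ 𝟏)) J m n → ⟪ T.SumsWithin x₃ x₂ x₁ x₀ ⟫ (∅ ▸ f ▸ J ▸ m ▸ n) ≡ O.SumsWithin f J m n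
SumsWithin-eq f J m n = cong₂ (λ a b → ∀[ 𝟎 ] ∀[ 𝟎 ⟶ 𝟏 ] ∀[ 𝟎 ⟶ 𝟏 ] (a ⇒ b))
  (cong₂ _∧̇_ (TaggedPartition-eq v₂ v₁ v₀) (Mesh-eq v₂ v₁ (↑ ↑ ↑ n)))
  (<ᴿ-eq (∅ ▸ ↑ ↑ ↑ f ▸ ↑ ↑ ↑ J ▸ ↑ ↑ ↑ m ▸ v₂ ▸ v₁ ▸ v₀) (2⁻ᴿᵖ · x₃) (absᴿᵖ · (subᴿᵖ · riemannSumᵖ x₅ x₂ x₁ x₀ · x₄)))

HasIntegral-eq : ∀ {Γ} (f : Tm Γ (𝟏 ⟶ 𝟏)) J → ⟪ HasIntegralᵖ x₁ x₀ ⟫ (∅ ▸ f ▸ J) ≡ O.HasIntegral f J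
HasIntegral-eq f J = cong (λ a → O.IsReal J ∧̇ (∀[ 𝟎 ] ∃[ 𝟎 ] a)) (SumsWithin-eq (↑ ↑ f) (↑ ↑ J) v₁ v₀)

RiemannIntegrable-eq : ∀ {Γ} (f : Tm Γ (𝟏 ⟶ 𝟏)) → ⟪ T.RiemannIntegrable x₀ ⟫ (∅ ▸ f) ≡ O.RiemannIntegrable f
RiemannIntegrable-eq f = cong₂ (λ a b → a ∧̇ (∃[ 𝟏 ] b)) (I→ℝ-eq f) (HasIntegral-eq (↑ f) v₀)

LimitOnI-eq : ∀ {Γ} (F : Tm Γ (𝟎 ⟶ 𝟏 ⟶ 𝟏)) f → ⟪ T.LimitOnI x₁ x₀ ⟫ (∅ ▸ F ▸ f) ≡ O.LimitOnI F f
LimitOnI-eq F f = cong₂ (λ a b → ∀[ 𝟏 ] (a ⇒ ∀[ 𝟎 ] ∃[ 𝟎 ] ∀[ 𝟎 ] (v₁ ≼ v₀ ⇒ b))) (∈I-eq v₀)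
  (<ᴿ-eq (∅ ▸ ↑ ↑ ↑ ↑ F ▸ ↑ ↑ ↑ ↑ f ▸ v₃ ▸ v₂ ▸ v₀) (2⁻ᴿᵖ · x₁) (absᴿᵖ · (subᴿᵖ · (x₄ · x₀ · x₂) · (x₃ · x₂))))

UniformlyBounded-eq : ∀ {Γ} (F : Tm Γ (𝟎 ⟶ 𝟏 ⟶ 𝟏)) → ⟪ T.UniformlyBounded x₀ ⟫ (∅ ▸ F) ≡ O.UniformlyBounded F
UniformlyBounded-eq F = cong₂ (λ a b → ∃[ 𝟎 ] ∀[ 𝟎 ] ∀[ 𝟏 ] (a ⇒ b)) (∈I-eq v₀)
  (≤ᴿ-eq (∅ ▸ ↑ ↑ ↑ F ▸ v₂ ▸ v₁ ▸ v₀) (absᴿᵖ · (x₃ · x₁ · x₀)) (natᴿᵖ · (x₂ +ᵖ 1ᵖ)))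

IntegralsConverge-eq : ∀ {Γ} (F : Tm Γ (𝟎 ⟶ 𝟏 ⟶ 𝟏)) f → ⟪ T.IntegralsConverge x₁ x₀ ⟫ (∅ ▸ F ▸ f) ≡ O.IntegralsConverge F f
IntegralsConverge-eq F f = cong₂ (λ a b → ∀[ 𝟏 ] (a ⇒ ∀[ 𝟎 ] ∃[ 𝟎 ] ∀[ 𝟎 ] (v₁ ≼ v₀ ⇒ ∀[ 𝟏 ] b)))
  (HasIntegral-eq (↑ f) v₀)
  (cong₂ _⇒_ (HasIntegral-eq (↑ ↑ ↑ ↑ ↑ F · v₁) v₀)
    (<ᴿ-eq (∅ ▸ ↑ v₃ ▸ v₃ ▸ v₀) (2⁻ᴿᵖ · x₁) (absᴿᵖ · (subᴿᵖ · x₀ · x₂))))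

Arz-eq : ⟪ Arzᵖ ⟫ ∅ ≡ O.Arz
Arz-eq = cong₂ (λ a b → ∀[ 𝟏 ⟶ 𝟏 ] ∀[ 𝟎 ⟶ 𝟏 ⟶ 𝟏 ] (a ⇒ b))
  (cong₂ _∧̇_ (RiemannIntegrable-eq v₁)
    (cong₂ _∧̇_ (cong (∀[ 𝟎 ]_) (RiemannIntegrable-eq (v₁ · v₀)))
      (cong₂ _∧̇_ (LimitOnI-eq v₀ v₁) (UniformlyBounded-eq v₀))))
  (IntegralsConverge-eq v₀ v₁)

NIN-eq : ⟪ T.NIN ⟫ ∅ ≡ O.NIN
NIN-eq = cong₂ (λ a b → ∀[ 𝟏 ⟶ 𝟎 ] (a ⇒ b)) (I→ℕ-eq v₀)
  (cong₂ (λ a b → ∃[ 𝟏 ] ∃[ 𝟏 ] (a ∧̇ b ∧̇ O.¬̇ (v₁ O.=ᴿ v₀) ∧̇ v₂ · v₁ ≐ v₂ · v₀)) (∈I-eq v₁) (∈I-eq v₀))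

-- From opaque to concrete operations.

Family : Ty → Set
Family τ = ∀ Γ → Tm Γ τ

module Instance (l r a e e′ : Family 𝟏) (p m : Family (𝟎 ⟶ 𝟎 ⟶ 𝟎)) (n d : Family (𝟎 ⟶ 𝟏)) (aᴿ : Family (𝟏 ⟶ 𝟏))
         (sᴿ : Family (𝟏 ⟶ 𝟏 ⟶ 𝟏))
         (S : ∀ Γ → Tm Γ (𝟏 ⟶ 𝟏) → Tm Γ 𝟎 → Tm Γ (𝟎 ⟶ 𝟏) → Tm Γ (𝟎 ⟶ 𝟏) → Tm Γ 𝟏) =
  Formulas Tm Fm _·_ con v₀ v₁ v₂ v₃ ↑_ _≐_ _≺_ ⊥̇ _∧̇_ _∨̇_ _⇒_ ∀[_]_ ∃[_]_
    (λ {Γ} → l Γ) (λ {Γ} → r Γ) (λ {Γ} → a Γ) (λ {Γ} → e Γ) (λ {Γ} → e′ Γ) (λ {Γ} → p Γ) (λ {Γ} → m Γ)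
    (λ {Γ} → n Γ) (λ {Γ} → d Γ) (λ {Γ} → aᴿ Γ) (λ {Γ} → sᴿ Γ) (λ {Γ} → S Γ)

-- The operations are variables here, so their equalities are matched with `refl`, and exchanging
-- them needs no unfolding inside the sentences.
transport : ∀ {l l′ r r′ a a′ e e′ u u′ : Family 𝟏} {p p′ m m′ : Family (𝟎 ⟶ 𝟎 ⟶ 𝟎)} {n n′ d d′ : Family (𝟎 ⟶ 𝟏)}
  {aᴿ aᴿ′ : Family (𝟏 ⟶ 𝟏)} {sᴿ sᴿ′ : Family (𝟏 ⟶ 𝟏 ⟶ 𝟏)}
  {S S′ : ∀ Γ → Tm Γ (𝟏 ⟶ 𝟏) → Tm Γ 𝟎 → Tm Γ (𝟎 ⟶ 𝟏) → Tm Γ (𝟎 ⟶ 𝟏) → Tm Γ 𝟏} →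
  l ≡ l′ → r ≡ r′ → a ≡ a′ → e ≡ e′ → u ≡ u′ → p ≡ p′ → m ≡ m′ → n ≡ n′ → d ≡ d′ → aᴿ ≡ aᴿ′ → sᴿ ≡ sᴿ′ → S ≡ S′ →
  [] ⊢ Instance.Arz l r a e u p m n d aᴿ sᴿ S ⇒ Instance.NIN l r a e u p m n d aᴿ sᴿ S →
  [] ⊢ Instance.Arz l′ r′ a′ e′ u′ p′ m′ n′ d′ aᴿ′ sᴿ′ S′ ⇒ Instance.NIN l′ r′ a′ e′ u′ p′ m′ n′ d′ aᴿ′ sᴿ′ S′
transport refl refl refl refl refl refl refl refl refl refl refl refl D = D

opaque
  unfolding leftᵒ riemannSumᵒ

  left≡ : (λ Γ → leftᵒ {Γ}) ≡ (λ Γ → leftᵗ {Γ})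
  left≡ = refl
  right≡ : (λ Γ → rightᵒ {Γ}) ≡ (λ Γ → rightᵗ {Γ})
  right≡ = refl
  abs≡ : (λ Γ → absᵒ {Γ}) ≡ (λ Γ → absℚ {Γ})
  abs≡ = refl
  2⁻≡ : (λ Γ → 2⁻ᵒ {Γ}) ≡ (λ Γ → 2⁻ {Γ})
  2⁻≡ = refl
  2·2⁻≡ : (λ Γ → 2·2⁻ᵒ {Γ}) ≡ (λ Γ → 2·2⁻ {Γ})
  2·2⁻≡ = refl
  add≡ : (λ Γ → addᵒ {Γ}) ≡ (λ Γ → addℚ {Γ})
  add≡ = refl
  sub≡ : (λ Γ → subᵒ {Γ}) ≡ (λ Γ → subℚ {Γ})
  sub≡ = refl
  natᴿ≡ : (λ Γ → natᴿᵒ {Γ}) ≡ (λ Γ → natᴿ {Γ})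
  natᴿ≡ = refl
  2⁻ᴿ≡ : (λ Γ → 2⁻ᴿᵒ {Γ}) ≡ (λ Γ → 2⁻ᴿ {Γ})
  2⁻ᴿ≡ = refl
  absᴿ≡ : (λ Γ → absᴿᵒ {Γ}) ≡ (λ Γ → absᴿ {Γ})
  absᴿ≡ = refl
  riemannSum≡ : (λ Γ → riemannSumᵒ {Γ}) ≡ (λ Γ → riemannSum {Γ})
  riemannSum≡ = refl

module Opaque = Instance (λ Γ → leftᵒ) (λ Γ → rightᵒ) (λ Γ → absᵒ) (λ Γ → 2⁻ᵒ) (λ Γ → 2·2⁻ᵒ) (λ Γ → addᵒ) (λ Γ → subᵒ)
  (λ Γ → natᴿᵒ) (λ Γ → 2⁻ᴿᵒ) (λ Γ → absᴿᵒ) (λ Γ → subᴿᵒ) (λ Γ → riemannSumᵒ)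

module Standard = Instance (λ Γ → leftᵗ) (λ Γ → rightᵗ) (λ Γ → absℚ) (λ Γ → 2⁻) (λ Γ → 2·2⁻) (λ Γ → addℚ) (λ Γ → subℚ)
  (λ Γ → natᴿ) (λ Γ → 2⁻ᴿ) (λ Γ → absᴿ) (λ Γ → subᴿ) (λ Γ → riemannSum)

standardise : [] ⊢ Opaque.Arz ⇒ Opaque.NIN → [] ⊢ Standard.Arz ⇒ Standard.NIN
standardise = transport
  {l = λ Γ → leftᵒ {Γ}} {l′ = λ Γ → leftᵗ {Γ}}
  {r = λ Γ → rightᵒ {Γ}} {r′ = λ Γ → rightᵗ {Γ}}
  {a = λ Γ → absᵒ {Γ}} {a′ = λ Γ → absℚ {Γ}}
  {e = λ Γ → 2⁻ᵒ {Γ}} {e′ = λ Γ → 2⁻ {Γ}}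
  {u = λ Γ → 2·2⁻ᵒ {Γ}} {u′ = λ Γ → 2·2⁻ {Γ}}
  {p = λ Γ → addᵒ {Γ}} {p′ = λ Γ → addℚ {Γ}}
  {m = λ Γ → subᵒ {Γ}} {m′ = λ Γ → subℚ {Γ}}
  {n = λ Γ → natᴿᵒ {Γ}} {n′ = λ Γ → natᴿ {Γ}}
  {d = λ Γ → 2⁻ᴿᵒ {Γ}} {d′ = λ Γ → 2⁻ᴿ {Γ}}
  {aᴿ = λ Γ → absᴿᵒ {Γ}} {aᴿ′ = λ Γ → absᴿ {Γ}}
  {sᴿ = λ Γ → subᴿᵒ {Γ}} {sᴿ′ = λ Γ → subᴿ {Γ}}
  {S = λ Γ → riemannSumᵒ {Γ}} {S′ = λ Γ → riemannSum {Γ}}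
  left≡ right≡ abs≡ 2⁻≡ 2·2⁻≡ add≡ sub≡ natᴿ≡ 2⁻ᴿ≡ absᴿ≡ subᴿ≡ riemannSum≡

theorem3p6 : RCA₀ω⊢ (Defs.Arz ⇒ Defs.NIN)
theorem3p6 = standardise
  (subst₂ (λ φ ψ → [] ⊢ φ ⇒ ψ) Arz-eq NIN-eq (⇒-intro (Arz⇒NIN h₀)))
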